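{- Let $p$ be a prime and $\Phi=(\phi_1,\dots,\phi_k)$ a system of linear forms $\phi_j\colon\mathbb{F}_p^d\to\mathbb{F}_p$, regarded as a linear datum with index set $[k]$. Let $i\in[k]$, and suppose $s=s(\Phi,i)<\infty$ and $s(\Phi)\le s+1$. Then $\Phi\vdash^M_\gamma\mathrm{gc}_s(\mathbb{F}_p)$ where $\gamma(\triangle)=(i,0)$ or $(i,1)$ and $M\ll k^3(\log k+\log\log(10L))$, where $L$ is such that $\phi_j(x)=\sum_\ell a_{j\ell}x_\ell$ with integers $|a_{j\ell}|\le L$ (absolute implied constant).
   Context: A system of linear forms $\Phi$ is regarded as the linear datum with $V=\mathbb{F}_p^d$, $W_j=\mathbb{F}_p$, maps $\phi_j$. In general a linear datum $(I,V,(W_i),(\phi_i))$ has a finite index set, finite-dimensional $\mathbb{F}_p$-spaces and linear maps $\phi_i\colon V\to W_i$. $s(\Phi,i)$ is the largest $t\ge0$ with $\phi_i^{\otimes t}\in\operatorname{span}(\phi_j^{\otimes t}:j\ne i)$ in $((\mathbb{F}_p^d)^*)^{\otimes t}$ ($\infty$ if no largest exists); $s(\Phi)=\max_i s(\Phi,i)$. $\mathrm{gc}_s(\mathbb{F}_p)$ is the datum with $V=\mathbb{F}_p^{s+1}$, indices $\triangle,1,\dots,s+1$, $W_\triangle=\mathbb{F}_p$, $W_r=\mathbb{F}_p^s$, $\phi_\triangle$ the sum of coordinates and $\phi_r$ omitting the $r$-th coordinate. Morphisms: with $W_*=\{0\}$, $\phi_*=0$, a morphism $\Psi\to\Phi$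 of shape $\alpha\colon I^\Phi\to I^\Psi\cup\{*\}$ is a linear $\theta\colon V^\Psi\to V^\Phi$ and linear $\sigma_j\colon W^\Psi_{\alpha(j)}\to W^\Phi_j$ with $\sigma_j\circ\phi^\Psi_{\alpha(j)}=\phi^\Phi_j\circ\theta$; it respects $j$ if $\alpha(j)\ne*$, is not the image of another index, $W^\Phi_j=W^\Psi_{\alpha(j)}$ and $\sigma_j=\mathrm{id}$. Self-joining $\Phi+_S\Phi$: indices $(L,i),(R,i)$ for $i\notin S$, space $\{(v_0,v_1):\phi_i(v_0)=\phi_i(v_1)\,\forall i\in S\}$, maps $\phi_i(v_0)$ and $\phi_i(v_1)$. For a partial $\gamma\colon I^\Psi\to I^\Phi\times\{0,1\}$, $\Phi\vdash^k_\gamma\Psi$ is defined recursively: (a) a morphism $\Theta\colon\Psi\to\Phi$ exists, $k=0$, $\gamma=\{\alpha^\Theta(i)\mapsto(i,0):\Theta\text{ respects }i\}$; (b) $\Psi=\Phi+_S\Phi$, $\gamma(L,i)=(i,0)$, $\gamma(R,i)=(i,1)$; (c) composition $\Phi\vdash^{k_1}_{\gamma_1}\Xi\vdash^{k_2}_{\gamma_2}\Psi$ with $k=k_1+k_2$ and $\gamma(j)=(i,a_1+a_2\bmod2)$ when $\gamma_2(j)=(\ell,a_2)$, $\gamma_1(\ell)=(i,a_1)$; (d) $\Phi\vdash^{k'}_{\gamma'}\Psi$ with $k'\le k$ and $\gamma\subseteq\gamma'$. -}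

module Defs where

open import Data.Nat as ℕ using (ℕ; zero; suc; NonZero; _≤_)
open import Data.Nat.DivMod using (_mod_)
open import Data.Fin as Fin using (Fin; toℕ; _↑ˡ_; _↑ʳ_; punchIn)
open import Data.Bool using (Bool; true; false; _xor_; if_then_else_)
open import Data.Maybe using (Maybe; just; nothing)
open import Data.Product using (Σ; ∃; _×_; _,_; proj₁; proj₂)
open import Data.Sum using (_⊎_; inj₁; inj₂)
open import Data.Empty using (⊥)
open import Data.Integer as ℤ using (ℤ; +_; -[1+_])
open import Data.List using (List; map; allFin; _∷_)
open import Data.List.Membership.Propositional using (_∈_)
open import Data.List.Membership.Propositional.Properties using (∈-map⁺; ∈-allFin)
open import Data.List.Relation.Unary.Any using (here; there)
open import Data.Vec.Functional using (Vector; foldr; _++_)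
open import Relation.Binary.PropositionalEquality using (_≡_; _≢_; refl)
open import Relation.Nullary using (does)

Finite : Set → Set
Finite I = Σ (List I) λ xs → ∀ x → x ∈ xs

finite-Fin : ∀ n → Finite (Fin n)
finite-Fin n = allFin n , ∈-allFin

finite-Maybe : ∀ {I : Set} → Finite I → Finite (Maybe I)
finite-Maybe (xs , h) = (nothing ∷ map just xs) , λ { nothing → here refl ; (just x) → there (∈-map⁺ just (h x)) }

module Over (p : ℕ) .{{_ : NonZero p}} where

  F : Set
  F = Fin p

  0F 1F : F
  0F = 0 mod p
  1F = 1 mod p

  _+F_ _*F_ : F → F → F
  a +F b = (toℕ a ℕ.+ toℕ b) mod p
  a *F b = (toℕ a ℕ.* toℕ b) mod p

  -F_ : F → F
  -F a = (p ℕ.∸ toℕ a) mod p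

  ℤ→F : ℤ → F
  ℤ→F (+ n) = n mod p
  ℤ→F -[1+ n ] = -F ((suc n) mod p)

  ΣF : ∀ {n} → Vector F n → F
  ΣF = foldr _+F_ 0F

  ΠF : ∀ {n} → Vector F n → F
  ΠF = foldr _*F_ 1F

  Mat : ℕ → ℕ → Set
  Mat m n = Fin m → Fin n → F

  _·_ : ∀ {m n} → Mat m n → Vector F n → Vector F m
  (A · v) c = ΣF (λ k → A c k *F v k)

  dot : ∀ {n} → Vector F n → Vector F n → F
  dot u v = ΣF (λ k → u k *F v k)

  δ : ℕ → ℕ → F
  δ a b = if does (a ℕ.≟ b) then 1F else 0F

  -- Linear data.  V is the subspace of F^n cut out by the linear
  -- constraints cons r (r : R); W_i = F^(dimW i); φ_i is a matrix.
  record Datum : Set₁ where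
    field
      I      : Set
      finI   : Finite I
      n      : ℕ
      R      : Set
      cons   : R → Vector F n
      dimW   : I → ℕ
      φ      : (i : I) → Mat (dimW i) n

    InV : Vector F n → Set
    InV v = ∀ r → dot (cons r) v ≡ 0F

    -- the extra index * with W_* = {0}, φ_* = 0
    dimW* : Maybe I → ℕ
    dimW* nothing  = 0
    dimW* (just i) = dimW i

    φ* : (i : Maybe I) → Mat (dimW* i) n
    φ* nothing  = λ ()
    φ* (just i) = φ i
  open Datum public

  record Morphism (Ψ Φ : Datum) : Set where
    field
      α      : I Φ → Maybe (I Ψ)
      θ      : Mat (n Φ) (n Ψ)
      θ-into : ∀ v → InV Ψ v → InV Φ (θ · v)
      σ      : (j : I Φ) → Mat (dimW Φ j) (dimW* Ψ (α j))
      comm   : ∀ j v → InV Ψ v → σ j · (φ* Ψ (α j) · v) ≡ φ Φ j · (θ · v)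

    Respects : I Φ → Set
    Respects j = Σ (I Ψ) λ i → (α j ≡ just i)
      × (∀ j' → α j' ≡ just i → j' ≡ j)
      × (dimW Φ j ≡ dimW* Ψ (α j))
      × (∀ c c' → σ j c c' ≡ δ (toℕ c) (toℕ c'))
  open Morphism public

  -- partial maps I^Ψ ⇀ I^Φ × {0,1}, as (functional) relations; false = 0, true = 1
  PMap : Datum → Datum → Set₁
  PMap Ψ Φ = I Ψ → I Φ × Bool → Set

  -- Self-joining Φ +_S Φ, S ⊆ I given by a Bool-valued predicate.
  -- Index (false , i) = (L,i), (true , i) = (R,i), for i ∉ S.
  -- V = {(v0,v1) ∈ F^(n+n) : v0,v1 ∈ V, φ_i v0 = φ_i v1 for i ∈ S}.
  module _ (Φ : Datum) (S : I Φ → Bool) where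
    SelfJoinI : Set
    SelfJoinI = Bool × Σ (I Φ) λ i → S i ≡ false

    selfJoin : Finite SelfJoinI → Datum
    selfJoin fin = record
      { I    = SelfJoinI
      ; finI = fin
      ; n    = n Φ ℕ.+ n Φ
      ; R    = (R Φ ⊎ R Φ) ⊎ (Σ (I Φ) λ i → (S i ≡ true) × Fin (dimW Φ i))
      ; cons = λ { (inj₁ (inj₁ r)) → cons Φ r ++ (λ _ → 0F)
                 ; (inj₁ (inj₂ r)) → (λ _ → 0F) ++ cons Φ r
                 ; (inj₂ (i , _ , c)) → φ Φ i c ++ (λ k → -F (φ Φ i c k)) }
      ; dimW = λ x → dimW Φ (proj₁ (proj₂ x))
      ; φ    = λ { (false , i , _) c → φ Φ i c ++ (λ _ → 0F)
                 ; (true , i , _) c → (λ _ → 0F) ++ φ Φ i c }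
      }

  fromMorphism : ∀ {Ψ Φ} → Morphism Ψ Φ → PMap Ψ Φ
  fromMorphism Θ y (i , b) = (b ≡ false) × (α Θ i ≡ just y) × Respects Θ i

  selfJoinMap : ∀ Φ S fin → PMap (selfJoin Φ S fin) Φ
  selfJoinMap Φ S fin (b , i , _) (i' , b') = (i ≡ i') × (b ≡ b')

  composeMap : ∀ {Φ Ξ Ψ} → PMap Ξ Φ → PMap Ψ Ξ → PMap Ψ Φ
  composeMap {Ξ = Ξ} γ₁ γ₂ j (i , a) =
    Σ (I Ξ) λ ℓ → Σ Bool λ a₁ → Σ Bool λ a₂ → γ₂ j (ℓ , a₂) × γ₁ ℓ (i , a₁) × (a ≡ a₁ xor a₂)

  data Derives : (Φ Ψ : Datum) → ℕ → PMap Ψ Φ → Set₂ where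
    morph   : ∀ {Φ Ψ} (Θ : Morphism Ψ Φ) → Derives Φ Ψ 0 (fromMorphism Θ)
    join    : ∀ Φ S fin → Derives Φ (selfJoin Φ S fin) 1 (selfJoinMap Φ S fin)
    compose : ∀ {Φ Ξ Ψ k₁ k₂ γ₁ γ₂} → Derives Φ Ξ k₁ γ₁ → Derives Ξ Ψ k₂ γ₂
            → Derives Φ Ψ (k₁ ℕ.+ k₂) (composeMap {Φ} {Ξ} {Ψ} γ₁ γ₂)
    weaken  : ∀ {Φ Ψ k k' γ γ'} → Derives Φ Ψ k' γ' → k' ≤ k
            → (∀ j x → γ j x → γ' j x) → Derives Φ Ψ k γ

  systemDatum : (k d : ℕ) → Mat k d → Datum
  systemDatum k d A = record
    { I = Fin k ; finI = finite-Fin k ; n = d ; R = ⊥ ; cons = λ ()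
    ; dimW = λ _ → 1 ; φ = λ j _ → A j }

  -- φ^{⊗t} as an element of ((F^d)^*)^{⊗t} ≅ functions (Fin t → Fin d) → F
  tensorPow : ∀ {d} → Vector F d → (t : ℕ) → (Fin t → Fin d) → F
  tensorPow a t ℓ = ΠF (λ r → a (ℓ r))

  InSpan : ∀ {k d} → Mat k d → Fin k → ℕ → Set
  InSpan {k} A i t = Σ (Vector F k) λ c → (c i ≡ 0F)
    × (∀ ℓ → tensorPow (A i) t ℓ ≡ ΣF (λ j → c j *F tensorPow (A j) t ℓ))

  IsS : ∀ {k d} → Mat k d → Fin k → ℕ → Set
  IsS A i s = InSpan A i s × (∀ t → InSpan A i t → t ≤ s)

  -- gc_s(F_p): V = F^(s+1); index nothing = △, just r = r; φ_△ = sum, φ_r = omit coordinate r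
  gc : ℕ → Datum
  gc s = record
    { I = Maybe (Fin (suc s)) ; finI = finite-Maybe (finite-Fin (suc s))
    ; n = suc s ; R = ⊥ ; cons = λ ()
    ; dimW = λ { nothing → 1 ; (just _) → s }
    ; φ = λ { nothing _ _ → 1F ; (just r) c k → δ (toℕ k) (toℕ (punchIn r c)) } }

  △ : ∀ {s} → I (gc s)
  △ = nothing

  IntLift : ∀ {k d} → Mat k d → (Fin k → Fin d → ℤ) → Set
  IntLift A a = ∀ j ℓ → A j ℓ ≡ ℤ→F (a j ℓ)

{-# OPTIONS --safe #-}
module Submission where

-- A derivation only has to produce, inside an iterated self-joining, s+1 directions such that every
-- surviving form but one copy of φ_i vanishes in some direction.  By downward induction on t one attaches
-- to every form φ_j a copy of gc_t.  If gc_{t+1} is attached to all forms but φ_i, a copy of Φ moved in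
-- t+1 directions b_0,…,b_t leaves at φ_l a nondegenerate contribution that only depends on the product
-- ∏_r φ_l(b_r): gadgets made of copies of gc_{t+1} move the coefficients of all directions into the first
-- one, moving an integer n by O(log log n) joins since the movable numbers are closed under
-- (m, n, r) ↦ mn - r.  If φ_i^{⊗(t+1)} is not in the span of the other powers, some tensor
-- b_0 ⊗ … ⊗ b_t with φ_i(b_r) ≠ 0 is a combination of at most k tensors having a factor in the kernel of
-- φ_i, as far as the φ_l^{⊗(t+1)} with l ≠ i can see.  Arranging the corresponding copies in a cycle
-- cancels all contributions except that of φ_i, which gives gc_t.

open import Defs
open import Algebra.Bundles using (CommutativeRing)
open import Algebra.Structures using (IsCommutativeRing)
open import Data.Bool using (Bool; true; false; if_then_else_; _∨_)
open import Data.Empty using (⊥; ⊥-elim)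
open import Data.Fin using (Fin; zero; suc; _≟_; fromℕ<; punchIn; splitAt; toℕ)
open import Data.Fin.Properties using (any?; punchIn-injective; punchInᵢ≢i; toℕ-fromℕ<; toℕ-injective; toℕ<n)
open import Data.Integer using (ℤ; ∣_∣; -[1+_]) renaming (+_ to fromNat)
open import Data.List using (List; []; _∷_; _++_; allFin; drop; length; map; take)
open import Data.List.Membership.Propositional using (_∈_)
open import Data.List.Membership.Propositional.Properties using (∈-++⁺ˡ; ∈-++⁺ʳ; ∈-allFin; ∈-map⁺)
open import Data.List.Properties using (length-drop; length-map; length-tabulate; length-take)
open import Data.List.Relation.Unary.Any using (here; there)
open import Data.Maybe using (Maybe; just; maybe; nothing)
open import Data.Maybe.Properties using (just-injective)
open import Data.Nat as ℕ using (ℕ; zero; suc; NonZero; _≤_; _<_; _<?_; _^_; _/_; _%_; z≤n; s≤s; ⌊_/2⌋; ⌈_/2⌉)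
open import Data.Nat.Coprimality using (coprime-Bézout; prime⇒coprime)
open import Data.Nat.DivMod using (_mod_; %-distribˡ-*; %-distribˡ-+; m%n<n; m*n%n≡0; m<n*o⇒m/o<n; m<n⇒m%n≡m; m≡m%n+[m/n]*n; n%n≡0)
open import Data.Nat.GCD using (module Bézout)
open import Data.Nat.Induction using (<-rec)
open import Data.Nat.Logarithm using (⌊log₂_⌋; ⌊log₂⌊n/2⌋⌋≡⌊log₂n⌋∸1; ⌊log₂⌋-mono-≤)
open import Data.Nat.Primality using (Prime)
import Data.Nat.Properties as ℕ
open import Data.Nat.Solver using (module +-*-Solver)
open import Data.Product using (Σ; _×_; _,_; proj₁; proj₂)
open import Data.Sum using (_⊎_; inj₁; inj₂)
open import Data.Unit using (⊤; tt)
open import Data.Vec as Vec using (Vec; []; _∷_; lookup)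
open import Data.Vec.Functional as V using (Vector; removeAt; updateAt) renaming (_∷_ to _◃_)
open import Data.Vec.Functional.Properties using (updateAt-minimal; updateAt-updates)
open import Function using (_∘_)
open import Level using (0ℓ)
open import Relation.Binary.Definitions using (DecidableEquality)
open import Relation.Binary.PropositionalEquality
open import Relation.Binary.PropositionalEquality.WithK using (≡-irrelevant)
open import Relation.Nullary using (Dec; yes; no; ¬_; does)
open import Relation.Nullary.Decidable using (dec-false; dec-true; decidable-stable; map′; ¬?)

-- Two difficulties shape the argument. The combination of tensors has arbitrary coefficients in the
-- field, too large to be moved between directions in few rounds; each is therefore absorbed into
-- direction 0, where the product is collected and from which nothing has to move. Only entries of
-- the forms and differences of two products of entries remain to be moved, so integers up to L²
-- suffice. Secondly, a system seen from φ_j needs something attached at φ_i before the level lemma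
-- applies to it, yet φ_i is the output and must stay bare. A descent step hence works with three
-- copies: one supplies φ_i of another, which in turn supplies φ_j of the first.
--
-- The hypothesis on s(Φ) allows such steps for all forms down to order s + 1; the last step, to
-- order s, takes place at φ_i only. In the bound one factor k counts the levels, one the forms
-- treated at each level and one the gadgets attached to a single copy; log k + log log L is the
-- number of rounds that build a gadget, its first term coming from the up to k directions.

record Field : Set₁ where
  infixl 6 _+_
  infixl 7 _*_
  infix 8 -_
  field
    F : Set
    _+_ _*_ : F → F → F
    -_ : F → F
    0# 1# : F
    isCommutativeRing : IsCommutativeRing _≡_ _+_ _*_ -_ 0# 1#
    _≟F_ : DecidableEquality F
    inverse : ∀ x → x ≢ 0# → Σ F λ y → y * x ≡ 1#

  commutativeRing : CommutativeRing 0ℓ 0ℓ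
  commutativeRing = record { isCommutativeRing = isCommutativeRing }

-- levelCost: four joins for each of suc (q + 3 + h) rounds, in each of k gadgets, and suc q joins closing up
-- a cycle of 2 ^ suc q copies.  A step of a sweep applies the level lemma twice.
levelCost sweepCost totalCost : ℕ → ℕ → ℕ → ℕ
levelCost k q h = k ℕ.* (suc (q ℕ.+ (3 ℕ.+ h)) ℕ.* 4) ℕ.+ suc q
sweepCost k q h = k ℕ.* (2 ℕ.+ (levelCost k q h ℕ.+ levelCost k q h))
totalCost k q h = k ℕ.* 1 ℕ.+ (k ℕ.* sweepCost k q h ℕ.+ levelCost k q h)

module Theory (K : Field) where

  open Field K public
  open CommutativeRing commutativeRing public using (+-assoc; +-comm; +-identityˡ; +-identityʳ; *-assoc; *-comm; *-identityˡ; *-identityʳ; distribˡ; distribʳ; zeroˡ; zeroʳ; -‿inverseˡ; -‿inverseʳ; semiring; *-commutativeMonoid)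
  open import Algebra.Properties.Semiring.Sum semiring public using (sum; sum-cong-≗; sum-remove; ∑-distrib-+; ∑-comm; sum-replicate-zero; *-distribˡ-sum; *-distribʳ-sum)

  open import Algebra.Properties.CommutativeSemigroup (CommutativeRing.*-commutativeSemigroup commutativeRing) public using () renaming (x∙yz≈y∙xz to *-swap)
  open import Algebra.Properties.CommutativeSemigroup (CommutativeRing.+-commutativeSemigroup commutativeRing) public using () renaming (interchange to +-interchange)
  open import Algebra.Properties.CommutativeMonoid.Sum *-commutativeMonoid public using () renaming (sum to prod; sum-cong-≗ to prod-cong-≗; sum-remove to prod-remove)
  open import Algebra.Properties.Ring (CommutativeRing.ring commutativeRing) public using (-‿distribˡ-*; -‿distribʳ-*; -‿+-comm; -‿involutive; -0#≈0#; +-inverseˡ-unique)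

  -- Ports, joins and derivations

  infix 4 _≈[_]_
  _≈[_]_ : ∀ {n} → Vector F n → Fin n → Vector F n → Set
  y ≈[ r ] y' = ∀ c → c ≢ r → y c ≡ y' c

  -- A datum seen from one of its forms, called out; rel ι x y says that x and y agree on the form ι.  The
  -- linear structure is forgotten: from a map θ one recovers a linear one by taking differences θ(e_r) - θ(0).
  record Port : Set₁ where
    field
      P       : Set
      out     : P → F
      I       : Set
      rel     : I → P → P → Set
      rfl     : ∀ ι x → rel ι x x
      sec     : F → P
      out-sec : ∀ e → out (sec e) ≡ e

    rel-≡ : ∀ ι {x y} → x ≡ y → rel ι x y
    rel-≡ ι refl = rfl ι _

  open Port public

  Determines : (Y' Y : Port) → (P Y' → P Y) → I Y → I Y' → Set
  Determines Y' Y θ ι κ = ∀ x y → rel Y' κ x y → rel Y ι (θ x) (θ y)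

  -- This is a morphism from `Y'` to `Y` respecting the output, so it points against `Y ⊢[ 0 ] Y'`.
  -- Its shape is the first component of `dep`.
  record Sim (Y' Y : Port) : Set where
    field
      θ     : P Y' → P Y
      out-θ : ∀ x → out Y (θ x) ≡ out Y' x
      dep   : ∀ ι → Σ (I Y') (Determines Y' Y θ ι)

  open Sim public

  -- atom is the second copy of the form out.
  data JoinI (Y : Port) (S : I Y → Bool) : Set where
    left right : ∀ ι → S ι ≡ false → JoinI Y S
    atom       : JoinI Y S

  Join : (Y : Port) → (I Y → Bool) → Port
  Join Y S = record
    { P = Σ (P Y × P Y) λ { (x , x') → ∀ ι → S ι ≡ true → rel Y ι x x' }
    ; out = λ { ((x , _) , _) → out Y x }
    ; I = JoinI Y S
    ; rel = λ { (left ι _) ((x , _) , _) ((y , _) , _) → rel Y ι x y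
              ; (right ι _) ((_ , x') , _) ((_ , y') , _) → rel Y ι x' y'
              ; atom ((_ , x') , _) ((_ , y') , _) → out Y x' ≡ out Y y' }
    ; rfl = λ { (left ι _) _ → rfl Y ι _ ; (right ι _) _ → rfl Y ι _ ; atom _ → refl }
    ; sec = λ e → (sec Y e , sec Y e) , λ ι _ → rfl Y ι _
    ; out-sec = out-sec Y
    }

  infix 3 _⊢[_]_
  data _⊢[_]_ : Port → ℕ → Port → Set₁ where
    sim   : ∀ {Y Y'} → Sim Y' Y → Y ⊢[ 0 ] Y'
    join  : ∀ {Y} S → Y ⊢[ 1 ] Join Y S
    _▸_   : ∀ {Y Z W m n} → Y ⊢[ m ] Z → Z ⊢[ n ] W → Y ⊢[ m ℕ.+ n ] W
    relax : ∀ {Y Z m n} → m ≤ n → Y ⊢[ m ] Z → Y ⊢[ n ] Z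

  infixr 5 _▸_

  sim-id : ∀ {Y} → Sim Y Y
  sim-id = record { θ = λ x → x ; out-θ = λ _ → refl ; dep = λ ι → ι , λ _ _ r → r }

  ⊢-refl : ∀ {Y} → Y ⊢[ 0 ] Y
  ⊢-refl = sim sim-id

  _₀◂_ : ∀ {Y Z W n} → Y ⊢[ n ] Z → Z ⊢[ 0 ] W → Y ⊢[ n ] W
  _₀◂_ {n = n} d e = relax (ℕ.≤-reflexive (ℕ.+-identityʳ n)) (d ▸ e)

  infixl 6 _₀◂_

  record JoinSim (Y Y' : Port) : Set where
    field
      S     : I Y → Bool
      θL θR : P Y' → P Y
      out-L : ∀ x → out Y (θL x) ≡ out Y' x
      agree : ∀ x ι → S ι ≡ true → rel Y ι (θL x) (θR x)
      dep-L : ∀ ι → S ι ≡ false → Σ (I Y') (Determines Y' Y θL ι)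
      dep-R : ∀ ι → S ι ≡ false → Σ (I Y') (Determines Y' Y θR ι)
      dep-O : Σ (I Y') λ κ → ∀ x y → rel Y' κ x y → out Y (θR x) ≡ out Y (θR y)

  joinSim : ∀ {Y Y'} → JoinSim Y Y' → Y ⊢[ 1 ] Y'
  joinSim {Y} {Y'} J = join S ▸ sim (record
    { θ = λ x → (θL x , θR x) , agree x
    ; out-θ = out-L
    ; dep = λ { (left ι p) → dep-L ι p ; (right ι p) → dep-R ι p ; atom → dep-O } })
    where open JoinSim J

  -- Gluing ports into contexts

  -- A datum with two distinguished forms; the port to be developed is glued at `hole`. The sections
  -- `msec` and `hsec` rebuild a whole point from one value, so in a copy that is not of interest
  -- every form becomes a function of a single output.
  record Ctx : Set₁ where
    field
      P       : Set
      main    : P → F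
      hole    : P → F
      I       : Set
      rel     : I → P → P → Set
      rfl     : ∀ ι x → rel ι x x
      msec    : F → P
      main-msec : ∀ e → main (msec e) ≡ e
      hsec    : F → P
      hole-hsec : ∀ e → hole (hsec e) ≡ e

  plug : Ctx → Port → Port
  plug C Y = record
    { P = Σ (C.P × P Y) λ { (c , y) → C.hole c ≡ out Y y }
    ; out = λ { ((c , _) , _) → C.main c }
    ; I = C.I ⊎ I Y
    ; rel = λ { (inj₁ ι) ((c , _) , _) ((c' , _) , _) → C.rel ι c c'
              ; (inj₂ ι) ((_ , y) , _) ((_ , y') , _) → rel Y ι y y' }
    ; rfl = λ { (inj₁ ι) _ → C.rfl ι _ ; (inj₂ ι) _ → rfl Y ι _ }
    ; sec = λ e → (C.msec e , sec Y (C.hole (C.msec e))) , sym (out-sec Y _)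
    ; out-sec = C.main-msec
    }
    where module C = Ctx C

  -- In the second copy the context is rebuilt from the value at the hole alone, by hsec.
  plug-⊢ : ∀ (C : Ctx) {Y Y' n} → Y ⊢[ n ] Y' → plug C Y ⊢[ n ] plug C Y'
  plug-⊢ C (sim s) = sim (record
    { θ = λ { ((c , y) , e) → (c , θ s y) , trans e (sym (out-θ s y)) }
    ; out-θ = λ _ → refl
    ; dep = λ { (inj₁ ι) → inj₁ ι , λ _ _ r → r
              ; (inj₂ ι) → inj₂ (proj₁ (dep s ι)) , λ _ _ r → proj₂ (dep s ι) _ _ r } })
  plug-⊢ C {Y} (join S) = joinSim (record
    { S = λ { (inj₁ _) → false ; (inj₂ ι) → S ι }
    ; θL = λ { ((c , ((x , _) , _)) , e) → (c , x) , e }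
    ; θR = λ { ((_ , ((_ , x') , _)) , _) → (Ctx.hsec C (out Y x') , x') , Ctx.hole-hsec C _ }
    ; out-L = λ _ → refl
    ; agree = λ { ((_ , (_ , ag)) , _) (inj₂ ι) p → ag ι p }
    ; dep-L = λ { (inj₁ ι) _ → inj₁ ι , λ _ _ r → r
                ; (inj₂ ι) p → inj₂ (left ι p) , λ _ _ r → r }
    ; dep-R = λ { (inj₁ ι) _ → inj₂ atom , λ _ _ r → subst (Ctx.rel C ι _) (cong (Ctx.hsec C) r) (Ctx.rfl C ι _)
                ; (inj₂ ι) p → inj₂ (right ι p) , λ _ _ r → r }
    ; dep-O = inj₂ atom , λ _ _ r → cong (λ e → Ctx.main C (Ctx.hsec C e)) r
    })
  plug-⊢ C (d ▸ e) = plug-⊢ C d ▸ plug-⊢ C e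
  plug-⊢ C (relax m≤n d) = relax m≤n (plug-⊢ C d)

  sum-ε : ∀ {n} (y : Vector F n) → (∀ c → y c ≡ 0#) → sum y ≡ 0#
  sum-ε {n} y h = trans (sum-cong-≗ h) (sum-replicate-zero n)

  sum-≗ : ∀ {n} (y y' : Vector F n) → y ≗ y' → sum y ≡ sum y'
  sum-≗ y y' h = sum-cong-≗ h

  sum-single : ∀ {n} (c : Fin n) (y : Vector F n) → (∀ r → r ≢ c → y r ≡ 0#) → sum y ≡ y c
  sum-single {suc n} c y h = trans (sum-remove {i = c} y)
    (trans (cong (y c +_) (sum-ε (λ r → y (punchIn c r)) λ r → h (punchIn c r) (punchInᵢ≢i c r))) (+-identityʳ _))

  unit : ∀ {n} → Fin n → Vector F n
  unit r c = if does (c ≟ r) then 1# else 0#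

  unit-same : ∀ {n} (r : Fin n) → unit r r ≡ 1#
  unit-same r = cong (if_then 1# else 0#) (dec-true (r ≟ r) refl)

  unit-off : ∀ {n} {r c : Fin n} → c ≢ r → unit r c ≡ 0#
  unit-off {r = r} {c} c≢r = cong (if_then 1# else 0#) (dec-false (c ≟ r) c≢r)

  sum-unit : ∀ {n} (g : Vector F n) r → sum (λ c → g c * unit r c) ≡ g r
  sum-unit g r = trans (sum-single r (λ c → g c * unit r c) (λ c c≢r → trans (cong (g c *_) (unit-off c≢r)) (zeroʳ _)))
    (trans (cong (g r *_) (unit-same r)) (*-identityʳ _))

  fromℕ : ℕ → F
  fromℕ zero = 0#
  fromℕ (suc n) = 1# + fromℕ n

  fromℕ-+ : ∀ m n → fromℕ (m ℕ.+ n) ≡ fromℕ m + fromℕ n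
  fromℕ-+ zero n = sym (+-identityˡ _)
  fromℕ-+ (suc m) n = trans (cong (1# +_) (fromℕ-+ m n)) (sym (+-assoc _ _ _))

  fromℕ-* : ∀ m n → fromℕ (m ℕ.* n) ≡ fromℕ m * fromℕ n
  fromℕ-* zero n = sym (zeroˡ _)
  fromℕ-* (suc m) n = trans (fromℕ-+ n (m ℕ.* n)) (trans (cong₂ _+_ (sym (*-identityˡ _)) (fromℕ-* m n)) (sym (distribʳ _ _ _)))

  gc : ℕ → Port
  gc n = record
    { P = Vector F (suc n)
    ; out = sum
    ; I = Fin (suc n)
    ; rel = λ r y y' → y ≈[ r ] y'
    ; rfl = λ _ _ _ _ → refl
    ; sec = λ e → e ◃ (λ _ → 0#)
    ; out-sec = λ e → trans (cong (e +_) (sum-replicate-zero n)) (+-identityʳ e)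
    }

  -- `Open` shows nothing and `Atom` shows its output as a form. Attached to a form of a system, the
  -- first hides it and the second leaves it as it was.
  Open Atom : Port
  Open = record { P = F ; out = λ e → e ; I = ⊥ ; rel = λ () ; rfl = λ () ; sec = λ e → e ; out-sec = λ _ → refl }
  Atom = record { P = F ; out = λ e → e ; I = ⊤ ; rel = λ _ → _≡_ ; rfl = λ _ _ → refl ; sec = λ e → e ; out-sec = λ _ → refl }

  -- Two coordinates are merged. A form blind to the merged coordinate is determined by one blind to
  -- coordinate 0, and the remaining indices are shifted by one.
  gc-suc : ∀ n → Sim (gc (suc n)) (gc n)
  gc-suc n = record
    { θ = λ y → (y zero + y (suc zero)) ◃ (λ c → y (suc (suc c)))
    ; out-θ = λ y → +-assoc _ _ _
    ; dep = λ { zero → zero , λ { x y h zero p → ⊥-elim (p refl) ; x y h (suc c) p → h (suc (suc c)) λ () }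
              ; (suc r) → suc (suc r) , λ { x y h zero p → cong₂ _+_ (h zero λ ()) (h (suc zero) λ ())
                                          ; x y h (suc c) p → h (suc (suc c)) λ { refl → p refl } } } }

  gc-mono : ∀ {m n} → m ≤ n → gc m ⊢[ 0 ] gc n
  gc-mono {m} {n} m≤n = go (ℕ.≤⇒≤′ m≤n)
    where
    go : ∀ {n} → m ℕ.≤′ n → gc m ⊢[ 0 ] gc n
    go ℕ.≤′-refl = ⊢-refl
    go (ℕ.≤′-step h) = go h ▸ sim (gc-suc _)

  record Ctxs (k : ℕ) : Set₁ where
    field
      P       : Set
      main    : P → F
      hole    : Fin k → P → F
      I       : Set
      rel     : I → P → P → Set
      rfl     : ∀ ι x → rel ι x x
      msec    : F → P
      main-msec : ∀ e → main (msec e) ≡ e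
      hsec    : Fin k → F → P
      hole-hsec : ∀ l e → hole l (hsec l e) ≡ e

  plugs : ∀ {k} → Ctxs k → (Fin k → Port) → Port
  plugs {k} C X = record
    { P = Σ C.P λ c → Σ (∀ l → P (X l)) λ z → ∀ l → C.hole l c ≡ out (X l) (z l)
    ; out = λ { (c , _) → C.main c }
    ; I = C.I ⊎ Σ (Fin k) λ l → I (X l)
    ; rel = λ { (inj₁ ι) (c , _) (c' , _) → C.rel ι c c'
              ; (inj₂ (l , ι)) (_ , z , _) (_ , z' , _) → rel (X l) ι (z l) (z' l) }
    ; rfl = λ { (inj₁ ι) _ → C.rfl ι _ ; (inj₂ (l , ι)) _ → rfl (X l) ι _ }
    ; sec = λ e → C.msec e , (λ l → sec (X l) (C.hole l (C.msec e))) , λ l → sym (out-sec (X l) _)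
    ; out-sec = C.main-msec
    }
    where module C = Ctxs C

  fillTail : ∀ {k} → Ctxs (suc k) → (Fin k → Port) → Ctx
  fillTail {k} C X = record
    { P = Σ C.P λ c → Σ (∀ l → P (X l)) λ z → ∀ l → C.hole (suc l) c ≡ out (X l) (z l)
    ; main = λ { (c , _) → C.main c }
    ; hole = λ { (c , _) → C.hole zero c }
    ; I = C.I ⊎ Σ (Fin k) λ l → I (X l)
    ; rel = λ { (inj₁ ι) (c , _) (c' , _) → C.rel ι c c'
              ; (inj₂ (l , ι)) (_ , z , _) (_ , z' , _) → rel (X l) ι (z l) (z' l) }
    ; rfl = λ { (inj₁ ι) _ → C.rfl ι _ ; (inj₂ (l , ι)) _ → rfl (X l) ι _ }
    ; msec = λ e → fill (C.msec e)
    ; main-msec = C.main-msec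
    ; hsec = λ e → fill (C.hsec zero e)
    ; hole-hsec = C.hole-hsec zero
    }
    where
    module C = Ctxs C
    fill : (c : C.P) → _
    fill c = c , (λ l → sec (X l) (C.hole (suc l) c)) , λ l → sym (out-sec (X l) _)

  fillHead : ∀ {k} → Ctxs (suc k) → Port → Ctxs k
  fillHead C Y = record
    { P = Σ (C.P × P Y) λ { (c , y) → C.hole zero c ≡ out Y y }
    ; main = λ { ((c , _) , _) → C.main c }
    ; hole = λ { l ((c , _) , _) → C.hole (suc l) c }
    ; I = C.I ⊎ I Y
    ; rel = λ { (inj₁ ι) ((c , _) , _) ((c' , _) , _) → C.rel ι c c'
              ; (inj₂ ι) ((_ , y) , _) ((_ , y') , _) → rel Y ι y y' }
    ; rfl = λ { (inj₁ ι) _ → C.rfl ι _ ; (inj₂ ι) _ → rfl Y ι _ }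
    ; msec = λ e → fill (C.msec e)
    ; main-msec = C.main-msec
    ; hsec = λ l e → fill (C.hsec (suc l) e)
    ; hole-hsec = λ l → C.hole-hsec (suc l)
    }
    where
    module C = Ctxs C
    fill : (c : C.P) → _
    fill c = (c , sec Y (C.hole zero c)) , sym (out-sec Y _)

  -- Holes are served one after another: with the tail filled by the old ports a single hole is left
  -- and `plug-⊢` applies, after which the new head port is counted to the context.
  plugs-⊢ : ∀ {k} (C : Ctxs k) {X X' : Fin k → Port} {n} → (∀ l → X l ⊢[ n ] X' l) → plugs C X ⊢[ k ℕ.* n ] plugs C X'
  plugs-⊢ {zero} C _ = sim (record
    { θ = λ { (c , _) → c , (λ ()) , λ () } ; out-θ = λ _ → refl
    ; dep = λ { (inj₁ ι) → inj₁ ι , λ _ _ r → r } })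
  plugs-⊢ {suc k} C {X} {X'} {n} h =
    (split ▸ plug-⊢ (fillTail C (λ l → X (suc l))) (h zero)) ▸
    (regroup ▸ plugs-⊢ (fillHead C (X' zero)) (λ l → h (suc l)) ₀◂ unsplit)
    where
    split : plugs C X ⊢[ 0 ] plug (fillTail C (λ l → X (suc l))) (X zero)
    split = sim (record
      { θ = λ { (((c , z , e) , y) , e₀) → c , (λ { zero → y ; (suc l) → z l }) , λ { zero → e₀ ; (suc l) → e l } }
      ; out-θ = λ _ → refl
      ; dep = λ { (inj₁ ι) → inj₁ (inj₁ ι) , λ _ _ r → r
                ; (inj₂ (zero , ι)) → inj₂ ι , λ _ _ r → r
                ; (inj₂ (suc l , ι)) → inj₁ (inj₂ (l , ι)) , λ _ _ r → r } })
    regroup : plug (fillTail C (λ l → X (suc l))) (X' zero) ⊢[ 0 ] plugs (fillHead C (X' zero)) (λ l → X (suc l))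
    regroup = sim (record
      { θ = λ { (((c , y) , e₀) , z , e) → ((c , z , e) , y) , e₀ }
      ; out-θ = λ _ → refl
      ; dep = λ { (inj₁ (inj₁ ι)) → inj₁ (inj₁ ι) , λ _ _ r → r
                ; (inj₂ ι) → inj₁ (inj₂ ι) , λ _ _ r → r
                ; (inj₁ (inj₂ (l , ι))) → inj₂ (l , ι) , λ _ _ r → r } })
    unsplit : plugs (fillHead C (X' zero)) (λ l → X' (suc l)) ⊢[ 0 ] plugs C X'
    unsplit = sim (record
      { θ = λ { (c , z , e) → ((c , z zero) , e zero) , (λ l → z (suc l)) , λ l → e (suc l) }
      ; out-θ = λ _ → refl
      ; dep = λ { (inj₁ (inj₁ ι)) → inj₁ ι , λ _ _ r → r
                ; (inj₁ (inj₂ ι)) → inj₂ (zero , ι) , λ _ _ r → r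
                ; (inj₂ (l , ι)) → inj₂ (suc l , ι) , λ _ _ r → r } })

  -- The decision is an argument so that properties at `l ≟ i` can be proved by matching on an
  -- arbitrary decision.
  pick : ∀ {Q : Set} → Dec Q → Port → Port
  pick (yes _) Y = Open
  pick (no _) Y = Y

  choose : ∀ {Q : Set} → Dec Q → Port → Port → Port
  choose (yes _) Y Z = Y
  choose (no _) Y Z = Z

  -- Two linked copies and a third one

  module Doubling (C : Ctx) (t : ℕ) where
    private
      module C = Ctx C
      G = gc (suc t)
      D = plug C G

    tail≈ : P D → P D → Set
    tail≈ ((_ , y) , _) ((_ , y') , _) = y ≈[ zero ] y'

    rel⁻ : C.I ⊎ Fin (suc t) → P D → P D → Set
    rel⁻ (inj₁ ι) = rel D (inj₁ ι)
    rel⁻ (inj₂ r) = rel D (inj₂ (suc r))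

    rfl⁻ : ∀ ι p → rel⁻ ι p p
    rfl⁻ (inj₁ ι) = rfl D (inj₁ ι)
    rfl⁻ (inj₂ r) = rfl D (inj₂ (suc r))

    -- The form of the gc point that omits coordinate 0 is spent on gluing the two copies, so `rel⁻`
    -- lists all others. The output of the second copy is the hole, where a third copy is to be
    -- attached.
    pairCtx : Ctx
    pairCtx = record
      { P = Σ (P D × P D) λ { (p , p') → tail≈ p p' }
      ; main = λ { ((p , _) , _) → out D p } ; hole = λ { ((_ , p') , _) → out D p' }
      ; I = Bool × (C.I ⊎ Fin (suc t))
      ; rel = λ { (false , ι) ((p , _) , _) ((q , _) , _) → rel⁻ ι p q ; (true , ι) ((_ , p') , _) ((_ , q') , _) → rel⁻ ι p' q' }
      ; rfl = λ { (false , ι) _ → rfl⁻ ι _ ; (true , ι) _ → rfl⁻ ι _ }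
      ; msec = λ e → (sec D e , sec D e) , λ _ _ → refl ; main-msec = out-sec D
      ; hsec = λ e → (sec D e , sec D e) , λ _ _ → refl ; hole-hsec = out-sec D }

    -- Only the gc point of the second copy is left here; the rest of that copy becomes the port in
    -- the hole, glued to this point through the sum of its coordinates.
    linkCtx : Ctx
    linkCtx = record
      { P = Σ (P D × P G) λ { (((_ , y) , _) , y') → y ≈[ zero ] y' }
      ; main = λ { ((p , _) , _) → out D p } ; hole = λ { ((_ , y') , _) → sum y' }
      ; I = (C.I ⊎ Fin (suc t)) ⊎ Fin (suc t)
      ; rel = λ { (inj₁ ι) ((p , _) , _) ((q , _) , _) → rel⁻ ι p q ; (inj₂ r) ((_ , y') , _) ((_ , z') , _) → y' ≈[ suc r ] z' }
      ; rfl = λ { (inj₁ ι) _ → rfl⁻ ι _ ; (inj₂ r) _ _ _ → refl }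
      ; msec = λ e → (sec D e , proj₂ (proj₁ (sec D e))) , λ _ _ → refl ; main-msec = out-sec D
      ; hsec = λ e → (((C.hsec e , sec G e) , trans (C.hole-hsec e) (sym (out-sec G e))) , sec G e) , λ _ _ → refl ; hole-hsec = out-sec G }

    private
      flatten : P G → P G
      flatten y = 0# ◃ (λ r → y (suc r))

      flatten-cong : ∀ {y y'} → y ≈[ zero ] y' → sum (flatten y) ≡ sum (flatten y')
      flatten-cong {y} {y'} h = sum-≗ (flatten y) (flatten y') λ { zero → refl ; (suc r) → h (suc r) λ () }

      S : C.I ⊎ Fin (suc (suc t)) → Bool
      S (inj₂ zero) = true
      S _ = false

      S' : JoinI D S → Bool
      S' atom = true
      S' _ = false

    -- In the mirror image of the first copy all but coordinates 1,2,… of the shared point is rebuilt.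
    double : D ⊢[ 2 ] plug pairCtx D
    double = join S ▸ joinSim (record
      { S = S'
      ; θL = λ { ((((p , p') , h) , _) , _) → (p , p') , λ { (inj₂ zero) _ → h ; (inj₂ (suc _)) () ; (inj₁ _) () } }
      ; θR = λ { ((_ , ((c , y) , e)) , _) → (((C.hsec (sum (flatten y)) , flatten y) , C.hole-hsec _) , ((c , y) , e)) ,
                   λ { (inj₂ zero) _ → λ { zero p → ⊥-elim (p refl) ; (suc _) _ → refl } ; (inj₂ (suc _)) () ; (inj₁ _) () } }
      ; out-L = λ _ → refl
      ; agree = λ { (_ , e) atom _ → e ; _ (left _ _) () ; _ (right _ _) () }
      ; dep-L = λ { (left (inj₁ ι) _) _ → inj₁ (false , inj₁ ι) , λ _ _ r → r ; (left (inj₂ (suc r)) _) _ → inj₁ (false , inj₂ r) , λ _ _ q → q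
                  ; (right (inj₁ ι) _) _ → inj₁ (true , inj₁ ι) , λ _ _ r → r ; (right (inj₂ (suc r)) _) _ → inj₁ (true , inj₂ r) , λ _ _ q → q
                  ; (left (inj₂ zero) ()) _ ; (right (inj₂ zero) ()) _ ; atom () }
      ; dep-R = λ { (left (inj₁ ι) _) _ → inj₂ (inj₂ zero) , λ { _ ((_ , ((_ , y) , _)) , _) q → subst (C.rel ι _) (cong C.hsec (flatten-cong q)) (C.rfl ι _) }
                  ; (left (inj₂ (suc r)) _) _ → inj₂ (inj₂ zero) , λ { _ _ q zero _ → refl ; _ _ q (suc c) _ → q (suc c) λ () }
                  ; (right ι _) _ → inj₂ ι , λ _ _ r → r
                  ; (left (inj₂ zero) ()) _ ; atom () }
      ; dep-O = inj₂ (inj₂ zero) , λ _ _ q → cong (λ e → C.main (C.hsec e)) (flatten-cong q) })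

    -- Both gc points are taken with coordinate 0 equal to 0 and the coordinates of `g` after it.
    -- They satisfy the gluing and have the sum of `g`, and the forms still visible on them omit a
    -- coordinate of `g`.
    link⊢plug : plug linkCtx (gc t) ⊢[ 0 ] plug C (gc t)
    link⊢plug = sim (record
      { θ = λ { ((c , g) , e) → (((((c , 0# ◃ g) , trans e (sym (+-identityˡ _))) , 0# ◃ g) , λ _ _ → refl) , g) , +-identityˡ _ }
      ; out-θ = λ _ → refl
      ; dep = λ { (inj₁ (inj₁ (inj₁ ι))) → inj₁ ι , λ _ _ r → r
                ; (inj₁ (inj₁ (inj₂ r))) → inj₂ r , λ _ _ q → lift q
                ; (inj₁ (inj₂ r)) → inj₂ r , λ _ _ q → lift q
                ; (inj₂ r) → inj₂ r , λ _ _ q → q } })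
      where
      lift : ∀ {r} {g g' : Vector F (suc t)} → g ≈[ r ] g' → (0# ◃ g) ≈[ suc r ] (0# ◃ g')
      lift q zero _ = refl
      lift q (suc c) p = q c λ { refl → p refl }

  -- Linear algebra

  Searchable : Set → Set₁
  Searchable X = ∀ {Q : X → Set} → (∀ x → Dec (Q x)) → Dec (Σ X Q)

  search-Fin : ∀ n → Searchable (Fin n)
  search-Fin n = any?

  search-Bool : Searchable Bool
  search-Bool Q? with Q? false | Q? true
  ... | yes q | _ = yes (false , q)
  ... | no _ | yes q = yes (true , q)
  ... | no ¬q | no ¬q' = no λ { (false , q) → ¬q q ; (true , q) → ¬q' q }

  search-× : ∀ {X Y} → Searchable X → Searchable Y → Searchable (X × Y)
  search-× sX sY Q? = map′ (λ { (x , y , q) → (x , y) , q }) (λ { ((x , y) , q) → x , y , q }) (sX (λ x → sY (λ y → Q? (x , y))))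

  search-Vec : ∀ {X} → Searchable X → ∀ n → Searchable (Vec X n)
  search-Vec sX zero Q? = map′ ([] ,_) (λ { ([] , q) → q }) (Q? [])
  search-Vec sX (suc n) Q? = map′ (λ { (x , xs , q) → (x ∷ xs) , q }) (λ { ((x ∷ xs) , q) → x , xs , q })
    (sX (λ x → search-Vec sX n (λ xs → Q? (x ∷ xs))))

  combination : ∀ {X : Set} {n} → (X → Vector F n) → List (F × X) → Vector F n
  combination r [] l = 0#
  combination r ((c , x) ∷ ts) l = c * r x l + combination r ts l

  pairing : ∀ {n} → Vector F n → Vector F n → F
  pairing c v = sum (λ l → c l * v l)

  pairing-+* : ∀ {n} (c u g : Vector F n) s → pairing c (λ l → u l + s * g l) ≡ pairing c u + s * pairing c g
  pairing-+* c u g s = trans (sum-cong-≗ (λ l → trans (distribˡ (c l) (u l) (s * g l)) (cong (c l * u l +_) (*-swap (c l) s (g l)))))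
    (trans (∑-distrib-+ (λ l → c l * u l) (λ l → s * (c l * g l))) (cong (pairing c u +_) (sym (*-distribˡ-sum s (λ l → c l * g l)))))

  private
    module _ {X : Set} {n} (r : X → Vector F (suc n)) (g : Vector F n) (p' : F) where
      r' : X → Vector F n
      r' x l = r x (suc l) + - (r x zero * p') * g l

      combination-reduce : ∀ ts l → combination r' ts l ≡ combination r ts (suc l) + - (combination r ts zero * p') * g l
      combination-reduce [] l = sym (trans (+-identityˡ _) (trans (cong (λ x → - x * g l) (zeroˡ p')) (trans (cong (_* g l) -0#≈0#) (zeroˡ _))))
      combination-reduce ((c , x) ∷ ts) l = begin
        c * (a + s * g l) + combination r' ts l             ≡⟨ cong₂ _+_ (trans (distribˡ c a (s * g l)) (cong (c * a +_) (sym (*-assoc c s (g l))))) (combination-reduce ts l) ⟩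
        (c * a + c * s * g l) + (b + s' * g l)              ≡⟨ +-interchange _ _ _ _ ⟩
        (c * a + b) + (c * s * g l + s' * g l)              ≡⟨ cong ((c * a + b) +_) (sym (distribʳ (g l) (c * s) s')) ⟩
        (c * a + b) + (c * s + s') * g l                    ≡⟨ cong (λ z → (c * a + b) + z * g l) scal ⟩
        (c * a + b) + - ((c * r x zero + combination r ts zero) * p') * g l ∎
        where
        open ≡-Reasoning
        a = r x (suc l)
        s = - (r x zero * p')
        b = combination r ts (suc l)
        s' = - (combination r ts zero * p')
        scal : c * s + s' ≡ - ((c * r x zero + combination r ts zero) * p')
        scal = trans (cong (_+ s') (trans (sym (-‿distribʳ-* c (r x zero * p'))) (cong -_ (sym (*-assoc c (r x zero) p')))))
          (trans (-‿+-comm _ _) (cong -_ (sym (distribʳ p' (c * r x zero) (combination r ts zero)))))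

  -- Gaussian elimination on the coordinates. Each coordinate uses at most one pivot from the
  -- family, whence at most `n` terms whatever the size of the family.
  span-or-separate : ∀ {X} → Searchable X → ∀ n (r : X → Vector F n) (v : Vector F n) →
    (Σ (List (F × X)) λ ts → length ts ≤ n × (∀ l → v l ≡ combination r ts l)) ⊎
    (Σ (Vector F n) λ c → (∀ x → pairing c (r x) ≡ 0#) × pairing c v ≡ 1#)
  span-or-separate s zero r v = inj₁ ([] , z≤n , λ ())
  span-or-separate {X} s (suc n) r v with s (λ x → ¬? (r x zero ≟F 0#))
  ... | no all0 = flat (v zero ≟F 0#)
    where
    r₀ : ∀ x → r x zero ≡ 0#
    r₀ x = decidable-stable (r x zero ≟F 0#) (λ ne → all0 (x , ne))
    combination₀ : ∀ ts → combination r ts zero ≡ 0#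
    combination₀ [] = refl
    combination₀ ((c , x) ∷ ts) = trans (cong₂ _+_ (trans (cong (c *_) (r₀ x)) (zeroʳ c)) (combination₀ ts)) (+-identityˡ 0#)
    combination-suc : ∀ ts l → combination (λ x → r x ∘ suc) ts l ≡ combination r ts (suc l)
    combination-suc [] l = refl
    combination-suc ((c , x) ∷ ts) l = cong (c * r x (suc l) +_) (combination-suc ts l)
    flat : Dec (v zero ≡ 0#) → _
    flat (yes v₀) with span-or-separate s n (λ x → r x ∘ suc) (v ∘ suc)
    ... | inj₁ (ts , len , eq) = inj₁ (ts , ℕ.m≤n⇒m≤1+n len , λ { zero → trans v₀ (sym (combination₀ ts)) ; (suc l) → trans (eq l) (combination-suc ts l) })
    ... | inj₂ (c , kill , one) = inj₂ (0# ◃ c , (λ x → trans (cong₂ _+_ (zeroˡ _) (kill x)) (+-identityˡ _)) , trans (cong₂ _+_ (zeroˡ _) one) (+-identityˡ _))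
    -- Only `v` has a nonzero coordinate 0, so a multiple of that coordinate separates.
    flat (no v₀≢0) with y , y*v ← inverse (v zero) v₀≢0 = inj₂ (y ◃ (λ _ → 0#) ,
      (λ x → trans (cong₂ _+_ (trans (cong (y *_) (r₀ x)) (zeroʳ y)) (sum-ε (λ l → 0# * r x (suc l)) λ l → zeroˡ _)) (+-identityˡ _)) ,
      trans (cong₂ _+_ y*v (sum-ε (λ l → 0# * v (suc l)) λ l → zeroˡ _)) (+-identityʳ _))
  ... | yes (x₀ , ne) with p' , p'p ← inverse (r x₀ zero) ne = reduce (span-or-separate s n (r' r g p') v')
    where
    g : Vector F n
    g = r x₀ ∘ suc
    p = r x₀ zero
    v' : Vector F n
    v' l = v (suc l) + - (v zero * p') * g l
    reduce : _ → _
    reduce (inj₁ (ts , len , eq)) = inj₁ ((T₀ , x₀) ∷ ts , s≤s len , λ { zero → at0 ; (suc l) → atS l })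
      where
      S₀ = combination r ts zero
      -- The pivot has to supply what the other terms leave of `v zero`.
      T₀ = (v zero + - S₀) * p'
      at0 : v zero ≡ T₀ * p + S₀
      at0 = sym (trans (cong (_+ S₀) (trans (*-assoc _ p' p) (trans (cong ((v zero + - S₀) *_) p'p) (*-identityʳ _))))
        (trans (+-assoc _ _ _) (trans (cong (v zero +_) (-‿inverseˡ S₀)) (+-identityʳ _))))
      atS : ∀ l → v (suc l) ≡ T₀ * g l + combination r ts (suc l)
      atS l = begin
        v (suc l)                                                     ≡⟨ +-identityʳ _ ⟨
        v (suc l) + 0#                                                ≡⟨ cong (v (suc l) +_) (trans (sym (distribʳ (g l) (- (v zero * p')) (v zero * p'))) (trans (cong (_* g l) (-‿inverseˡ _)) (zeroˡ _))) ⟨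
        v (suc l) + (- (v zero * p') * g l + v zero * p' * g l)       ≡⟨ +-assoc _ _ _ ⟨
        v' l + v zero * p' * g l                                      ≡⟨ cong (_+ v zero * p' * g l) (trans (eq l) (combination-reduce r g p' ts l)) ⟩
        (C + - (S₀ * p') * g l) + v zero * p' * g l                   ≡⟨ +-assoc _ _ _ ⟩
        C + (- (S₀ * p') * g l + v zero * p' * g l)                   ≡⟨ cong (C +_) (trans (sym (distribʳ (g l) (- (S₀ * p')) (v zero * p'))) (cong (_* g l) (trans (+-comm _ _) (trans (cong (v zero * p' +_) (-‿distribˡ-* S₀ p')) (sym (distribʳ p' (v zero) (- S₀))))))) ⟩
        C + T₀ * g l                                                  ≡⟨ +-comm _ _ ⟩
        T₀ * g l + C                                                  ∎
        where
        open ≡-Reasoning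
        C = combination r ts (suc l)
    reduce (inj₂ (c , kill , one)) = inj₂ (c₀ ◃ c , (λ x → trans (lift (r x)) (kill x)) , trans (lift v) one)
      where
      G = pairing c g
      -- Forced by the pivot: `c₀ * p + G` must vanish.
      c₀ = - (p' * G)
      lift : ∀ (u : Vector F (suc n)) → pairing (c₀ ◃ c) u ≡ pairing c (λ l → u (suc l) + - (u zero * p') * g l)
      lift u = trans (+-comm _ _) (trans (cong (pairing c (u ∘ suc) +_) coefficient) (sym (pairing-+* c (u ∘ suc) g (- (u zero * p')))))
        where
        coefficient : c₀ * u zero ≡ - (u zero * p') * G
        coefficient = trans (sym (-‿distribˡ-* _ _)) (trans (cong -_ (trans (*-comm _ _) (sym (*-assoc _ _ _)))) (-‿distribˡ-* _ _))

  -- Gadgets with a far point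

  module AtLevel (t : ℕ) where

    W : Set
    W = Vector F (suc t)

    Far : Set
    Far = Vector F (suc (suc t))

    -- A port whose two marked indices read off the coordinates of a far point, all but
    -- coordinate 0 (false) or all but coordinate 1 (true).
    record Gadget : Set₁ where
      field
        P      : Set
        out    : P → F
        far    : P → Far
        I      : Set
        rel    : I → P → P → Set
        rfl    : ∀ ι x → rel ι x x
        fill     : Far → P
        out-fill : ∀ y → out (fill y) ≡ sum y
        far-fill : ∀ y c → far (fill y) c ≡ y c
        dep-fill : ∀ ι → Σ (Fin (suc (suc t))) λ r → ∀ y y' → y ≈[ r ] y' → rel ι (fill y) (fill y')

    mark : Bool → Fin (suc (suc t))
    mark false = zero
    mark true = suc zero

    port : Gadget → Port
    port Y = record
      { P = Y.P ; out = Y.out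
      ; I = Bool ⊎ Y.I
      ; rel = λ { (inj₁ b) x x' → Y.far x ≈[ mark b ] Y.far x' ; (inj₂ ι) → Y.rel ι }
      ; rfl = λ { (inj₁ b) x c _ → refl ; (inj₂ ι) → Y.rfl ι }
      ; sec = λ e → Y.fill (e ◃ (λ _ → 0#))
      ; out-sec = λ e → trans (Y.out-fill _) (out-sec (gc (suc t)) e) }
      where module Y = Gadget Y

    gc-gadget : Gadget
    gc-gadget = record
      { P = Far ; out = sum ; far = λ y → y
      ; I = Fin t ; rel = λ r y y' → y ≈[ suc (suc r) ] y' ; rfl = λ _ _ _ _ → refl
      ; fill = λ y → y ; out-fill = λ _ → refl ; far-fill = λ _ _ → refl
      ; dep-fill = λ r → suc (suc r) , λ _ _ h → h }

    gc⊢gadget : gc (suc t) ⊢[ 0 ] port gc-gadget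
    gc⊢gadget = sim (record
      { θ = λ y → y ; out-θ = λ _ → refl
      ; dep = λ { zero → inj₁ false , λ _ _ h → h ; (suc zero) → inj₁ true , λ _ _ h → h
                ; (suc (suc r)) → inj₂ r , λ _ _ h → h } })

    module _ (Y : Gadget) where
      private module Y = Gadget Y

      -- Coordinate 0 of the far points depends on the second index only, coordinate 1 on the first,
      -- and the others are constant. The four sums thus form an additive quadruple: the two pairs
      -- of opposite corners have equal total, which later expresses one value through three others.
      record Ring : Set where
        field
          pt : Bool → Bool → Y.P
          eB : ∀ c → Y.far (pt c false) ≈[ zero ] Y.far (pt c true)
          eA : ∀ c → Y.far (pt false c) ≈[ suc zero ] Y.far (pt true c)

      open Ring public

      data RingI : Set where
        corner : Bool → Bool → Y.I → RingI
        oB     : Bool → RingI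
        oA     : RingI

      ringPort : Port
      ringPort = record
        { P = Ring
        ; out = λ x → Y.out (pt x false false)
        ; I = RingI
        ; rel = λ { (corner c c' ι) x x' → Y.rel ι (pt x c c') (pt x' c c')
                  ; (oB c) x x' → Y.out (pt x c true) ≡ Y.out (pt x' c true)
                  ; oA x x' → Y.out (pt x true false) ≡ Y.out (pt x' true false) }
        ; rfl = λ { (corner c c' ι) _ → Y.rfl ι _ ; (oB _) _ → refl ; oA _ → refl }
        ; sec = λ e → record { pt = λ _ _ → sec (port Y) e ; eB = λ _ _ _ → refl ; eA = λ _ _ _ → refl }
        ; out-sec = out-sec (port Y) }

      port⊢ring : port Y ⊢[ 2 ] ringPort
      port⊢ring = join S₁ ▸ joinSim (record
        { S = S₂
        ; θL = λ x → (pt x false false , pt x false true) , λ { (inj₁ false) _ → eB x false ; (inj₁ true) () ; (inj₂ _) () }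
        ; θR = λ x → (pt x true false , pt x true true) , λ { (inj₁ false) _ → eB x true ; (inj₁ true) () ; (inj₂ _) () }
        ; out-L = λ _ → refl
        ; agree = λ { x (left (inj₁ true) _) _ → eA x false ; x (right (inj₁ true) _) _ → eA x true
                    ; x (left (inj₁ false) ()) _ ; x (right (inj₁ false) ()) _
                    ; x (left (inj₂ _) _) () ; x (right (inj₂ _) _) () ; x atom () }
        ; dep-L = λ { (left (inj₂ ι) _) _ → corner false false ι , λ _ _ h → h
                    ; (right (inj₂ ι) _) _ → corner false true ι , λ _ _ h → h
                    ; atom _ → oB false , λ _ _ h → h
                    ; (left (inj₁ false) ()) _ ; (right (inj₁ false) ()) _
                    ; (left (inj₁ true) _) () ; (right (inj₁ true) _) () }
        ; dep-R = λ { (left (inj₂ ι) _) _ → corner true false ι , λ _ _ h → h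
                    ; (right (inj₂ ι) _) _ → corner true true ι , λ _ _ h → h
                    ; atom _ → oB true , λ _ _ h → h
                    ; (left (inj₁ false) ()) _ ; (right (inj₁ false) ()) _
                    ; (left (inj₁ true) _) () ; (right (inj₁ true) _) () }
        ; dep-O = oA , λ _ _ h → h })
        where
        S₁ : Bool ⊎ Y.I → Bool
        S₁ (inj₁ false) = true
        S₁ _ = false
        S₂ : JoinI (port Y) S₁ → Bool
        S₂ (left (inj₁ true) _) = true
        S₂ (right (inj₁ true) _) = true
        S₂ _ = false

      -- Starting from `y` at the corner `false false`, either step around the ring empties one of
      -- the two free coordinates.
      cornerFar : Far → Bool → Bool → Far
      cornerFar y c c' = (if c' then 0# else y zero) ◃ (if c then 0# else y (suc zero)) ◃ (λ r → y (suc (suc r)))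

      cornerFar-≈ : ∀ {y y'} c c' r → y ≈[ r ] y' → cornerFar y c c' ≈[ r ] cornerFar y' c c'
      cornerFar-≈ c true r h zero p = refl
      cornerFar-≈ c false r h zero p = h zero p
      cornerFar-≈ true c' r h (suc zero) p = refl
      cornerFar-≈ false c' r h (suc zero) p = h (suc zero) p
      cornerFar-≈ c c' r h (suc (suc r')) p = h (suc (suc r')) p

      stdRing : Far → Ring
      stdRing y = record
        { pt = λ c c' → Y.fill (cornerFar y c c')
        ; eB = λ c → via λ { zero p → ⊥-elim (p refl) ; (suc zero) _ → refl ; (suc (suc _)) _ → refl }
        ; eA = λ c → via λ { (suc zero) p → ⊥-elim (p refl) ; zero _ → refl ; (suc (suc _)) _ → refl } }
        where
        via : ∀ {r y y'} → y ≈[ r ] y' → Y.far (Y.fill y) ≈[ r ] Y.far (Y.fill y')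
        via h c p = trans (Y.far-fill _ c) (trans (h c p) (sym (Y.far-fill _ c)))

      constFar : F → Far
      constFar e = 0# ◃ e ◃ (λ _ → 0#)

      sum-constFar : ∀ e → sum (constFar e) ≡ e
      sum-constFar e = trans (+-identityˡ _) (trans (cong (e +_) (sum-ε {t} (λ _ → 0#) λ _ → refl)) (+-identityʳ e))

      -- With coordinate 1 as the only nonzero one, the outputs of the two rows of the ring can be
      -- prescribed independently.
      constRing : (Bool → F) → Ring
      constRing e = record
        { pt = λ c _ → Y.fill (constFar (e c))
        ; eB = λ _ _ _ → refl
        ; eA = λ _ → λ { zero _ → far₂ zero refl ; (suc zero) p → ⊥-elim (p refl) ; (suc (suc r)) _ → far₂ (suc (suc r)) refl } }
        where
        far₂ : ∀ {e e'} c → constFar e c ≡ constFar e' c → Y.far (Y.fill (constFar e)) c ≡ Y.far (Y.fill (constFar e')) c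
        far₂ c h = trans (Y.far-fill _ c) (trans h (sym (Y.far-fill _ c)))

      -- One ring starts at the output of the new gadget, the other ends at its far point, and they
      -- are glued at both corners with second index `true`. The remaining corner `true false` of
      -- either ring is left exposed and will have to carry a degenerate value.
      record NextP : Set where
        field
          ring₁ ring₂ : Ring
          share : ∀ c → Y.out (pt ring₁ c true) ≡ Y.out (pt ring₂ c true)
          z     : Far
          ez    : Y.out (pt ring₂ false false) ≡ sum z

      open NextP public

      side : NextP → Bool → Ring
      side x false = ring₁ x
      side x true = ring₂ x

      data NextI : Set where
        corner : Bool → Bool → Bool → Y.I → NextI
        oA     : Bool → NextI
        zz     : Fin t → NextI

      next : Gadget
      next = record
        { P = NextP
        ; out = λ x → Y.out (pt (ring₁ x) false false)
        ; far = z
        ; I = NextI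
        ; rel = relN
        ; rfl = λ { (corner b c c' ι) _ → Y.rfl ι _ ; (oA _) _ → refl ; (zz _) _ _ _ → refl }
        ; fill = fillN
        ; out-fill = λ y → Y.out-fill _
        ; far-fill = λ _ _ → refl
        ; dep-fill = λ { (corner false c c' ι) → depC c c' ι ; (corner true c c' ι) → depC c c' ι
                       ; (oA false) → suc zero , depO ; (oA true) → suc zero , depO
                       ; (zz r) → suc (suc r) , λ _ _ h → h } }
        where
        relN : NextI → NextP → NextP → Set
        relN (corner b c c' ι) x x' = Y.rel ι (pt (side x b) c c') (pt (side x' b) c c')
        relN (oA b) x x' = Y.out (pt (side x b) true false) ≡ Y.out (pt (side x' b) true false)
        relN (zz r) x x' = z x ≈[ suc (suc r) ] z x'
        fillN : Far → NextP
        fillN y = record { ring₁ = stdRing y ; ring₂ = stdRing y ; share = λ _ → refl ; z = y ; ez = Y.out-fill _ }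
        depC : ∀ c c' ι → Σ (Fin (suc (suc t))) λ r → ∀ y y' → y ≈[ r ] y' → Y.rel ι (pt (stdRing y) c c') (pt (stdRing y') c c')
        depC c c' ι = proj₁ (Y.dep-fill ι) , λ y y' h → proj₂ (Y.dep-fill ι) _ _ (cornerFar-≈ c c' _ h)
        depO : ∀ y y' → y ≈[ suc zero ] y' → Y.out (pt (stdRing y) true false) ≡ Y.out (pt (stdRing y') true false)
        depO y y' h = trans (Y.out-fill _) (trans (sum-≗ (cornerFar y true false) (cornerFar y' true false) λ { zero → h zero λ () ; (suc zero) → refl ; (suc (suc r)) → h (suc (suc r)) λ () }) (sym (Y.out-fill _)))

      private
        S₃ : RingI → Bool
        S₃ (oB _) = true
        S₃ _ = false

        S₄ : JoinI ringPort S₃ → Bool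
        S₄ atom = true
        S₄ _ = false

        ixOf : Fin (suc (suc t)) → Bool ⊎ NextI
        ixOf zero = inj₁ false
        ixOf (suc zero) = inj₁ true
        ixOf (suc (suc r)) = inj₂ (zz r)

        rel-z : ∀ r x x' → rel (port next) (ixOf r) x x' → z x ≈[ r ] z x'
        rel-z zero x x' h = h
        rel-z (suc zero) x x' h = h
        rel-z (suc (suc r)) x x' h = h

        level : Far → Bool → F
        level y c = sum (cornerFar y c true)

        level-cong : ∀ y y' c → y ≈[ zero ] y' → level y c ≡ level y' c
        level-cong y y' c h = sum-≗ (cornerFar y c true) (cornerFar y' c true) λ { zero → refl ; (suc r) → cornerFar-≈ c true zero h (suc r) λ () }

        -- In the mirror image `ring₂` is rebuilt from `z`, while of `ring₁` only the two shared
        -- outputs are prescribed. At these corners coordinate 0 is emptied, so the image of `ring₁`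
        -- is determined by `z` off coordinate 0.
        collapse : ∀ x → P (Join ringPort S₃)
        collapse x = (constRing (level (z x)) , stdRing (z x)) , λ
          { (oB c) _ → trans (Y.out-fill _) (trans (sum-constFar _) (sym (Y.out-fill _))) ; (corner _ _ _) () ; oA () }

        const-cong : ∀ x x' c → z x ≈[ zero ] z x' → Y.fill (constFar (level (z x) c)) ≡ Y.fill (constFar (level (z x') c))
        const-cong x x' c h = cong (Y.fill ∘ constFar) (level-cong (z x) (z x') c h)

      -- The far point is attached by a second copy of the two rings, rebuilt from z.
      port⊢next : port Y ⊢[ 4 ] port next
      port⊢next = port⊢ring ▸ join S₃ ▸ joinSim (record
        { S = S₄
        ; θL = λ x → (ring₁ x , ring₂ x) , λ { (oB c) _ → share x c ; (corner _ _ _) () ; oA () }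
        ; θR = collapse
        ; out-L = λ _ → refl
        ; agree = λ { x atom _ → trans (ez x) (sym (Y.out-fill _)) ; x (left _ _) () ; x (right _ _) () }
        ; dep-L = λ { (left (corner c c' ι) _) _ → inj₂ (corner false c c' ι) , λ _ _ h → h
                    ; (left oA _) _ → inj₂ (oA false) , λ _ _ h → h
                    ; (right (corner c c' ι) _) _ → inj₂ (corner true c c' ι) , λ _ _ h → h
                    ; (right oA _) _ → inj₂ (oA true) , λ _ _ h → h
                    ; (left (oB _) ()) _ ; (right (oB _) ()) _ ; atom () }
        ; dep-R = λ { (left (corner c c' ι) _) _ → inj₁ false , λ x x' h → rel-≡ (port Y) (inj₂ ι) (const-cong x x' c h)
                    ; (left oA _) _ → inj₁ false , λ x x' h → cong Y.out (const-cong x x' true h)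
                    ; (right (corner c c' ι) _) _ → ixOf (proj₁ (Y.dep-fill ι)) ,
                        λ x x' h → proj₂ (Y.dep-fill ι) _ _ (cornerFar-≈ c c' _ (rel-z _ x x' h))
                    ; (right oA _) _ → inj₁ true , λ x x' h → trans (Y.out-fill _)
                        (trans (sum-≗ (cornerFar (z x) true false) (cornerFar (z x') true false) λ { zero → h zero λ () ; (suc zero) → refl ; (suc (suc r)) → h (suc (suc r)) λ () }) (sym (Y.out-fill _)))
                    ; (left (oB _) ()) _ ; (right (oB _) ()) _ ; atom () }
        ; dep-O = inj₁ false , λ x x' h → cong Y.out (const-cong x x' false h) })

    -- Families of configurations and the moves of a gadget

    -- `w` runs through the points of the final gc of order `t`; a form that ignores one coordinate
    -- of `w` factors through a form of it.
    Degenerate : (W → W → Set) → Set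
    Degenerate R = Σ (Fin (suc t)) λ r → ∀ w w' → w ≈[ r ] w' → R w w'

    val : W → W → F
    val γ w = sum (λ r → γ r * w r)

    val-off : ∀ γ a → γ a ≡ 0# → ∀ w w' → w ≈[ a ] w' → val γ w ≡ val γ w'
    val-off γ a γa≡0 w w' h = begin
      val γ w                                                        ≡⟨ sum-remove {i = a} (λ r → γ r * w r) ⟩
      γ a * w a + sum (λ k → γ (punchIn a k) * w (punchIn a k))      ≡⟨ cong₂ _+_ (vanish w) (sum-cong-≗ (λ k → cong (γ (punchIn a k) *_) (h _ (punchInᵢ≢i a k)))) ⟩
      0# + sum (λ k → γ (punchIn a k) * w' (punchIn a k))            ≡⟨ cong (_+ sum (λ k → γ (punchIn a k) * w' (punchIn a k))) (vanish w') ⟨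
      γ a * w' a + sum (λ k → γ (punchIn a k) * w' (punchIn a k))    ≡⟨ sum-remove {i = a} (λ r → γ r * w' r) ⟨
      val γ w'                                                       ∎
      where
      open ≡-Reasoning
      vanish : ∀ w → γ a * w a ≡ 0#
      vanish w = trans (cong (_* w a) γa≡0) (zeroˡ _)

    record Config (Y : Gadget) (g : W → F) (y : W → Far) : Set where
      private module Y = Gadget Y
      field
        at    : W → Y.P
        out-at : ∀ w → Y.out (at w) ≡ g w
        far-at : ∀ w c → Y.far (at w) c ≡ y w c
        deg   : ∀ ι → Degenerate (λ w w' → Y.rel ι (at w) (at w'))

    open Config public

    -- The two forms of the far point that omit coordinate 0 or 1 are exempt, since they are the
    -- marks and will be glued.
    Admissible : (W → Far) → Set
    Admissible y = ∀ r → Degenerate (λ w w' → y w ≈[ suc (suc r) ] y w')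

    -- The gadget as an adapter: coefficients `γ` at the output become `γ'` at the far point,
    -- however they are distributed over the far coordinates.
    Move : Gadget → W → W → Set
    Move Y γ γ' = ∀ y → (∀ w → sum (y w) ≡ val γ' w) → Admissible y → Config Y (val γ) y

    module _ {Y : Gadget} where
      private module Y = Gadget Y

      record RingConfig (g : W → F) (h : Bool → W → F) : Set where
        field
          ring  : W → Ring Y
          out₀  : ∀ w → Y.out (pt (ring w) false false) ≡ g w
          outB  : ∀ c w → Y.out (pt (ring w) c true) ≡ h c w
          degᶜ  : ∀ c c' ι → Degenerate (λ w w' → Y.rel ι (pt (ring w) c c') (pt (ring w') c c'))
          degA  : Degenerate (λ w w' → Y.out (pt (ring w) true false) ≡ Y.out (pt (ring w') true false))

      open RingConfig

      ringConfig : ∀ {g : Bool → Bool → W → F} {y : Bool → Bool → W → Far} →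
        (∀ c c' → Config Y (g c c') (y c c')) →
        (∀ c w → y c false w ≈[ zero ] y c true w) →
        (∀ c w → y false c w ≈[ suc zero ] y true c w) →
        Degenerate (λ w w' → g true false w ≡ g true false w') →
        RingConfig (g false false) (λ c → g c true)
      ringConfig C hB hA (r , d) = record
        { ring = λ w → record
          { pt = λ c c' → at (C c c') w
          ; eB = λ c k p → trans (far-at (C c false) w k) (trans (hB c w k p) (sym (far-at (C c true) w k)))
          ; eA = λ c k p → trans (far-at (C false c) w k) (trans (hA c w k p) (sym (far-at (C true c) w k))) }
        ; out₀ = out-at (C false false)
        ; outB = λ c → out-at (C c true)
        ; degᶜ = λ c c' ι → deg (C c c') ι
        ; degA = r , λ w w' e → trans (out-at (C true false) w) (trans (d w w' e) (sym (out-at (C true false) w'))) }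

      nextConfig : ∀ {g g' h y} → RingConfig g h → RingConfig g' h →
        (∀ w → sum (y w) ≡ g' w) → Admissible y → Config (next Y) g y
      nextConfig {y = y} R R' hy ad = record
        { at = λ w → record { ring₁ = ring R w ; ring₂ = ring R' w ; share = λ c → trans (outB R c w) (sym (outB R' c w))
                            ; z = y w ; ez = trans (out₀ R' w) (sym (hy w)) }
        ; out-at = out₀ R
        ; far-at = λ _ _ → refl
        ; deg = λ { (corner false c c' ι) → degᶜ R c c' ι ; (corner true c c' ι) → degᶜ R' c c' ι
                  ; (oA false) → degA R ; (oA true) → degA R' ; (zz r) → ad r } }

      -- Any value that misses a slot can be traded for any other: both rings pass through 0.
      degenerateRing : ∀ γ a → γ a ≡ 0# → RingConfig (val γ) (λ _ _ → 0#)
      degenerateRing γ a γa≡0 = record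
        { ring = λ w → stdRing Y (base w)
        ; out₀ = λ w → trans (Y.out-fill _) (trans (cong (val γ w +_) (trans (+-identityˡ _) (sum-ε {t} (λ _ → 0#) λ _ → refl))) (+-identityʳ _))
        ; outB = λ { false w → trans (Y.out-fill _) (sum-ε (cornerFar Y (base w) false true) λ { zero → refl ; (suc zero) → refl ; (suc (suc r)) → refl })
                   ; true w → trans (Y.out-fill _) (sum-ε (cornerFar Y (base w) true true) λ { zero → refl ; (suc zero) → refl ; (suc (suc r)) → refl }) }
        ; degᶜ = λ c c' ι → a , λ w w' h → rel-≡ (port Y) (inj₂ ι) (cong (λ e → Y.fill (cornerFar Y (e ◃ (λ _ → 0#)) c c')) (same w w' h))
        ; degA = a , λ w w' h → cong (λ e → Y.out (Y.fill (cornerFar Y (e ◃ (λ _ → 0#)) true false))) (same w w' h) }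
        where
        base : W → Far
        base w = val γ w ◃ (λ _ → 0#)
        same : ∀ w w' → w ≈[ a ] w' → val γ w ≡ val γ w'
        same = val-off γ a γa≡0

    -- Slot `a` is spread over the far coordinates 0 and 1 and each other slot has a coordinate of
    -- its own, which is why far points have one coordinate more than `W`.
    slotFar : Fin (suc t) → F → F → W → W → Far
    slotFar a x y γ w = x * w a ◃ y * w a ◃ (λ r → γ (punchIn a r) * w (punchIn a r))

    slotFar-admissible : ∀ a x y γ → Admissible (slotFar a x y γ)
    slotFar-admissible a x y γ r = punchIn a r , λ w w' h →
      λ { zero _ → cong (x *_) (h a (punchInᵢ≢i a r ∘ sym))
        ; (suc zero) _ → cong (y *_) (h a (punchInᵢ≢i a r ∘ sym))
        ; (suc (suc r')) p → cong (γ (punchIn a r') *_) (h _ λ e → p (cong (λ q → suc (suc q)) (punchIn-injective a _ _ e))) }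

    sum-slotFar : ∀ a x y γ f → f a ≡ x + y → f ≈[ a ] γ → ∀ w → sum (slotFar a x y γ w) ≡ val f w
    sum-slotFar a x y γ f fa f≈γ w = trans (sym (+-assoc _ _ _)) (trans
      (cong₂ _+_ (trans (sym (distribʳ _ x y)) (cong (_* w a) (sym fa))) (sum-cong-≗ (λ r → cong (_* w (punchIn a r)) (sym (f≈γ _ (punchInᵢ≢i a r))))))
      (sym (sum-remove {i = a} (λ r → f r * w r))))

    record Shift (γ : W) (a : Fin (suc t)) (c : F) (f₁ f₃ : W) : Set where
      constructor shift
      field
        f₁-a : f₁ a ≡ c + γ a
        f₁-≈ : f₁ ≈[ a ] γ
        f₃-a : f₃ a ≡ c
        f₃-≈ : f₃ ≈[ a ] γ

    -- In rule, the values γ, f₁, f₃ and γ', f₁', f₃' occur around two rings, whose fourth value is degenerate;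
    -- the rings are glued at two ports with values γ₁ and γ₃.
    data Mv : ℕ → W → W → Set where
      base  : ∀ {γ γ'} → γ ≗ γ' → Mv 0 γ γ'
      degen : ∀ {h γ γ'} a b → γ a ≡ 0# → γ' b ≡ 0# → Mv (suc h) γ γ'
      rule  : ∀ {h γ γ' γ₁ γ₃ f₁ f₃ f₁' f₃'} a b c c' → Shift γ a c f₁ f₃ → Shift γ' b c' f₁' f₃' →
              Mv h γ₁ f₁ → Mv h γ₃ f₃ → Mv h γ₁ f₁' → Mv h γ₃ f₃' → Mv (suc h) γ γ'

    val-cong : ∀ {γ γ'} → γ ≗ γ' → ∀ w → val γ w ≡ val γ' w
    val-cong h w = sum-cong-≗ (λ r → cong (_* w r) (h r))

    mv-refl : ∀ h {γ γ'} → γ ≗ γ' → Mv h γ γ'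
    mv-refl zero e = base e
    mv-refl (suc h) {γ} {γ'} e = rule zero zero 0# 0# (self γ) (self γ')
      (mv-refl h λ _ → refl) (mv-refl h λ _ → refl) (mv-refl h e) (mv-refl h λ { zero → refl ; (suc r) → e (suc r) })
      where
      self : ∀ γ → Shift γ zero 0# γ (0# ◃ (γ ∘ suc))
      self γ = shift (sym (+-identityˡ _)) (λ _ _ → refl) refl (λ { zero p → ⊥-elim (p refl) ; (suc _) _ → refl })

    Realised : Gadget → ℕ → Set
    Realised Y h = ∀ {γ γ'} → Mv h γ γ' → Move Y γ γ'

    gc-realised : Realised gc-gadget 0
    gc-realised (base e) y hy ad = record
      { at = y ; out-at = λ w → trans (hy w) (sym (val-cong e w)) ; far-at = λ _ _ → refl ; deg = ad }

    private
      shiftRing : ∀ {Y h γ a c f₁ f₃ γ₁ γ₃} → Realised Y h → Shift γ a c f₁ f₃ → Mv h γ₁ f₁ → Mv h γ₃ f₃ →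
        RingConfig {Y} (val γ) (λ c₀ → if c₀ then val γ₃ else val γ₁)
      shiftRing {Y} {h} {γ} {a} {c} {f₁} {f₃} {γ₁} {γ₃} real (shift f₁a f₁≈ f₃a f₃≈) m₁ m₃ =
        record { RingConfig RC ; outB = λ { false → RingConfig.outB RC false ; true → RingConfig.outB RC true } }
        where
        -- The corner `true false`, where slot `a` is empty; this makes the exposed output of the
        -- ring degenerate.
        f₂ : W
        f₂ = updateAt γ a (λ _ → 0#)
        x y : Bool → F
        x c' = if c' then c else 0#
        y c₀ = if c₀ then 0# else γ a
        far* : Bool → Bool → W → Far
        far* c₀ c' = slotFar a (x c') (y c₀) γ
        g : Bool → Bool → W → F
        g false false = val γ
        g false true = val γ₁
        g true false = val f₂
        g true true = val γ₃
        conf : ∀ c₀ c' → Config Y (g c₀ c') (far* c₀ c')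
        conf false false = real (mv-refl h {γ} {γ} λ _ → refl) _ (sum-slotFar a _ _ γ γ (sym (+-identityˡ _)) (λ _ _ → refl)) (slotFar-admissible a _ _ γ)
        conf false true = real m₁ _ (sum-slotFar a _ _ γ f₁ f₁a f₁≈) (slotFar-admissible a _ _ γ)
        conf true false = real (mv-refl h {f₂} {f₂} λ _ → refl) _ (sum-slotFar a _ _ γ f₂ (trans (updateAt-updates a γ) (sym (+-identityˡ _))) (λ j p → updateAt-minimal j a γ p)) (slotFar-admissible a _ _ γ)
        conf true true = real m₃ _ (sum-slotFar a _ _ γ f₃ (trans f₃a (sym (+-identityʳ _))) f₃≈) (slotFar-admissible a _ _ γ)
        RC : RingConfig {Y} (g false false) (λ c → g c true)
        RC = ringConfig conf
          (λ c w → λ { zero p → ⊥-elim (p refl) ; (suc _) _ → refl })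
          (λ c w → λ { zero _ → refl ; (suc zero) p → ⊥-elim (p refl) ; (suc (suc _)) _ → refl })
          (a , val-off f₂ a (updateAt-updates a γ))

    next-realised : ∀ {Y h} → Realised Y h → Realised (next Y) (suc h)
    next-realised real (degen {γ = γ} {γ'} a b γa γ'b) y hy ad = nextConfig (degenerateRing γ a γa) (degenerateRing γ' b γ'b) hy ad
    next-realised real (rule a b c c' s s' m₁ m₃ m₁' m₃') y hy ad = nextConfig (shiftRing real s m₁ m₃) (shiftRing real s' m₁' m₃') hy ad

    gadget : ℕ → Gadget
    gadget zero = gc-gadget
    gadget (suc h) = next (gadget h)

    gadget-realised : ∀ h → Realised (gadget h) h
    gadget-realised zero = gc-realised
    gadget-realised (suc h) = next-realised (gadget-realised h)

    gc⊢port : ∀ h → gc (suc t) ⊢[ h ℕ.* 4 ] port (gadget h)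
    gc⊢port zero = gc⊢gadget
    gc⊢port (suc h) = relax (ℕ.≤-reflexive (ℕ.+-comm (h ℕ.* 4) 4)) (gc⊢port h ▸ port⊢next (gadget h))

    -- Moving factors between slots

    mv-sym : ∀ {h γ γ'} → Mv h γ γ' → Mv h γ' γ
    mv-sym (base e) = base (λ r → sym (e r))
    mv-sym (degen a b γa γ'b) = degen b a γ'b γa
    mv-sym (rule a b c c' s s' m₁ m₃ m₁' m₃') = rule b a c' c s' s m₁' m₃' m₁ m₃

    mv-resp : ∀ {h γ γ' δ δ'} → γ ≗ δ → γ' ≗ δ' → Mv h γ γ' → Mv h δ δ'
    mv-resp e e' (base d) = base (λ r → trans (sym (e r)) (trans (d r) (e' r)))
    mv-resp e e' (degen a b γa γ'b) = degen a b (trans (sym (e a)) γa) (trans (sym (e' b)) γ'b)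
    mv-resp e e' (rule a b c c' s s' m₁ m₃ m₁' m₃') = rule a b c c' (shift-resp e s) (shift-resp e' s') m₁ m₃ m₁' m₃'
      where
      shift-resp : ∀ {γ δ a c f₁ f₃} → γ ≗ δ → Shift γ a c f₁ f₃ → Shift δ a c f₁ f₃
      shift-resp e (shift p q p' q') = shift (trans p (cong (_ +_) (e _))) (λ r n → trans (q r n) (e r)) p' (λ r n → trans (q' r n) (e r))

    -- The rings meet at `δ`. Their second meeting is between values whose slot 0 is empty, which
    -- `degen` connects. Composing two moves of equal height costs a single round, so long chains
    -- cost only a logarithm.
    mv-comp : ∀ {h γ δ γ'} → Mv (suc h) γ δ → Mv (suc h) δ γ' → Mv (suc (suc h)) γ γ'
    mv-comp {h} {γ} {δ} {γ'} m m' = rule zero zero 0# 0# (self γ) (self γ')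
      (mv-sym m) (mv-refl (suc h) {0# ◃ (γ ∘ suc)} λ _ → refl) m' (degen zero zero refl refl)
      where
      self : ∀ γ → Shift γ zero 0# γ (0# ◃ (γ ∘ suc))
      self γ = shift (sym (+-identityˡ _)) (λ _ _ → refl) refl (λ { zero p → ⊥-elim (p refl) ; (suc _) _ → refl })

    -- The factor n can be moved between slot 0 and slot suc b.
    Movable : ℕ → F → Set
    Movable h n = ∀ b γ γ' → γ' zero ≡ n * γ zero → γ (suc b) ≡ n * γ' (suc b) →
      (∀ j → j ≢ b → γ (suc j) ≡ γ' (suc j)) → Mv h γ γ'

    movable-1 : ∀ {h} → Movable h 1#
    movable-1 {h} b γ γ' e₀ e₁ e = mv-refl h λ { zero → sym (trans e₀ (*-identityˡ _)) ; (suc j) → tl j }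
      where
      tl : ∀ j → γ (suc j) ≡ γ' (suc j)
      tl j with j ≟ b
      ... | yes refl = trans e₁ (*-identityˡ _)
      ... | no j≢b = e j j≢b

    movable-0 : ∀ {h} → Movable (suc h) 0#
    movable-0 b γ γ' e₀ e₁ e = degen (suc b) zero (trans e₁ (zeroˡ _)) (trans e₀ (zeroˡ _))

    -- In slots 0 and `suc b` the values are `γ = (ξ, nη)` and `γ' = (nξ, η)`. Shifting by `n₀η` and
    -- `n₀ξ` gives `(ξ, n₁n₂η)` and `(n₁n₂ξ, η)`, which meet at `(n₁ξ, n₂η)`, while the other
    -- corners `(ξ, n₀η)` and `(n₀ξ, η)` differ by moving `n₀`.
    movable-comb : ∀ {h n n₀ n₁ n₂} → n₀ + n ≡ n₁ * n₂ → Movable h n₁ → Movable h n₂ → Movable h n₀ → Movable (suc h) n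
    movable-comb {h} {n} {n₀} {n₁} {n₂} eq M₁ M₂ M₀ b γ γ' e₀ e₁ e =
      rule (suc b) zero (n₀ * η) (n₀ * ξ)
        (shift (mk-b _) (off-b ξ _ refl) (mk-b _) (off-b ξ _ refl))
        (shift refl (off-0 (n₀ * ξ + γ' zero)) refl (off-0 (n₀ * ξ)))
        (mv-sym (M₁ b f₁ γ₁ refl
          (trans (mk-b _) (trans (cong (n₀ * η +_) e₁) (trans (sym (distribʳ η n₀ n)) (trans (cong (_* η) eq)
            (trans (*-assoc n₁ n₂ η) (cong (n₁ *_) (sym (mk-b _))))))))
          (λ j p → trans (mk-off _ j p) (sym (mk-off _ j p)))))
        (mv-refl h λ _ → refl)
        (M₂ b γ₁ f₁'
          (trans (cong (n₀ * ξ +_) e₀) (trans (sym (distribʳ ξ n₀ n)) (trans (cong (_* ξ) (trans eq (*-comm n₁ n₂))) (*-assoc n₂ n₁ ξ))))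
          (trans (mk-b _) (cong (n₂ *_) (sym (mk-b _))))
          (λ j p → trans (mk-off _ j p) (sym (mk-off _ j p))))
        (M₀ b f₃ f₃' refl (trans (mk-b _) (cong (n₀ *_) (sym (mk-b _))))
          (λ j p → trans (mk-off _ j p) (sym (mk-off _ j p))))
      where
      ξ = γ zero
      η = γ' (suc b)
      mk : F → F → W
      mk x y = x ◃ updateAt (γ ∘ suc) b (λ _ → y)
      mk-b : ∀ y → updateAt (γ ∘ suc) b (λ _ → y) b ≡ y
      mk-b y = updateAt-updates b (γ ∘ suc)
      mk-off : ∀ y j → j ≢ b → updateAt (γ ∘ suc) b (λ _ → y) j ≡ γ (suc j)
      mk-off y j p = updateAt-minimal j b (γ ∘ suc) p
      f₁ = mk ξ (n₀ * η + γ (suc b))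
      f₃ = mk ξ (n₀ * η)
      f₁' = mk (n₀ * ξ + γ' zero) η
      f₃' = mk (n₀ * ξ) η
      γ₁ = mk (n₁ * ξ) (n₂ * η)
      off-b : ∀ x y → x ≡ γ zero → mk x y ≈[ suc b ] γ
      off-b x y x≡ zero _ = x≡
      off-b x y x≡ (suc j) p = mk-off y j (λ q → p (cong suc q))
      off-0 : ∀ x → mk x η ≈[ zero ] γ'
      off-0 x zero p = ⊥-elim (p refl)
      off-0 x (suc j) _ with j ≟ b
      ... | yes refl = mk-b η
      ... | no j≢b = trans (mk-off η j j≢b) (e j j≢b)

    movable-suc : ∀ {h n} → Movable (suc h) n → Movable (suc (suc h)) n
    movable-suc {h} {n} M = movable-comb {n₀ = 0#} {n₁ = n} {n₂ = 1#} (trans (+-identityˡ n) (sym (*-identityʳ n))) M movable-1 movable-0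

    IntMovable : ℕ → ℕ → Set
    IntMovable h B = ∀ n → n ≤ B → Movable h (fromℕ n) × Movable h (- fromℕ n)

    intMovable-1 : IntMovable 2 1
    intMovable-1 zero _ = movable-0 , subst (Movable 2) (sym -0#≈0#) movable-0
    intMovable-1 (suc zero) _ = subst (Movable 2) (sym (+-identityʳ 1#)) movable-1 ,
      -- Minus one is 0 * 0 - 1.
      movable-comb {n₀ = 1#} {n₁ = 0#} {n₂ = 0#} (trans (cong (λ x → 1# + - x) (+-identityʳ 1#)) (trans (-‿inverseʳ 1#) (sym (zeroˡ 0#)))) movable-0 movable-0 movable-1
    intMovable-1 (suc (suc n)) (s≤s ())

    -- Division by `B` gives n = q B - (-r) and -n = (-q) B - r, so the range is squared in one
    -- round as long as both signs are carried along.
    intMovable-step : ∀ {h B} → IntMovable h B → IntMovable (suc h) (B ℕ.* B ℕ.+ B)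
    intMovable-step {h} {B} M n n≤ = combine (split B n≤)
      where
      split : ∀ B → n ≤ B ℕ.* B ℕ.+ B → Σ ℕ λ q → Σ ℕ λ r → q ≤ B × r ≤ B × n ≡ q ℕ.* B ℕ.+ r
      split zero z≤n = 0 , 0 , z≤n , z≤n , refl
      split B@(suc _) n≤ with n <? B ℕ.* B
      ... | yes n<BB = n / B , n % B , ℕ.<⇒≤ (m<n*o⇒m/o<n n<BB) , ℕ.<⇒≤ (m%n<n n B) , trans (m≡m%n+[m/n]*n n B) (ℕ.+-comm (n % B) _)
      ... | no n≮BB = B , n ℕ.∸ B ℕ.* B , ℕ.≤-refl , ℕ.≤-trans (ℕ.∸-monoˡ-≤ (B ℕ.* B) n≤) (ℕ.≤-reflexive (ℕ.m+n∸m≡n (B ℕ.* B) B)) , sym (ℕ.m+[n∸m]≡n (ℕ.≮⇒≥ n≮BB))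
      combine : (Σ ℕ λ q → Σ ℕ λ r → q ≤ B × r ≤ B × n ≡ q ℕ.* B ℕ.+ r) → Movable (suc h) (fromℕ n) × Movable (suc h) (- fromℕ n)
      combine (q , r , q≤ , r≤ , e) =
        movable-comb pos (proj₁ (M q q≤)) (proj₁ (M B ℕ.≤-refl)) (proj₂ (M r r≤)) ,
        movable-comb neg (proj₂ (M q q≤)) (proj₁ (M B ℕ.≤-refl)) (proj₁ (M r r≤))
        where
        n≡ : fromℕ n ≡ fromℕ r + fromℕ q * fromℕ B
        n≡ = trans (cong fromℕ e) (trans (fromℕ-+ (q ℕ.* B) r) (trans (+-comm _ _) (cong (fromℕ r +_) (fromℕ-* q B))))
        pos : - fromℕ r + fromℕ n ≡ fromℕ q * fromℕ B
        pos = trans (cong (- fromℕ r +_) n≡) (trans (sym (+-assoc _ _ _)) (trans (cong (_+ fromℕ q * fromℕ B) (-‿inverseˡ _)) (+-identityˡ _)))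
        neg : fromℕ r + - fromℕ n ≡ - fromℕ q * fromℕ B
        neg = trans (cong (λ x → fromℕ r + - x) n≡) (trans (cong (fromℕ r +_) (sym (-‿+-comm _ _))) (trans (sym (+-assoc _ _ _))
          (trans (cong (_+ - (fromℕ q * fromℕ B)) (-‿inverseʳ _)) (trans (+-identityˡ _) (-‿distribˡ-* _ _)))))

    intMovable-mono : ∀ {h B B'} → B' ≤ B → IntMovable h B → IntMovable h B'
    intMovable-mono B'≤B M n n≤ = M n (ℕ.≤-trans n≤ B'≤B)

    -- The heights 2 and 3 reach 1 and 1 * 1 + 1 = 2; from there on each round squares.
    intMovable : ∀ h → IntMovable (3 ℕ.+ h) (2 ^ (2 ^ h))
    intMovable zero = intMovable-step intMovable-1
    intMovable (suc h) = intMovable-mono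
      (ℕ.≤-trans (ℕ.≤-reflexive (trans (cong (2 ^_) (cong (2 ^ h ℕ.+_) (ℕ.+-identityʳ (2 ^ h)))) (ℕ.^-distribˡ-+-* 2 (2 ^ h) (2 ^ h)))) (ℕ.m≤m+n _ _))
      (intMovable-step (intMovable h))

    mv-chain : ∀ {h} (p : ℕ → W) → (∀ m → Mv (suc h) (p m) (p (suc m))) → ∀ q m → Mv (suc (q ℕ.+ h)) (p m) (p (2 ^ q ℕ.+ m))
    mv-chain p step zero m = step m
    mv-chain {h} p step (suc q) m = subst (λ k → Mv (suc (suc (q ℕ.+ h))) (p m) (p k))
      (trans (sym (ℕ.+-assoc (2 ^ q) (2 ^ q) m)) (cong (λ x → 2 ^ q ℕ.+ x ℕ.+ m) (sym (ℕ.+-identityʳ (2 ^ q)))))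
      (mv-comp (mv-chain p step q m) (mv-chain p step q (2 ^ q ℕ.+ m)))

    prod-replace : ∀ {n} (b : Fin n) (f g : Vector F n) → f b ≡ 1# → (∀ j → j ≢ b → f j ≡ g j) → prod g ≡ g b * prod f
    prod-replace {suc n} b f g fb h = trans (prod-remove {i = b} g) (cong (g b *_) (sym (trans (prod-remove {i = b} f)
      (trans (cong (_* prod (removeAt f b)) fb) (trans (*-identityˡ _) (prod-cong-≗ λ j → h _ (punchInᵢ≢i b j)))))))

    -- Collects the coefficients of all slots in slot 0, one slot at a time.
    mv-product : ∀ {h} q → t ≤ 2 ^ q → ∀ c → (∀ r → Movable (suc h) (c (suc r))) → Mv (suc (q ℕ.+ h)) c (prod c ◃ (λ _ → 1#))
    mv-product {h} q t≤ c M = mv-resp start end (mv-chain p step q 0)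
      where
      lt : ℕ → Fin t → Bool
      lt m r = does (toℕ r <? m)
      lt-yes : ∀ {m r} → toℕ r < m → lt m r ≡ true
      lt-yes h = dec-true (_ <? _) h
      lt-no : ∀ {m r} → m ≤ toℕ r → lt m r ≡ false
      lt-no h = dec-false (_ <? _) (ℕ.≤⇒≯ h)
      done : ℕ → Vector F t
      done m r = if lt m r then c (suc r) else 1#
      todo : ℕ → Vector F t
      todo m r = if lt m r then 1# else c (suc r)
      p : ℕ → W
      p m = c zero * prod (done m) ◃ todo m
      lt-suc : ∀ m r → toℕ r ≢ m → lt m r ≡ lt (suc m) r
      lt-suc m r ne with ℕ.<-≤-connex (toℕ r) m
      ... | inj₁ r<m = trans (lt-yes {m} {r} r<m) (sym (lt-yes {suc m} {r} (ℕ.m≤n⇒m≤1+n r<m)))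
      ... | inj₂ m≤r = trans (lt-no {m} {r} m≤r) (sym (lt-no {suc m} {r} (ℕ.≤∧≢⇒< m≤r (λ e → ne (sym e)))))
      step : ∀ m → Mv (suc h) (p m) (p (suc m))
      step m with m <? t
      -- Past `t` the path stands still; it is prolonged to the length 2 ^ q that repeated doubling
      -- requires.
      ... | no m≮t = mv-refl (suc h) λ
        { zero → cong (c zero *_) (prod-cong-≗ λ r → cong (if_then c (suc r) else 1#) (same r)) ; (suc r) → cong (if_then 1# else c (suc r)) (same r) }
        where
        same : ∀ r → lt m r ≡ lt (suc m) r
        same r = lt-suc m r (λ e → ℕ.<⇒≢ (ℕ.<-≤-trans (toℕ<n r) (ℕ.≮⇒≥ m≮t)) e)
      ... | yes m<t = M b b (p m) (p (suc m))
        (trans (cong (c zero *_) (trans (prod-replace b (done m) (done (suc m)) before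
            (λ j j≢b → cong (if_then c (suc j) else 1#) (lt-suc m j (λ e → j≢b (toℕ-injective (trans e (sym toℕ-b)))))))
            (cong (_* prod (done m)) now)))
          (trans (sym (*-assoc _ _ _)) (trans (cong (_* prod (done m)) (*-comm _ _)) (*-assoc _ _ _))))
        (trans (cong (if_then 1# else c (suc b)) (lt-no {m} {b} (ℕ.≤-reflexive (sym toℕ-b)))) (trans (sym (*-identityʳ _)) (cong (c (suc b) *_) (sym (cong (if_then 1# else c (suc b)) (lt-yes {suc m} {b} (s≤s (ℕ.≤-reflexive toℕ-b))))))))
        (λ j j≢b → cong (if_then 1# else c (suc j)) (lt-suc m j (λ e → j≢b (toℕ-injective (trans e (sym toℕ-b))))))
        where
        b = fromℕ< m<t
        toℕ-b : toℕ b ≡ m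
        toℕ-b = toℕ-fromℕ< m<t
        now : done (suc m) b ≡ c (suc b)
        now = cong (if_then c (suc b) else 1#) (lt-yes {suc m} {b} (s≤s (ℕ.≤-reflexive toℕ-b)))
        before : done m b ≡ 1#
        before = cong (if_then c (suc b) else 1#) (lt-no {m} {b} (ℕ.≤-reflexive (sym toℕ-b)))
      start : p 0 ≗ c
      start zero = trans (cong (c zero *_) (prod-1 t)) (*-identityʳ _)
        where
        prod-1 : ∀ n → prod {n} (λ _ → 1#) ≡ 1#
        prod-1 zero = refl
        prod-1 (suc n) = trans (*-identityˡ _) (prod-1 n)
      start (suc r) = refl
      end : p (2 ^ q ℕ.+ 0) ≗ (prod c ◃ (λ _ → 1#))
      end zero = cong (c zero *_) (prod-cong-≗ λ r → cong (if_then c (suc r) else 1#) (lt-yes {2 ^ q ℕ.+ 0} {r} (below r)))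
        where
        below : ∀ (r : Fin t) → toℕ r < 2 ^ q ℕ.+ 0
        below r = ℕ.<-≤-trans (toℕ<n r) (ℕ.≤-trans t≤ (ℕ.m≤m+n _ 0))
      end (suc r) = cong (if_then 1# else c (suc r)) (lt-yes {2 ^ q ℕ.+ 0} {r} (ℕ.<-≤-trans (toℕ<n r) (ℕ.≤-trans t≤ (ℕ.m≤m+n _ 0))))

    -- Chains and cycles of copies

    -- Each form belongs to end A, to end B or has to be degenerate. The offset `α` is seen at A,
    -- and passing through the copy adds `weight u`, so B sees only their sum.
    record Links (Z : Port) : Set₁ where
      field
        A B    : I Z → Bool
        Λ      : Set
        Leaf   : Set
        weight : Leaf → Λ → F
        place     : Leaf → (Λ → F) → W → P Z
        agreeA : ∀ u u' α α' → (∀ l → α l ≡ α' l) → ∀ w ι → A ι ≡ true → rel Z ι (place u α w) (place u' α' w)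
        agreeB : ∀ u u' α α' → (∀ l → α l + weight u l ≡ α' l + weight u' l) → ∀ w ι → B ι ≡ true → rel Z ι (place u α w) (place u' α' w)
        place-deg : ∀ u α ι → A ι ≡ false → B ι ≡ false → Degenerate (λ w w' → rel Z ι (place u α w) (place u α w'))

    module Chains {Z : Port} (𝓛 : Links Z) where
      open Links 𝓛

      -- Gluing right ends to right ends reverses the second half: both ends of the new chain are
      -- left ends of halves, and the weights of the second half count negatively in `total`.
      chain : ℕ → Port
      leftEnd rightEnd : ∀ q → I (chain q) → Bool
      chain zero = Z
      chain (suc q) = Join (chain q) (rightEnd q)
      leftEnd zero = A
      leftEnd (suc q) (left ι _) = leftEnd q ι
      leftEnd (suc q) _ = false
      rightEnd zero = B
      rightEnd (suc q) (right ι _) = leftEnd q ι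
      rightEnd (suc q) _ = false

      ⊢chain : ∀ q → Z ⊢[ q ] chain q
      ⊢chain zero = ⊢-refl
      ⊢chain (suc q) = relax (ℕ.≤-reflexive (ℕ.+-comm q 1)) (⊢chain q ▸ join (rightEnd q))

      data Tree : ℕ → Set where
        leaf : Leaf → Tree 0
        node : ∀ {q} → Tree q → Tree q → Tree (suc q)

      total : ∀ {q} → Tree q → Λ → F
      total (leaf u) = weight u
      total (node u v) l = total u l + - total v l

      first : ∀ {q} → Tree q → Leaf
      first (leaf u) = u
      first (node u _) = first u

      DegenerateOut : Leaf → Set
      DegenerateOut u = Σ (Fin (suc t)) λ r → ∀ α w w' → w ≈[ r ] w' → out Z (place u α w) ≡ out Z (place u α w')

      -- The output of the first leaf is that of the chain. The output of every other leaf is turned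
      -- into a form by some join and has to be degenerate.
      AllDegenerate TailDegenerate : ∀ {q} → Tree q → Set
      AllDegenerate (leaf u) = DegenerateOut u
      AllDegenerate (node u v) = AllDegenerate u × AllDegenerate v
      TailDegenerate (leaf u) = ⊤
      TailDegenerate (node u v) = TailDegenerate u × AllDegenerate v

      all⇒first : ∀ {q} (u : Tree q) → AllDegenerate u → DegenerateOut (first u)
      all⇒first (leaf u) d = d
      all⇒first (node u _) (d , _) = all⇒first u d

      all⇒tail : ∀ {q} (u : Tree q) → AllDegenerate u → TailDegenerate u
      all⇒tail (leaf u) _ = tt
      all⇒tail (node u _) (d , e) = all⇒tail u d , e

      private

        -- The offset with which the second half has to start for the right ends to meet.
        shifted : (Λ → F) → ∀ {q} → Tree q → Tree q → Λ → F
        shifted α u v l = α l + (total u l + - total v l)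

        shifted-total : ∀ α {q} (u v : Tree q) l → α l + total u l ≡ shifted α u v l + total v l
        shifted-total α u v l = sym (trans (+-assoc (α l) _ _) (cong (α l +_)
          (trans (+-assoc _ _ _) (trans (cong (total u l +_) (-‿inverseˡ _)) (+-identityʳ _)))))

      point : ∀ {q} → Tree q → (Λ → F) → W → P (chain q)
      point-left : ∀ {q} (u u' : Tree q) α α' → (∀ l → α l ≡ α' l) → ∀ w ι → leftEnd q ι ≡ true →
        rel (chain q) ι (point u α w) (point u' α' w)
      point-right : ∀ {q} (u u' : Tree q) α α' → (∀ l → α l + total u l ≡ α' l + total u' l) → ∀ w ι → rightEnd q ι ≡ true →
        rel (chain q) ι (point u α w) (point u' α' w)
      point (leaf u) α w = place u α w
      point (node u v) α w = (point u α w , point v (shifted α u v) w) , point-right u v α (shifted α u v) (shifted-total α u v) w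
      point-left (leaf u) (leaf u') α α' e w ι p = agreeA u u' α α' e w ι p
      point-left (node u v) (node u' v') α α' e w (left ι _) p = point-left u u' α α' e w ι p
      point-right (leaf u) (leaf u') α α' e w ι p = agreeB u u' α α' e w ι p
      point-right (node u v) (node u' v') α α' e w (right ι _) p = point-left v v' (shifted α u v) (shifted α' u' v') e w ι p

      out-point : ∀ {q} (u : Tree q) α w → out (chain q) (point u α w) ≡ out Z (place (first u) α w)
      out-point (leaf u) α w = refl
      out-point (node u v) α w = out-point u α w

      point-deg : ∀ {q} (u : Tree q) → TailDegenerate u → ∀ α ι → leftEnd q ι ≡ false → rightEnd q ι ≡ false →
        Degenerate (λ w w' → rel (chain q) ι (point u α w) (point u α w'))
      point-deg (leaf u) _ α ι p q = place-deg u α ι p q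
      point-deg (node u v) (d , e) α (left ι r) p q = point-deg u d α ι p r
      point-deg (node u v) (d , e) α (right ι r) p q = point-deg v (all⇒tail v e) (shifted α u v) ι q r
      point-deg (node u v) (d , e) α atom p q with r , h ← all⇒first v e =
        r , λ w w' w≈w' → trans (out-point v (shifted α u v) w) (trans (h _ w w' w≈w') (sym (out-point v (shifted α u v) w')))

      -- Both ends of a chain are glued to those of a second one, closing up a cycle.
      cycle⊢gc : ∀ {q} (u v : Tree q) → (∀ l → total u l ≡ total v l) → TailDegenerate u → AllDegenerate v →
        (ρ : W → W) → (∀ {r w w'} → w ≈[ r ] w' → ρ w ≈[ r ] ρ w') →
        (∀ α w → out Z (place (first u) α (ρ w)) ≡ sum w) →
        Z ⊢[ suc q ] gc t
      cycle⊢gc {q} u v bal du dv ρ ρ-≈ out-first = relax (ℕ.≤-reflexive (ℕ.+-comm q 1)) (⊢chain q ▸ joinSim (record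
        { S = S
        ; θL = λ w → point u α₀ (ρ w)
        ; θR = λ w → point v α₀ (ρ w)
        ; out-L = λ w → trans (out-point u α₀ (ρ w)) (out-first α₀ w)
        ; agree = agrees
        ; dep-L = λ ι p → depends u du ι p
        ; dep-R = λ ι p → depends v (all⇒tail v dv) ι p
        ; dep-O = proj₁ (all⇒first v dv) , λ w w' h → trans (out-point v α₀ _)
            (trans (proj₂ (all⇒first v dv) α₀ _ _ (ρ-≈ h)) (sym (out-point v α₀ _))) }))
        where
        S : I (chain q) → Bool
        S ι = leftEnd q ι ∨ rightEnd q ι
        α₀ : Λ → F
        α₀ _ = 0#
        agrees : ∀ w ι → S ι ≡ true → rel (chain q) ι (point u α₀ (ρ w)) (point v α₀ (ρ w))
        agrees w ι p with leftEnd q ι in eq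
        ... | true = point-left u v α₀ α₀ (λ _ → refl) (ρ w) ι eq
        ... | false = point-right u v α₀ α₀ (λ l → cong (0# +_) (bal l)) (ρ w) ι p
        ∨-left : ∀ {a b} → a ∨ b ≡ false → a ≡ false
        ∨-left {false} _ = refl
        ∨-right : ∀ {a b} → a ∨ b ≡ false → b ≡ false
        ∨-right {false} h = h
        depends : ∀ (u : Tree q) → TailDegenerate u → ∀ ι → S ι ≡ false →
          Σ (Fin (suc t)) λ r → ∀ w w' → w ≈[ r ] w' → rel (chain q) ι (point u α₀ (ρ w)) (point u α₀ (ρ w'))
        depends u d ι p with r , h ← point-deg u d α₀ ι (∨-left p) (∨-right {leftEnd q ι} p) = r , λ w w' e → h _ _ (ρ-≈ e)

  -- Systems of forms with ports attached

  module Forms {k d : ℕ} (A : Fin k → Fin d → F) where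

    φ : Fin k → Vector F d → F
    φ l v = sum (λ c → A l c * v c)

    lin : ∀ {n} → (Fin n → Vector F d) → Vector F n → Vector F d
    lin b w c = sum (λ r → b r c * w r)

    φ-lin : ∀ l {n} (b : Fin n → Vector F d) w → φ l (lin b w) ≡ sum (λ r → φ l (b r) * w r)
    φ-lin l b w = begin
      sum (λ c → A l c * sum (λ r → b r c * w r))      ≡⟨ sum-cong-≗ (λ c → *-distribˡ-sum (A l c) (λ r → b r c * w r)) ⟩
      sum (λ c → sum (λ r → A l c * (b r c * w r)))    ≡⟨ ∑-comm (λ c r → A l c * (b r c * w r)) ⟩
      sum (λ r → sum (λ c → A l c * (b r c * w r)))    ≡⟨ sum-cong-≗ (λ r → sum-cong-≗ (λ c → sym (*-assoc (A l c) (b r c) (w r)))) ⟩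
      sum (λ r → sum (λ c → A l c * b r c * w r))      ≡⟨ sum-cong-≗ (λ r → sym (*-distribʳ-sum (w r) (λ c → A l c * b r c))) ⟩
      sum (λ r → φ l (b r) * w r)                      ∎
      where open ≡-Reasoning

    φ-scale : ∀ l v e → φ l (λ c → v c * e) ≡ φ l v * e
    φ-scale l v e = trans (sum-≗ (λ c → A l c * (v c * e)) (λ c → A l c * v c * e) (λ c → sym (*-assoc (A l c) (v c) e)))
      (sym (*-distribʳ-sum e (λ c → A l c * v c)))

    module Systems (x : Fin k → Vector F d) (φx : ∀ j → φ j (x j) ≡ 1#) where

      section : Fin k → F → Vector F d
      section j e c = x j c * e

      φ-section : ∀ j e → φ j (section j e) ≡ e
      φ-section j e = trans (φ-scale j (x j) e) (trans (cong (_* e) (φx j)) (*-identityˡ e))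

      -- There are no visible forms here: `φ l` is seen only through the port attached to it.
      centre : Fin k → Ctxs k
      centre i = record
        { P = Vector F d ; main = φ i ; hole = φ
        ; I = ⊥ ; rel = λ () ; rfl = λ ()
        ; msec = section i ; main-msec = φ-section i
        ; hsec = section ; hole-hsec = φ-section }

      Sys : Fin k → (Fin k → Port) → Port
      Sys i X = plugs (centre i) X

      Sys-⊢ : ∀ i {X X' n} → (∀ l → X l ⊢[ n ] X' l) → Sys i X ⊢[ k ℕ.* n ] Sys i X'
      Sys-⊢ i = plugs-⊢ (centre i)

      Sys-⊢₀ : ∀ i {X X'} → (∀ l → X l ⊢[ 0 ] X' l) → Sys i X ⊢[ 0 ] Sys i X'
      Sys-⊢₀ i h = relax (ℕ.≤-reflexive (ℕ.*-zeroʳ k)) (Sys-⊢ i h)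

      Others : Fin k → Port → Fin k → Port
      Others i Y l = pick (l ≟ i) Y

      pick-⊢ : ∀ {Q : Set} (dec : Dec Q) {Y Y' n} → Y ⊢[ n ] Y' → pick dec Y ⊢[ n ] pick dec Y'
      pick-⊢ (yes _) _ = relax ℕ.z≤n ⊢-refl
      pick-⊢ (no _) d = d

      module Leaves (t H : ℕ) (i : Fin k) where
        open AtLevel t

        private
          module Y = Gadget (gadget H)
          Yport = port (gadget H)

          isMark : Bool → ∀ {Q : Set} (dec : Dec Q) → I (pick dec Yport) → Bool
          isMark true (no _) (inj₁ true) = true
          isMark false (no _) (inj₁ false) = true
          isMark _ (no _) _ = false

        -- A copy moved in the directions `vec`. At `φ l` it has the coefficients `φ l (vec r)`,
        -- which the gadget turns into their product followed by ones, so that at the far points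
        -- copies differ by one number only.
        record Term : Set where
          field
            vec  : Fin (suc t) → Vector F d
            moves : ∀ l → l ≢ i → Mv H (λ r → φ l (vec r)) (prod (λ r → φ l (vec r)) ◃ (λ _ → 1#))

        open Term public

        coef : Term → Fin k → Fin (suc t) → F
        coef u l r = φ l (vec u r)

        -- Slot i carries no gadget, so its weight is irrelevant and set to 0.
        wt : Term → ∀ l → Dec (l ≡ i) → F
        wt u l (yes _) = 0#
        wt u l (no _) = prod (coef u l)

        -- The coefficient π of slot 0 is split into -α and α + π. The mark omitting coordinate 1
        -- sees α but not π, the mark omitting coordinate 0 sees only α + π; this makes π the weight
        -- of the copy in a chain.
        farT : F → F → W → Far
        farT α π w = - α * w zero ◃ (α + π) * w zero ◃ (λ r → w (suc r))

        private
          farT-sum : ∀ α π w → sum (farT α π w) ≡ val (π ◃ (λ _ → 1#)) w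
          farT-sum α π w = trans (sym (+-assoc _ _ _)) (cong₂ _+_
            (trans (sym (distribʳ (w zero) (- α) (α + π))) (cong (_* w zero) (trans (sym (+-assoc _ _ _)) (trans (cong (_+ π) (-‿inverseˡ α)) (+-identityˡ π)))))
            (sum-cong-≗ (λ r → sym (*-identityˡ (w (suc r))))))

          farT-admissible : ∀ α π → Admissible (farT α π)
          farT-admissible α π r = suc r , λ w w' h →
            λ { zero _ → cong (- α *_) (h zero λ ()) ; (suc zero) _ → cong ((α + π) *_) (h zero λ ())
              ; (suc (suc r')) p → h (suc r') λ { refl → p refl } }

        config : ∀ u l → l ≢ i → ∀ α → Config (gadget H) (val (coef u l)) (farT α (prod (coef u l)))
        config u l l≢i α = gadget-realised H (moves u l l≢i) _ (farT-sum α _) (farT-admissible α _)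

        private
          zAt : Term → (Fin k → F) → W → ∀ l (dec : Dec (l ≡ i)) → P (pick dec Yport)
          zAt u α w l (yes _) = φ l (lin (vec u) w)
          zAt u α w l (no l≢i) = at (config u l l≢i (α l)) w

          zAt-out : ∀ u α w l dec → φ l (lin (vec u) w) ≡ out (pick dec Yport) (zAt u α w l dec)
          zAt-out u α w l (yes _) = refl
          zAt-out u α w l (no l≢i) = trans (φ-lin l (vec u) w) (sym (out-at (config u l l≢i (α l)) w))

          far-≡ : ∀ u u' l (l≢i : l ≢ i) a a' w c → farT a (prod (coef u l)) w c ≡ farT a' (prod (coef u' l)) w c →
            Y.far (at (config u l l≢i a) w) c ≡ Y.far (at (config u' l l≢i a') w) c
          far-≡ u u' l l≢i a a' w c h = trans (far-at (config u l l≢i a) w c) (trans h (sym (far-at (config u' l l≢i a') w c)))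

          zAt-A : ∀ u u' α α' w l dec → α l ≡ α' l → ∀ ι → isMark true dec ι ≡ true →
            rel (pick dec Yport) ι (zAt u α w l dec) (zAt u' α' w l dec)
          zAt-A u u' α α' w l (no l≢i) e (inj₁ true) _ =
            λ { zero p → far-≡ u u' l l≢i _ _ w zero (cong (λ a → - a * w zero) e) ; (suc zero) p → ⊥-elim (p refl)
              ; (suc (suc r)) p → far-≡ u u' l l≢i _ _ w (suc (suc r)) refl }

          zAt-B : ∀ u u' α α' w l dec → α l + wt u l dec ≡ α' l + wt u' l dec → ∀ ι → isMark false dec ι ≡ true →
            rel (pick dec Yport) ι (zAt u α w l dec) (zAt u' α' w l dec)
          zAt-B u u' α α' w l (no l≢i) e (inj₁ false) _ =
            λ { zero p → ⊥-elim (p refl) ; (suc zero) p → far-≡ u u' l l≢i _ _ w (suc zero) (cong (_* w zero) e)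
              ; (suc (suc r)) p → far-≡ u u' l l≢i _ _ w (suc (suc r)) refl }

          zAt-deg : ∀ u α l dec ι → isMark true dec ι ≡ false → isMark false dec ι ≡ false →
            Degenerate (λ w w' → rel (pick dec Yport) ι (zAt u α w l dec) (zAt u α w' l dec))
          zAt-deg u α l (no l≢i) (inj₁ true) () _
          zAt-deg u α l (no l≢i) (inj₁ false) _ ()
          zAt-deg u α l (no l≢i) (inj₂ ι) _ _ = deg (config u l l≢i (α l)) ι

        links : Links (Sys i (Others i Yport))
        links = record
          { A = λ { (inj₂ (l , ι)) → isMark true (l ≟ i) ι }
          ; B = λ { (inj₂ (l , ι)) → isMark false (l ≟ i) ι }
          ; Λ = Fin k
          ; Leaf = Term
          ; weight = λ u l → wt u l (l ≟ i)
          ; place = λ u α w → lin (vec u) w , (λ l → zAt u α w l (l ≟ i)) , λ l → zAt-out u α w l (l ≟ i)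
          ; agreeA = λ { u u' α α' e w (inj₂ (l , ι)) p → zAt-A u u' α α' w l (l ≟ i) (e l) ι p }
          ; agreeB = λ { u u' α α' e w (inj₂ (l , ι)) p → zAt-B u u' α α' w l (l ≟ i) (e l) ι p }
          ; place-deg = λ { u α (inj₂ (l , ι)) p q → zAt-deg u α l (l ≟ i) ι p q } }

        open Chains links public

        degenerate-out : ∀ u r → coef u i r ≡ 0# → DegenerateOut u
        degenerate-out u r h = r , λ α w w' e → trans (φ-lin i (vec u) w) (trans (val-off (coef u i) r h w w' e) (sym (φ-lin i (vec u) w')))

        level-step : ∀ {q} (u v : Tree q) → (∀ l → total u l ≡ total v l) → TailDegenerate u → AllDegenerate v →
          ∀ a → a ≢ 0# → (∀ r → coef (first u) i r ≡ a) →
          Sys i (Others i (gc (suc t))) ⊢[ k ℕ.* (H ℕ.* 4) ℕ.+ suc q ] gc t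
        level-step u v bal du dv a a≢0 ha with a' , a'a≡1 ← inverse a a≢0 =
          Sys-⊢ i (λ l → pick-⊢ (l ≟ i) (gc⊢port H)) ▸
          cycle⊢gc u v bal du dv (λ w r → a' * w r) (λ h c p → cong (a' *_) (h c p))
            (λ α w → trans (φ-lin i (vec (first u)) (λ r → a' * w r))
              (sum-cong-≗ λ r → trans (cong (_* (a' * w r)) (ha r)) (trans (sym (*-assoc a a' (w r))) (trans (cong (_* w r) (trans (*-comm a a') a'a≡1)) (*-identityˡ (w r))))))

    -- Tensor powers and products of directions

    InSpan : Fin k → ℕ → Set
    InSpan i n = Σ (Vector F k) λ c → c i ≡ 0# ×
      (∀ (ℓ : Fin n → Fin d) → prod (λ r → A i (ℓ r)) ≡ sum (λ l → c l * prod (λ r → A l (ℓ r))))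

    Entry : ℕ → F → Set
    Entry L y = Σ ℕ λ n → n ≤ L × (y ≡ fromℕ n ⊎ y ≡ - fromℕ n)

    φ-unit : ∀ l ℓ → φ l (unit ℓ) ≡ A l ℓ
    φ-unit l = sum-unit (A l)

    φ-comb : ∀ l x y u v → φ l (λ c → x * u c + y * v c) ≡ x * φ l u + y * φ l v
    φ-comb l x y u v = trans (sum-≗ _ (λ c → x * (A l c * u c) + y * (A l c * v c)) (λ c → trans (distribˡ (A l c) _ _) (cong₂ _+_ (*-swap _ _ _) (*-swap _ _ _))))
      (trans (∑-distrib-+ (λ c → x * (A l c * u c)) (λ c → y * (A l c * v c)))
      (cong₂ _+_ (sym (*-distribˡ-sum x (λ c → A l c * u c))) (sym (*-distribˡ-sum y (λ c → A l c * v c)))))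

    -- The zero form has zero powers, which lie in every span.
    nonzero : ∀ j {n} → ¬ InSpan j (suc n) → Σ (Fin d) λ ℓ → A j ℓ ≢ 0#
    nonzero j ¬span with search-Fin d (λ ℓ → ¬? (A j ℓ ≟F 0#))
    ... | yes r = r
    ... | no all0 = ⊥-elim (¬span ((λ _ → 0#) , refl , λ ℓ →
      trans (cong (_* prod (λ r → A j (ℓ (suc r)))) (decidable-stable (A j (ℓ zero) ≟F 0#) (λ ne → all0 (_ , ne))))
            (trans (zeroˡ _) (sym (sum-ε (λ l → 0# * prod (λ r → A l (ℓ r))) λ l → zeroˡ _)))))

    -- Tuples of basis vectors (false , ℓ) and of the vectors (true , ℓ) = a e_ℓ - A_iℓ e_ℓ₀ in the kernel of φ i.
    module Tuples (i : Fin k) (ℓ₀ : Fin d) where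

      a : F
      a = A i ℓ₀

      El : Set
      El = Bool × Fin d

      value : Fin k → El → F
      value l (false , ℓ) = A l ℓ
      value l (true , ℓ) = a * A l ℓ + - (A i ℓ * A l ℓ₀)

      vector : El → Vector F d
      vector (false , ℓ) = unit ℓ
      vector (true , ℓ) c = a * unit ℓ c + - (A i ℓ) * unit ℓ₀ c

      φ-vector : ∀ l y → φ l (vector y) ≡ value l y
      φ-vector l (false , ℓ) = φ-unit l ℓ
      φ-vector l (true , ℓ) = trans (φ-comb l a (- A i ℓ) (unit ℓ) (unit ℓ₀))
        (cong₂ _+_ (cong (a *_) (φ-unit l ℓ)) (trans (cong (- A i ℓ *_) (φ-unit l ℓ₀)) (sym (-‿distribˡ-* _ _))))

      value-kernel : ∀ ℓ → value i (true , ℓ) ≡ 0#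
      value-kernel ℓ = trans (cong (_+ - (A i ℓ * a)) (*-comm a (A i ℓ))) (-‿inverseʳ _)

      pr : Fin k → ∀ {n} → Vec El n → F
      pr l [] = 1#
      pr l (y ∷ ys) = value l y * pr l ys

      hasKernel : ∀ {n} → Vec El n → Bool
      hasKernel [] = false
      hasKernel ((true , _) ∷ _) = true
      hasKernel ((false , _) ∷ ys) = hasKernel ys

      plain : ∀ {n} → Vec (Fin d) n → Vec El n
      plain = Vec.map (false ,_)

      power : ℕ → F
      power zero = 1#
      power (suc n) = a * power n

      pivot : ∀ n → Vec El n
      pivot n = Vec.replicate n (false , ℓ₀)

      -- Replacing e_ℓ by (A_iℓ / a) e_ℓ₀, one entry at a time, changes nothing modulo tuples that meet the kernel.
      functional-on-plain : ∀ {n} (g : Vector F k) → (∀ (y : Vec El n) → hasKernel y ≡ true → sum (λ l → g l * pr l y) ≡ 0#) →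
        ∀ (ℓs : Vec (Fin d) n) → power n * sum (λ l → g l * pr l (plain ℓs)) ≡ pr i (plain ℓs) * sum (λ l → g l * pr l (pivot n))
      functional-on-plain {zero} g kill [] = refl
      functional-on-plain {suc n} g kill (ℓ ∷ ℓs) = begin
        a * power n * sum (λ l → g l * (A l ℓ * R l))                    ≡⟨ cong (_* sum (λ l → g l * (A l ℓ * R l))) (*-comm a (power n)) ⟩
        power n * a * sum (λ l → g l * (A l ℓ * R l))                    ≡⟨ *-assoc _ _ _ ⟩
        power n * (a * sum (λ l → g l * (A l ℓ * R l)))                  ≡⟨ cong (power n *_) expand ⟩
        power n * (A i ℓ * sum (λ l → g' l * R l))                       ≡⟨ *-swap _ _ _ ⟩
        A i ℓ * (power n * sum (λ l → g' l * R l))                       ≡⟨ cong (A i ℓ *_) (functional-on-plain g' kill' ℓs) ⟩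
        A i ℓ * (pr i (plain ℓs) * sum (λ l → g' l * pr l (pivot n)))    ≡⟨ *-assoc _ _ _ ⟨
        A i ℓ * pr i (plain ℓs) * sum (λ l → g' l * pr l (pivot n))      ≡⟨ cong (A i ℓ * pr i (plain ℓs) *_) (sum-≗ (λ l → g' l * pr l (pivot n)) _ (λ l → *-assoc (g l) (A l ℓ₀) (pr l (pivot n)))) ⟩
        A i ℓ * pr i (plain ℓs) * sum (λ l → g l * (A l ℓ₀ * pr l (pivot n))) ∎
        where
        open ≡-Reasoning
        R : Fin k → F
        R l = pr l (plain ℓs)
        g' : Vector F k
        g' l = g l * A l ℓ₀
        kill' : ∀ y → hasKernel y ≡ true → sum (λ l → g' l * pr l y) ≡ 0#
        kill' y h = trans (sum-cong-≗ (λ l → *-assoc (g l) (A l ℓ₀) (pr l y))) (kill ((false , ℓ₀) ∷ y) h)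
        termwise : ∀ l → a * (g l * (A l ℓ * R l)) ≡ g l * (value l (true , ℓ) * R l) + A i ℓ * (g' l * R l)
        termwise l = begin
          a * (g l * (A l ℓ * R l))                                              ≡⟨ *-swap _ _ _ ⟩
          g l * (a * (A l ℓ * R l))                                              ≡⟨ cong (g l *_) (sym (*-assoc _ _ _)) ⟩
          g l * (a * A l ℓ * R l)                                                ≡⟨ cong (λ z → g l * (z * R l)) (sym (trans (+-assoc _ _ _) (trans (cong (a * A l ℓ +_) (-‿inverseˡ _)) (+-identityʳ _)))) ⟩
          g l * ((value l (true , ℓ) + A i ℓ * A l ℓ₀) * R l)                    ≡⟨ cong (g l *_) (distribʳ _ _ _) ⟩
          g l * (value l (true , ℓ) * R l + A i ℓ * A l ℓ₀ * R l)                ≡⟨ distribˡ _ _ _ ⟩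
          g l * (value l (true , ℓ) * R l) + g l * (A i ℓ * A l ℓ₀ * R l)        ≡⟨ cong (g l * (value l (true , ℓ) * R l) +_) (trans (cong (g l *_) (*-assoc _ _ _)) (trans (*-swap _ _ _) (cong (A i ℓ *_) (sym (*-assoc _ _ _))))) ⟩
          g l * (value l (true , ℓ) * R l) + A i ℓ * (g' l * R l)                ∎
        expand : a * sum (λ l → g l * (A l ℓ * R l)) ≡ A i ℓ * sum (λ l → g' l * R l)
        expand = trans (*-distribˡ-sum a (λ l → g l * (A l ℓ * R l))) (trans (sum-cong-≗ termwise)
          (trans (∑-distrib-+ (λ l → g l * (value l (true , ℓ) * R l)) (λ l → A i ℓ * (g' l * R l)))
          (trans (cong (_+ sum (λ l → A i ℓ * (g' l * R l))) (kill ((true , ℓ) ∷ plain ℓs) refl))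
          (trans (+-identityˡ _) (sym (*-distribˡ-sum (A i ℓ) (λ l → g' l * R l)))))))

      prod-lookup : ∀ l {n} (y : Vec El n) → prod (λ r → value l (lookup y r)) ≡ pr l y
      prod-lookup l [] = refl
      prod-lookup l (y ∷ ys) = cong (value l y *_) (prod-lookup l ys)

      prod-plain : ∀ l {n} (ℓ : Fin n → Fin d) → pr l (plain (Vec.tabulate ℓ)) ≡ prod (λ r → A l (ℓ r))
      prod-plain l {zero} ℓ = refl
      prod-plain l {suc n} ℓ = cong (A l (ℓ zero) *_) (prod-plain l (ℓ ∘ suc))

      offI : Vector F k → Vector F k
      offI c l = if does (l ≟ i) then 0# else c l

      offI-i : ∀ c → offI c i ≡ 0#
      offI-i c = cong (if_then 0# else c i) (dec-true (i ≟ i) refl)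

      pairing-offI : ∀ c v → pairing c (offI v) ≡ pairing (offI c) v
      pairing-offI c v = sum-≗ (λ l → c l * offI v l) (λ l → offI c l * v l) λ l → go l (does (l ≟ i))
        where
        go : ∀ l (b : Bool) → c l * (if b then 0# else v l) ≡ (if b then 0# else c l) * v l
        go l true = trans (zeroʳ _) (sym (zeroˡ _))
        go l false = refl

      -- Tuples without a factor in the kernel are entered as 0, so that the search can run over all
      -- tuples.
      family : ∀ {n} → Vec El n → Vector F k
      family y l = if hasKernel y then offI (λ l → pr l y) l else 0#

      Terms : ℕ → Set
      Terms n = Σ (List (F × Vec El n)) λ ts → length ts ≤ k × (∀ l → offI (λ l → pr l (pivot n)) l ≡ combination family ts l)

      -- Otherwise a functional supported off `i` is 1 at the pivot tuple and kills all tuples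
      -- meeting the kernel. By `functional-on-plain` its multiple by `power n` then writes the
      -- tensor power of `φ i` through the others. The bound `k` is the dimension of the space of
      -- value vectors.
      terms : ∀ n → ¬ InSpan i n → Terms n
      terms n ¬span with span-or-separate (search-Vec (search-× search-Bool (search-Fin d)) n) k family (offI (λ l → pr l (pivot n)))
      ... | inj₁ ts = ts
      ... | inj₂ (c , kill , one) = ⊥-elim (¬span ((λ l → power n * offI c l) , trans (cong (power n *_) (offI-i c)) (zeroʳ _) , λ ℓ → begin
        prod (λ r → A i (ℓ r))                                                 ≡⟨ prod-plain i ℓ ⟨
        pr i (plain (Vec.tabulate ℓ))                                          ≡⟨ *-identityʳ _ ⟨
        pr i (plain (Vec.tabulate ℓ)) * 1#                                     ≡⟨ cong (pr i (plain (Vec.tabulate ℓ)) *_) (trans (sym one) (pairing-offI c _)) ⟩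
        pr i (plain (Vec.tabulate ℓ)) * sum (λ l → offI c l * pr l (pivot n))  ≡⟨ functional-on-plain (offI c) kill' (Vec.tabulate ℓ) ⟨
        power n * sum (λ l → offI c l * pr l (plain (Vec.tabulate ℓ)))         ≡⟨ *-distribˡ-sum (power n) (λ l → offI c l * pr l (plain (Vec.tabulate ℓ))) ⟩
        sum (λ l → power n * (offI c l * pr l (plain (Vec.tabulate ℓ))))       ≡⟨ sum-cong-≗ (λ l → trans (sym (*-assoc _ _ _)) (cong (power n * offI c l *_) (prod-plain l ℓ))) ⟩
        sum (λ l → power n * offI c l * prod (λ r → A l (ℓ r)))                ∎))
        where
        open ≡-Reasoning
        kill' : ∀ y → hasKernel y ≡ true → sum (λ l → offI c l * pr l y) ≡ 0#
        kill' y h = trans (sym (pairing-offI c (λ l → pr l y)))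
          (trans (sum-cong-≗ (λ l → cong (λ b → c l * (if b then offI (λ l → pr l y) l else 0#)) (sym h))) (kill y))

    -- The level lemma

    module LevelLemma (x : Fin k → Vector F d) (φx : ∀ j → φ j (x j) ≡ 1#) where
      open Systems x φx

      module _ (t h₀ q₀ q L : ℕ) (entries : ∀ l c → Entry L (A l c)) (L²≤ : L ℕ.* L ≤ 2 ^ (2 ^ h₀))
               (t≤ : t ≤ 2 ^ q₀) (k≤ : k ≤ 2 ^ q) (i : Fin k) (¬span : ¬ InSpan i (suc t)) where

        -- Height 3 + h₀ moves integers up to 2 ^ (2 ^ h₀), one more round moves the values of
        -- kernel vectors, and q₀ rounds chain the moves of all slots.
        H : ℕ
        H = suc (q₀ ℕ.+ (3 ℕ.+ h₀))

        open AtLevel t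
        open Leaves t H i

        private
          ℓ₀,≢0 : Σ (Fin d) λ ℓ → A i ℓ ≢ 0#
          ℓ₀,≢0 = nonzero i ¬span

          ℓ₀ = proj₁ ℓ₀,≢0
          open Tuples i ℓ₀

          h : ℕ
          h = 2 ℕ.+ h₀

          L≤L² : L ≤ L ℕ.* L
          L≤L² = go L
            where
            go : ∀ L → L ≤ L ℕ.* L
            go zero = z≤n
            go (suc L) = ℕ.m≤m+n (suc L) _

          entry-movable : ∀ l c → Movable (suc h) (A l c)
          entry-movable l c with entries l c
          ... | n , n≤L , inj₁ e = subst (Movable (suc h)) (sym e) (proj₁ (intMovable h₀ n (ℕ.≤-trans n≤L (ℕ.≤-trans L≤L² L²≤))))
          ... | n , n≤L , inj₂ e = subst (Movable (suc h)) (sym e) (proj₂ (intMovable h₀ n (ℕ.≤-trans n≤L (ℕ.≤-trans L≤L² L²≤))))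

          product-movable : ∀ {y z} → Entry L y → Entry L z → Movable (suc h) (y * z)
          product-movable {y} {z} (m , m≤L , em) (n , n≤L , en) = go em en
            where
            mn≤ : m ℕ.* n ≤ 2 ^ (2 ^ h₀)
            mn≤ = ℕ.≤-trans (ℕ.*-mono-≤ m≤L n≤L) L²≤
            pos : Movable (suc h) (fromℕ m * fromℕ n)
            pos = subst (Movable (suc h)) (fromℕ-* m n) (proj₁ (intMovable h₀ (m ℕ.* n) mn≤))
            neg : Movable (suc h) (- (fromℕ m * fromℕ n))
            neg = subst (λ v → Movable (suc h) (- v)) (fromℕ-* m n) (proj₂ (intMovable h₀ (m ℕ.* n) mn≤))
            go : y ≡ fromℕ m ⊎ y ≡ - fromℕ m → z ≡ fromℕ n ⊎ z ≡ - fromℕ n → Movable (suc h) (y * z)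
            go (inj₁ refl) (inj₁ refl) = pos
            go (inj₁ refl) (inj₂ refl) = subst (Movable (suc h)) (-‿distribʳ-* _ _) neg
            go (inj₂ refl) (inj₁ refl) = subst (Movable (suc h)) (-‿distribˡ-* _ _) neg
            go (inj₂ refl) (inj₂ refl) = subst (Movable (suc h)) (trans (sym (-‿involutive _)) (trans (cong -_ (-‿distribˡ-* _ _)) (-‿distribʳ-* _ _))) pos

          -- A kernel value is `n₁ n₂ - n₀`, where `n₀` is itself a product of two entries. That
          -- product is moved as an integer, which is where the bound on L * L enters.
          value-movable : ∀ l y → Movable (suc (suc h)) (value l y)
          value-movable l (false , ℓ) = movable-suc (entry-movable l ℓ)
          value-movable l (true , ℓ) = movable-comb {n₀ = A i ℓ * A l ℓ₀} {n₁ = a} {n₂ = A l ℓ}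
            (trans (+-comm _ _) (trans (+-assoc _ _ _) (trans (cong (a * A l ℓ +_) (-‿inverseˡ _)) (+-identityʳ _))))
            (entry-movable i ℓ₀) (entry-movable l ℓ) (product-movable (entries i ℓ) (entries l ℓ₀))

          Item : Set
          Item = Vec El (suc t)

          -- The scalar `c` may be any field element and need not be movable in few rounds. In slot
          -- 0 it is harmless, as only the other slots are emptied.
          termVec : F → Item → Fin (suc t) → Vector F d
          termVec c y zero = λ j → vector (lookup y zero) j * c
          termVec c y (suc r) = vector (lookup y (suc r))

          moves-via : ∀ (vs : Fin (suc t) → Vector F d) l → (∀ r → Movable (suc (suc h)) (φ l (vs (suc r)))) →
            Mv H (λ r → φ l (vs r)) (prod (λ r → φ l (vs r)) ◃ (λ _ → 1#))
          moves-via vs l M = mv-product q₀ t≤ (λ r → φ l (vs r)) M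

          term : F → Item → Term
          term c y = record
            { vec = termVec c y
            ; moves = λ l _ → moves-via (termVec c y) l (λ r → subst (Movable (suc (suc h))) (sym (φ-vector l (lookup y (suc r)))) (value-movable l (lookup y (suc r)))) }

          coef-term : ∀ c y l → prod (coef (term c y) l) ≡ c * pr l y
          coef-term c (y ∷ ys) l = trans (cong₂ _*_ (trans (φ-scale l (vector y) c) (trans (*-comm _ c) (cong (c *_) (φ-vector l y))))
            (trans (prod-cong-≗ (λ r → φ-vector l (lookup ys r))) (prod-lookup l ys))) (*-assoc _ _ _)

          kernelItem : Item
          kernelItem = Vec.replicate (suc t) (true , ℓ₀)

          -- A tuple that avoids the kernel has no place in the cycle, since its output need not be
          -- degenerate. As its entry in `family` is 0, a zero multiple of a kernel tuple replaces
          -- it.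
          sanitise : Bool → F × Item → F × Item
          sanitise true p = p
          sanitise false _ = 0# , kernelItem

          item : F × Item → Term
          item (c , y) = let (c' , y') = sanitise (hasKernel y) (c , y) in term c' y'

          item-weight : ∀ c y l → wt (item (c , y)) l (l ≟ i) ≡ c * family y l
          item-weight c y l with hasKernel y | l ≟ i
          ... | true | yes _ = sym (zeroʳ c)
          ... | true | no _ = coef-term c y l
          ... | false | yes _ = sym (zeroʳ c)
          ... | false | no _ = trans (coef-term 0# kernelItem l) (trans (zeroˡ _) (sym (zeroʳ c)))

          kernel-slot : ∀ {n} (y : Vec El n) → hasKernel y ≡ true → Σ (Fin n) λ r → value i (lookup y r) ≡ 0#
          kernel-slot ((true , ℓ) ∷ _) _ = zero , value-kernel ℓ
          kernel-slot ((false , _) ∷ ys) h with r , e ← kernel-slot ys h = suc r , e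

          term-degenerate : ∀ c y → hasKernel y ≡ true → DegenerateOut (term c y)
          term-degenerate c y h with kernel-slot y h
          ... | zero , e = degenerate-out (term c y) zero (trans (φ-scale i (vector (lookup y zero)) c) (trans (cong (_* c) (trans (φ-vector i (lookup y zero)) e)) (zeroˡ c)))
          ... | suc r , e = degenerate-out (term c y) (suc r) (trans (φ-vector i (lookup y (suc r))) e)

          item-degenerate : ∀ p → DegenerateOut (item p)
          item-degenerate (c , y) = go (hasKernel y) refl
            where
            go : ∀ b → hasKernel y ≡ b → DegenerateOut (let (c' , y') = sanitise b (c , y) in term c' y')
            go true e = term-degenerate c y e
            go false _ = term-degenerate 0# kernelItem refl

          Items = List (F × Item)

          negate : Items → Items
          negate = map (λ { (c , y) → - c , y })

          combination-negate : ∀ (ts : Items) l → - combination family (negate ts) l ≡ combination family ts l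
          combination-negate [] l = -0#≈0#
          combination-negate ((c , y) ∷ ts) l = trans (sym (-‿+-comm _ _)) (cong₂ _+_
            (trans (cong -_ (sym (-‿distribˡ-* c (family y l)))) (-‿involutive _)) (combination-negate ts l))

          combination-split : ∀ n (ts : Items) l → combination family (take n ts) l + combination family (drop n ts) l ≡ combination family ts l
          combination-split zero ts l = +-identityˡ _
          combination-split (suc n) [] l = +-identityˡ _
          combination-split (suc n) (_ ∷ ts) l = trans (+-assoc _ _ _) (cong (_ +_) (combination-split n ts l))

          take-≤ : ∀ q (ts : Items) → length (take (2 ^ q) ts) ≤ 2 ^ q
          take-≤ q ts = ℕ.≤-trans (ℕ.≤-reflexive (length-take (2 ^ q) ts)) (ℕ.m⊓n≤m (2 ^ q) (length ts))

          drop-≤ : ∀ q (ts : Items) → length ts ≤ 2 ^ suc q → length (negate (drop (2 ^ q) ts)) ≤ 2 ^ q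
          drop-≤ q ts len = ℕ.≤-trans (ℕ.≤-reflexive (trans (length-map _ (drop (2 ^ q) ts)) (length-drop (2 ^ q) ts)))
            (ℕ.m≤n+o⇒m∸n≤o (length ts) (2 ^ q) (ℕ.≤-trans len (ℕ.≤-reflexive (cong (2 ^ q ℕ.+_) (ℕ.+-identityʳ (2 ^ q))))))

          -- The second half is negated because `total` subtracts it; places that remain free get
          -- weight 0.
          build : ∀ q (ts : Items) → length ts ≤ 2 ^ q → Tree q
          build zero [] _ = leaf (item (0# , kernelItem))
          build zero (p ∷ _) _ = leaf (item p)
          build (suc q) ts len = node (build q (take (2 ^ q) ts) (take-≤ q ts)) (build q (negate (drop (2 ^ q) ts)) (drop-≤ q ts len))

          build-total : ∀ q ts len l → total (build q ts len) l ≡ combination family ts l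
          build-total zero [] _ l = trans (item-weight 0# kernelItem l) (zeroˡ _)
          build-total zero ((c , y) ∷ []) _ l = trans (item-weight c y l) (sym (+-identityʳ _))
          build-total zero (_ ∷ _ ∷ _) (s≤s ()) l
          build-total (suc q) ts len l = trans (cong₂ (λ u v → u + - v) (build-total q (take (2 ^ q) ts) (take-≤ q ts) l) (build-total q (negate (drop (2 ^ q) ts)) (drop-≤ q ts len) l))
            (trans (cong (combination family (take (2 ^ q) ts) l +_) (combination-negate (drop (2 ^ q) ts) l)) (combination-split (2 ^ q) ts l))

          build-degenerate : ∀ q ts len → AllDegenerate (build q ts len)
          build-degenerate zero [] _ = item-degenerate (0# , kernelItem)
          build-degenerate zero (p ∷ _) _ = item-degenerate p
          build-degenerate (suc q) ts len = build-degenerate q (take (2 ^ q) ts) (take-≤ q ts) , build-degenerate q (negate (drop (2 ^ q) ts)) (drop-≤ q ts len)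

          headTerm : Term
          headTerm = record
            { vec = λ _ → unit ℓ₀
            ; moves = λ l _ → moves-via (λ _ → unit ℓ₀) l (λ _ → subst (Movable (suc (suc h))) (sym (φ-unit l ℓ₀)) (value-movable l (false , ℓ₀))) }

          head-weight : ∀ l → wt headTerm l (l ≟ i) ≡ offI (λ l → pr l (pivot (suc t))) l
          head-weight l with l ≟ i
          ... | yes _ = refl
          ... | no _ = go (suc t)
            where
            go : ∀ n → prod {n} (λ _ → φ l (unit ℓ₀)) ≡ pr l (pivot n)
            go zero = refl
            go (suc n) = cong₂ _*_ (φ-unit l ℓ₀) (go n)

          -- The only copy with a nondegenerate output sits at the front, padded with copies of
          -- weight 0 to the length of the opposite chain.
          spine : ∀ q → Tree q
          spine zero = leaf headTerm
          spine (suc q) = node (spine q) (build q [] z≤n)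

          spine-total : ∀ q l → total (spine q) l ≡ wt headTerm l (l ≟ i)
          spine-total zero l = refl
          spine-total (suc q) l = trans (cong₂ (λ u v → u + - v) (spine-total q l) (build-total q [] z≤n l))
            (trans (cong (wt headTerm l (l ≟ i) +_) -0#≈0#) (+-identityʳ _))

          spine-degenerate : ∀ q → TailDegenerate (spine q)
          spine-degenerate zero = _
          spine-degenerate (suc q) = spine-degenerate q , build-degenerate q [] z≤n

          spine-first : ∀ q r → coef (first (spine q)) i r ≡ A i ℓ₀
          spine-first zero r = φ-unit i ℓ₀
          spine-first (suc q) r = spine-first q r

        -- Both chains have the weight of the pivot tuple at every `l` other than `i`, one by its
        -- head copy alone and the other through kernel tuples, so they close up.
        level-lemma : Sys i (Others i (gc (suc t))) ⊢[ k ℕ.* (H ℕ.* 4) ℕ.+ suc q ] gc t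
        level-lemma with ts , len , eq ← terms (suc t) ¬span =
          level-step (spine q) (build q ts (ℕ.≤-trans len k≤))
            (λ l → trans (spine-total q l) (trans (head-weight l) (trans (eq l) (sym (build-total q ts (ℕ.≤-trans len k≤) l)))))
            (spine-degenerate q) (build-degenerate q ts (ℕ.≤-trans len k≤)) (A i ℓ₀) (proj₂ ℓ₀,≢0) (spine-first q)

    -- Replacing the ports of a system one by one

    upd : (Fin k → Port) → Fin k → Port → Fin k → Port
    upd X j Y l = choose (l ≟ j) Y (X l)

    module _ {j : Fin k} {Y Z : Port} where

      get : (dec : Dec (j ≡ j)) → P (choose dec Y Z) → P Y
      get (yes _) z = z
      get (no ¬p) z = ⊥-elim (¬p refl)

      out-get : ∀ dec z → out Y (get dec z) ≡ out (choose dec Y Z) z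
      out-get (yes _) z = refl
      out-get (no ¬p) z = ⊥-elim (¬p refl)

      getI : ∀ dec κ → Σ (I (choose dec Y Z)) λ κ' → ∀ z z' → rel (choose dec Y Z) κ' z z' → rel Y κ (get dec z) (get dec z')
      getI (yes _) κ = κ , λ _ _ r → r
      getI (no ¬p) κ = ⊥-elim (¬p refl)

    module Descents (x : Fin k → Vector F d) (φx : ∀ j → φ j (x j) ≡ 1#) where
      open Systems x φx

      module _ (i j : Fin k) (X : Fin k → Port) where

        X° : Fin k → Port
        X° = upd X j Open

        holeCtx : Ctx
        holeCtx = record
          { P = P (Sys i X°) ; main = out (Sys i X°) ; hole = λ { (v , _) → φ j v }
          ; I = I (Sys i X°) ; rel = rel (Sys i X°) ; rfl = rfl (Sys i X°)
          ; msec = sec (Sys i X°) ; main-msec = out-sec (Sys i X°)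
          ; hsec = λ e → section j e , (λ l → sec (X° l) (φ l (section j e))) , λ l → sym (out-sec (X° l) _)
          ; hole-hsec = φ-section j }

        private
          insert : ∀ {Y l} (dec : Dec (l ≡ j)) → P (choose dec Open (X l)) → P Y → P (choose dec Y (X l))
          insert (yes _) _ y = y
          insert (no _) z _ = z

          insert-out : ∀ {Y l} (dec : Dec (l ≡ j)) z (y : P Y) v → φ j v ≡ out Y y → φ l v ≡ out (choose dec Open (X l)) z →
            φ l v ≡ out (choose dec Y (X l)) (insert {Y} dec z y)
          insert-out (yes refl) z y v e e' = e
          insert-out (no _) z y v e e' = e'

          remove : ∀ {Y l} (dec : Dec (l ≡ j)) → P (choose dec Y (X l)) → F → P (choose dec Open (X l))
          remove (yes _) _ e = e
          remove (no _) z _ = z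

          remove-out : ∀ {Y l} (dec : Dec (l ≡ j)) z v → φ l v ≡ out (choose dec Y (X l)) z →
            φ l v ≡ out (choose dec Open (X l)) (remove {Y} dec z (φ l v))
          remove-out (yes _) z v e = refl
          remove-out (no _) z v e = e

          insert-dep : ∀ {Y l} (dec : Dec (l ≡ j)) (ι : I (choose dec Y (X l))) →
            (Σ (I Y) λ κ → ∀ z z' y y' → rel Y κ y y' → rel (choose dec Y (X l)) ι (insert {Y} dec z y) (insert {Y} dec z' y')) ⊎
            (Σ (I (choose dec Open (X l))) λ κ → ∀ z z' y y' → rel (choose dec Open (X l)) κ z z' → rel (choose dec Y (X l)) ι (insert {Y} dec z y) (insert {Y} dec z' y'))
          insert-dep (yes _) ι = inj₁ (ι , λ _ _ _ _ r → r)
          insert-dep (no _) ι = inj₂ (ι , λ _ _ _ _ r → r)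

          remove-dep : ∀ {Y l} (dec : Dec (l ≡ j)) (ι : I (choose dec Open (X l))) →
            Σ (I (choose dec Y (X l))) λ κ → ∀ z z' e e' → rel (choose dec Y (X l)) κ z z' → rel (choose dec Open (X l)) ι (remove {Y} dec z e) (remove {Y} dec z' e')
          remove-dep (no _) ι = ι , λ _ _ _ _ r → r

        Sys⊢plug : ∀ Y → Sys i (upd X j Y) ⊢[ 0 ] plug holeCtx Y
        Sys⊢plug Y = sim (record
          { θ = λ { (((v , z , e) , y) , e₀) → v , (λ l → insert (l ≟ j) (z l) y) , λ l → insert-out (l ≟ j) (z l) y v e₀ (e l) }
          ; out-θ = λ _ → refl
          ; dep = λ { (inj₂ (l , ι)) → dp l ι (insert-dep (l ≟ j) ι) } })
          where
          dp : ∀ l ι → _ → Σ (I (plug holeCtx Y)) _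
          dp l ι (inj₁ (κ , h)) = inj₂ κ , λ _ _ r → h _ _ _ _ r
          dp l ι (inj₂ (κ , h)) = inj₁ (inj₂ (l , κ)) , λ _ _ r → h _ _ _ _ r

        plug⊢Sys : ∀ Y → plug holeCtx Y ⊢[ 0 ] Sys i (upd X j Y)
        plug⊢Sys Y = sim (record
          { θ = λ { (v , z , e) → ((v , (λ l → remove (l ≟ j) (z l) (φ l v)) , λ l → remove-out (l ≟ j) (z l) v (e l)) , get (j ≟ j) (z j)) ,
                    trans (e j) (sym (out-get (j ≟ j) (z j))) }
          ; out-θ = λ _ → refl
          ; dep = λ { (inj₁ (inj₂ (l , ι))) → inj₂ (l , proj₁ (remove-dep {Y} (l ≟ j) ι)) , λ _ _ r → proj₂ (remove-dep {Y} (l ≟ j) ι) _ _ _ _ r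
                    ; (inj₂ κ) → inj₂ (j , proj₁ (getI {Z = X j} (j ≟ j) κ)) , λ _ _ r → proj₂ (getI (j ≟ j) κ) _ _ r } })

      -- Copying a system along one of its ports attaches to that port the rest of the second copy.
      base-step : ∀ {n} (i j : Fin k) → (X : Fin k → Port) → (b : Fin (suc n) → Vector F d) → (∀ r → φ j (b r) ≡ 1#) →
        (∀ l → l ≢ j → Σ (Fin (suc n)) λ r → φ l (b r) ≡ 0#) → i ≢ j → plug (holeCtx i j X) (X j) ⊢[ 1 ] plug (holeCtx i j X) (gc n)
      base-step {n} i j X b b-one b-zero i≢j = joinSim (record
        { S = λ { (inj₁ _) → false ; (inj₂ _) → true }
        ; θL = λ { ((c , g) , e) → (c , sec (X j) (C.hole c)) , sym (out-sec (X j) _) }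
        ; θR = λ { ((c , g) , e) → (rest g , sec (X j) (φ j (lin b g))) , sym (out-sec (X j) _) }
        ; out-L = λ _ → refl
        ; agree = λ { ((c , g) , e) (inj₂ ι) _ → rel-≡ (X j) ι (cong (sec (X j)) (trans e (sym (φ-j g)))) ; _ (inj₁ _) () }
        ; dep-L = λ { (inj₁ ι) _ → inj₁ ι , λ _ _ r → r ; (inj₂ _) () }
        ; dep-R = λ { (inj₁ (inj₂ (l , ι))) _ → depR l (l ≟ j) ι ; (inj₂ _) () }
        ; dep-O = let r , h = b-zero i i≢j in inj₂ r , λ { ((_ , g) , _) ((_ , g') , _) q → off i r h g g' q } })
        where
        module C = Ctx (holeCtx i j X)
        open AtLevel n using (val-off)
        rest : Vector F (suc n) → C.P
        rest g = lin b g , (λ l → sec (X° i j X l) (φ l (lin b g))) , λ l → sym (out-sec (X° i j X l) _)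
        φ-j : ∀ g → φ j (lin b g) ≡ sum g
        φ-j g = trans (φ-lin j b g) (sum-≗ (λ r → φ j (b r) * g r) g (λ r → trans (cong (_* g r) (b-one r)) (*-identityˡ (g r))))
        off : ∀ l r → φ l (b r) ≡ 0# → ∀ g g' → g ≈[ r ] g' → φ l (lin b g) ≡ φ l (lin b g')
        off l r h g g' q = trans (φ-lin l b g) (trans (val-off (λ r → φ l (b r)) r h g g' q) (sym (φ-lin l b g')))
        depR : ∀ l (dec : Dec (l ≡ j)) (ι : I (choose dec Open (X l))) → Σ (I (plug (holeCtx i j X) (gc n))) λ κ → ∀ p p' → rel (plug (holeCtx i j X) (gc n)) κ p p' →
          rel (choose dec Open (X l)) ι (sec (choose dec Open (X l)) (φ l (lin b (proj₂ (proj₁ p))))) (sec (choose dec Open (X l)) (φ l (lin b (proj₂ (proj₁ p')))))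
        depR l (no l≢j) ι with r , h ← b-zero l l≢j = inj₂ r , λ { ((_ , g) , _) ((_ , g') , _) q → rel-≡ (X l) ι (cong (sec (X l)) (off l r h g g' q)) }

    module Steps (x : Fin k → Vector F d) (φx : ∀ j → φ j (x j) ≡ 1#) where
      open Systems x φx
      open Descents x φx

      module _ (t : ℕ) (i j : Fin k) (i≢j : i ≢ j) (X : Fin k → Port)
               (good : ∀ l → l ≢ i → Sim (gc (suc t)) (X l)) (closed : Sim Open (X i)) where
        private
          C = holeCtx i j X
          G = gc (suc t)
          open Doubling C t

          relaxed : Sys i (upd X j G) ⊢[ 0 ] Sys i (Others i G)
          relaxed = Sys-⊢₀ i (λ l → sim (go l (l ≟ i) (l ≟ j)))
            where
            go : ∀ l (dec : Dec (l ≡ i)) (dec' : Dec (l ≡ j)) → Sim (pick dec G) (choose dec' G (X l))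
            go l (yes refl) (yes p) = ⊥-elim (i≢j p)
            go l (yes refl) (no _) = closed
            go l (no _) (yes _) = sim-id
            go l (no l≢i) (no _) = good l l≢i

          toX : ∀ l (di : Dec (l ≡ i)) (dj : Dec (l ≡ j)) → P (pick dj G) → F → P (choose dj Open (X l))
          toX l di (yes _) _ e = e
          toX l (yes refl) (no _) _ e = θ closed e
          toX l (no l≢i) (no _) z _ = θ (good l l≢i) z

          toX-out : ∀ l di dj z e → e ≡ out (pick dj G) z → e ≡ out (choose dj Open (X l)) (toX l di dj z e)
          toX-out l di (yes _) z e h = refl
          toX-out l (yes refl) (no _) z e h = sym (out-θ closed e)
          toX-out l (no l≢i) (no _) z e h = trans h (sym (out-θ (good l l≢i) z))

          toX-dep : ∀ l di dj (ι : I (choose dj Open (X l))) → Σ (I (pick dj G)) λ κ → ∀ z z' e e' → rel (pick dj G) κ z z' →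
            rel (choose dj Open (X l)) ι (toX l di dj z e) (toX l di dj z' e')
          toX-dep l (yes refl) (no _) ι = ⊥-elim (proj₁ (dep closed ι))
          toX-dep l (no l≢i) (no _) ι = proj₁ (dep (good l l≢i) ι) , λ z z' _ _ r → proj₂ (dep (good l l≢i) ι) z z' r

          gcAt : (dj : Dec (i ≡ j)) → P (pick dj G) → Vector F (suc t)
          gcAt (yes p) _ = ⊥-elim (i≢j p)
          gcAt (no _) z = θ (gc-suc t) z

          gcAt-out : ∀ dj z → sum (gcAt dj z) ≡ out (pick dj G) z
          gcAt-out (yes p) _ = ⊥-elim (i≢j p)
          gcAt-out (no _) z = out-θ (gc-suc t) z

          gcAt-dep : ∀ dj r → Σ (I (pick dj G)) λ κ → ∀ z z' → rel (pick dj G) κ z z' → gcAt dj z ≈[ r ] gcAt dj z'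
          gcAt-dep (yes p) _ = ⊥-elim (i≢j p)
          gcAt-dep (no _) r = dep (gc-suc t) r

          -- The third copy has supplied `gc t` at φ_i of the second one, and by `gc-suc` this may
          -- be taken as `gc (suc t)`. The second copy now carries `gc (suc t)` at all forms but φ_j
          -- and can be seen from φ_j, which the level lemma demands.
          regroup : plug pairCtx (gc t) ⊢[ 0 ] plug linkCtx (Sys j (Others j G))
          regroup = sim (record
            { θ = λ { ((((p , y') , h) , (v , z , e)) , e₀) →
                (((p , (((v , (λ l → toX l (l ≟ i) (l ≟ j) (z l) (φ l v)) , λ l → toX-out l (l ≟ i) (l ≟ j) (z l) (φ l v) (e l)) , y') , sym e₀)) , h) ,
                 gcAt (i ≟ j) (z i)) , trans (e i) (sym (gcAt-out (i ≟ j) (z i))) }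
            ; out-θ = λ _ → refl
            ; dep = λ { (inj₁ (false , ι)) → inj₁ (inj₁ ι) , λ _ _ r → r
                      ; (inj₁ (true , inj₁ (inj₂ (l , ι)))) → let κ , h = toX-dep l (l ≟ i) (l ≟ j) ι in inj₂ (inj₂ (l , κ)) , λ _ _ r → h _ _ _ _ r
                      ; (inj₁ (true , inj₂ r)) → inj₁ (inj₂ r) , λ _ _ q → q
                      ; (inj₂ r) → let κ , h = gcAt-dep (i ≟ j) r in inj₂ (inj₂ (i , κ)) , λ _ _ q → h _ _ q } })

        -- A second copy is linked to the first at j and a third to the second at i.  The level lemma turns the
        -- third copy into gc t, and then the second one, now complete, too.
        descend : ∀ {ℓ} → Sys i (Others i G) ⊢[ ℓ ] gc t → Sys j (Others j G) ⊢[ ℓ ] gc t →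
          Sys i X ⊢[ 2 ℕ.+ (ℓ ℕ.+ ℓ) ] Sys i (upd X j (gc t))
        descend {ℓ} LLi LLj = start ▸ Sys⊢plug i j X G ▸ double ▸
          (plug-⊢ pairCtx (plug⊢Sys i j X G ▸ relaxed ▸ LLi) ▸ regroup ▸ plug-⊢ linkCtx LLj ₀◂ link⊢plug ₀◂ plug⊢Sys i j X (gc t))
          where
          start : Sys i X ⊢[ 0 ] Sys i (upd X j G)
          start = Sys-⊢₀ i (λ l → go l (l ≟ j))
            where
            go : ∀ l (dec : Dec (l ≡ j)) → X l ⊢[ 0 ] choose dec G (X l)
            go l (yes refl) = sim (good l (λ p → i≢j (sym p)))
            go l (no _) = ⊢-refl

      -- The invariant `Pre` has to hold at replaced ports as well, hence `preY`. The index `i` is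
      -- passed over but counted, which gives the plain factor `k`.
      sweep : ∀ i (Pre : Port → Set) Y {c} → Pre Y → (∀ X → (∀ l → l ≢ i → Pre (X l)) → Sim Open (X i) →
        ∀ j → i ≢ j → Sys i X ⊢[ c ] Sys i (upd X j Y)) →
        ∀ X → (∀ l → l ≢ i → Pre (X l)) → Sim Open (X i) → Sys i X ⊢[ k ℕ.* c ] Sys i (Others i Y)
      sweep i Pre Y {c} preY step X₀ pre₀ open₀ =
        let X' , d' , done , open' = run (allFin k) X₀ pre₀ open₀
        in relax (ℕ.≤-reflexive (cong (ℕ._* c) all-k)) d' ₀◂ Sys-⊢₀ i (λ l → finish X' done open' l (l ≟ i))
        where
        all-k : length (allFin k) ≡ k
        all-k = length-tabulate {n = k} (λ x → x)

        Done : (Fin k → Port) → Fin k → Set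
        Done X l = Sim Y (X l)

        upd-pre : ∀ X j → (∀ l → l ≢ i → Pre (X l)) → ∀ l → l ≢ i → Pre (upd X j Y l)
        upd-pre X j pre l l≢i = go (l ≟ j)
          where
          go : (dec : Dec (l ≡ j)) → Pre (choose dec Y (X l))
          go (yes _) = preY
          go (no _) = pre l l≢i

        upd-open : ∀ X j → i ≢ j → Sim Open (X i) → Sim Open (upd X j Y i)
        upd-open X j i≢j h = go (i ≟ j)
          where
          go : (dec : Dec (i ≡ j)) → Sim Open (choose dec Y (X i))
          go (yes p) = ⊥-elim (i≢j p)
          go (no _) = h

        upd-here : ∀ X j → Done (upd X j Y) j
        upd-here X j = go (j ≟ j)
          where
          go : (dec : Dec (j ≡ j)) → Sim Y (choose dec Y (X j))
          go (yes _) = sim-id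
          go (no ¬p) = ⊥-elim (¬p refl)

        upd-there : ∀ X j l → Done X l → Done (upd X j Y) l
        upd-there X j l h = go (l ≟ j)
          where
          go : (dec : Dec (l ≡ j)) → Sim Y (choose dec Y (X l))
          go (yes _) = sim-id
          go (no _) = h

        run : ∀ js X → (∀ l → l ≢ i → Pre (X l)) → Sim Open (X i) → Σ (Fin k → Port) λ X' → (Sys i X ⊢[ length js ℕ.* c ] Sys i X') ×
          (∀ l → l ≢ i → Done X l ⊎ l ∈ js → Done X' l) × Sim Open (X' i)
        run [] X pre op = X , ⊢-refl , (λ { l _ (inj₁ h) → h }) , op
        run (j ∷ js) X pre op with i ≟ j
        ... | yes refl = let X' , d' , done , op' = run js X pre op in
          X' , relax (ℕ.m≤n+m _ c) d' ,
          (λ { l l≢i (inj₁ h) → done l l≢i (inj₁ h) ; l l≢i (inj₂ (here e)) → ⊥-elim (l≢i e) ; l l≢i (inj₂ (there m)) → done l l≢i (inj₂ m) }) , op'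
        ... | no i≢j = let X' , d' , done , op' = run js (upd X j Y) (upd-pre X j pre) (upd-open X j i≢j op) in
          X' , step X pre op j i≢j ▸ d' ,
          (λ { l l≢i (inj₁ h) → done l l≢i (inj₁ (upd-there X j l h)) ; l l≢i (inj₂ (here refl)) → done l l≢i (inj₁ (upd-here X j))
             ; l l≢i (inj₂ (there m)) → done l l≢i (inj₂ m) }) , op'

        finish : ∀ X' → (∀ l → l ≢ i → Done X₀ l ⊎ l ∈ allFin k → Done X' l) → Sim Open (X' i) → ∀ l (dec : Dec (l ≡ i)) → X' l ⊢[ 0 ] pick dec Y
        finish X' done op l (yes refl) = sim op
        finish X' done op l (no l≢i) = sim (done l l≢i (inj₂ (∈-allFin l)))

    normalise : ∀ j {n} → ¬ InSpan j (suc n) → Σ (Vector F d) λ v → φ j v ≡ 1#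
    normalise j ¬span with ℓ , ne ← nonzero j ¬span with y , yA ← inverse (A j ℓ) ne =
      (λ c → unit ℓ c * y) , trans (φ-scale j (unit ℓ) y) (trans (cong (_* y) (φ-unit j ℓ)) (trans (*-comm _ y) yA))

    -- The power of φ_l is a scalar multiple of that of φ_j. Thus a finite s(Φ, l) rules out that
    -- φ_l is a multiple of another form.
    proportional-inSpan : ∀ j l λ' → j ≢ l → (∀ c → A l c ≡ λ' * A j c) → ∀ n → InSpan l n
    proportional-inSpan j l λ' j≢l prop n = (λ m → power n * unit j m) , trans (cong (power n *_) (unit-off (j≢l ∘ sym))) (zeroʳ _) , λ ℓ → begin
      prod (λ r → A l (ℓ r))                                              ≡⟨ pow-prod n ℓ ⟩
      power n * prod (λ r → A j (ℓ r))                                    ≡⟨ sum-unit (λ m → power n * prod (λ r → A m (ℓ r))) j ⟨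
      sum (λ m → power n * prod (λ r → A m (ℓ r)) * unit j m)             ≡⟨ sum-≗ _ (λ m → power n * unit j m * prod (λ r → A m (ℓ r))) (λ m → trans (*-assoc (power n) _ _) (trans (cong (power n *_) (*-comm _ _)) (sym (*-assoc (power n) _ _)))) ⟩
      sum (λ m → power n * unit j m * prod (λ r → A m (ℓ r)))             ∎
      where
      open ≡-Reasoning
      power : ℕ → F
      power zero = 1#
      power (suc n) = λ' * power n
      pow-prod : ∀ n (ℓ : Fin n → Fin d) → prod (λ r → A l (ℓ r)) ≡ power n * prod (λ r → A j (ℓ r))
      pow-prod zero ℓ = sym (*-identityˡ _)
      pow-prod (suc n) ℓ = trans (cong₂ _*_ (prop (ℓ zero)) (pow-prod n (λ r → ℓ (suc r))))
        (trans (*-assoc _ _ _) (trans (cong (λ' *_) (*-swap _ _ _)) (sym (*-assoc _ _ _))))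

    -- If a 2 by 2 minor of the rows `j` and `l` through column ℓ₀ is nonzero, the matching
    -- combination of two basis vectors kills φ_l but not φ_j. If all vanish, the rows are
    -- proportional.
    separate : ∀ j l → j ≢ l → ∀ {m n} → ¬ InSpan j (suc m) → ¬ InSpan l n → Σ (Vector F d) λ v → φ j v ≡ 1# × φ l v ≡ 0#
    separate j l j≢l ¬spanⱼ ¬spanₗ with ℓ₀ , ne ← nonzero j ¬spanⱼ with y , yA ← inverse (A j ℓ₀) ne
      with search-Fin d (λ ℓ → ¬? (minor ℓ₀ ℓ ≟F 0#))
      where
      minor : Fin d → Fin d → F
      minor ℓ₀ ℓ = A l ℓ * A j ℓ₀ + - A l ℓ₀ * A j ℓ
    ... | yes (ℓ , ne') with z , zm ← inverse _ ne' = (λ c → u c * z) , trans (φ-scale j u z) (trans (cong (_* z) (value j)) (trans (*-comm _ z) zm)) ,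
      trans (φ-scale l u z) (trans (cong (_* z) (trans (value l) (trans (cong (A l ℓ * A l ℓ₀ +_) (trans (sym (-‿distribˡ-* _ _)) (cong -_ (*-comm _ _)))) (-‿inverseʳ _)))) (zeroˡ z))
      where
      u : Vector F d
      u c = A l ℓ * unit ℓ₀ c + - A l ℓ₀ * unit ℓ c
      value : ∀ m → φ m u ≡ A l ℓ * A m ℓ₀ + - A l ℓ₀ * A m ℓ
      value m = trans (φ-comb m (A l ℓ) (- A l ℓ₀) (unit ℓ₀) (unit ℓ)) (cong₂ _+_ (cong (A l ℓ *_) (φ-unit m ℓ₀)) (cong (- A l ℓ₀ *_) (φ-unit m ℓ)))
    ... | no all0 = ⊥-elim (¬spanₗ (proportional-inSpan j l (A l ℓ₀ * y) j≢l prop _))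
      where
      open ≡-Reasoning
      prop : ∀ c → A l c ≡ A l ℓ₀ * y * A j c
      prop c = begin
        A l c                                ≡⟨ *-identityʳ _ ⟨
        A l c * 1#                           ≡⟨ cong (A l c *_) (trans (*-comm (A j ℓ₀) y) yA) ⟨
        A l c * (A j ℓ₀ * y)                 ≡⟨ *-assoc _ _ _ ⟨
        A l c * A j ℓ₀ * y                   ≡⟨ cong (_* y) equal ⟩
        A l ℓ₀ * A j c * y                   ≡⟨ *-assoc _ _ _ ⟩
        A l ℓ₀ * (A j c * y)                 ≡⟨ cong (A l ℓ₀ *_) (*-comm _ _) ⟩
        A l ℓ₀ * (y * A j c)                 ≡⟨ *-assoc _ _ _ ⟨
        A l ℓ₀ * y * A j c                   ∎
        where
        equal : A l c * A j ℓ₀ ≡ A l ℓ₀ * A j c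
        equal = begin
          A l c * A j ℓ₀                                              ≡⟨ +-identityʳ _ ⟨
          A l c * A j ℓ₀ + 0#                                         ≡⟨ cong (A l c * A j ℓ₀ +_) (trans (cong (_+ A l ℓ₀ * A j c) (sym (-‿distribˡ-* (A l ℓ₀) (A j c)))) (-‿inverseˡ _)) ⟨
          A l c * A j ℓ₀ + (- A l ℓ₀ * A j c + A l ℓ₀ * A j c)        ≡⟨ +-assoc _ _ _ ⟨
          A l c * A j ℓ₀ + - A l ℓ₀ * A j c + A l ℓ₀ * A j c          ≡⟨ cong (_+ A l ℓ₀ * A j c) (decidable-stable (_ ≟F 0#) (λ ne → all0 (c , ne))) ⟩
          0# + A l ℓ₀ * A j c                                         ≡⟨ +-identityˡ _ ⟩
          A l ℓ₀ * A j c                                              ∎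

  -- From order k - 1 down to order s

  module Main {k' d : ℕ} (A : Fin (suc k') → Fin d → F) (i : Fin (suc k')) (s : ℕ)
    (¬spanᵢ : ∀ n → s < n → ¬ Forms.InSpan A i n) (¬span : ∀ j n → suc s < n → ¬ Forms.InSpan A j n) where
    open Forms A

    private
      k = suc k'

    private
      ¬span' : ∀ j → ¬ InSpan j (suc (suc s))
      ¬span' j = ¬span j (suc (suc s)) ℕ.≤-refl

      x : Fin k → Vector F d
      x j = proj₁ (normalise j (¬span' j))
      φx : ∀ j → φ j (x j) ≡ 1#
      φx j = proj₂ (normalise j (¬span' j))

      -- For `r = j` nothing has to vanish and `x j` only fills the slot, so each form yields `k`
      -- directions, enough for a gc of order k - 1.
      dual : ∀ j r (dec : Dec (j ≡ r)) → Σ (Vector F d) λ v → φ j v ≡ 1# × (r ≢ j → φ r v ≡ 0#)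
      dual j r (yes refl) = x j , φx j , λ ne → ⊥-elim (ne refl)
      dual j r (no j≢r) = let v , one , zer = separate j r j≢r (¬span' j) (¬span' r) in v , one , λ _ → zer

      b : Fin k → Fin k → Vector F d
      b j r = proj₁ (dual j r (j ≟ r))

      b-one : ∀ j r → φ j (b j r) ≡ 1#
      b-one j r = proj₁ (proj₂ (dual j r (j ≟ r)))

      b-zero : ∀ j l → l ≢ j → Σ (Fin k) λ r → φ l (b j r) ≡ 0#
      b-zero j l l≢j = l , proj₂ (proj₂ (dual j l (j ≟ l))) l≢j

    open Systems x φx public
    open Descents x φx
    open Steps x φx
    open LevelLemma x φx

    module _ (h q L : ℕ) (entries : ∀ l c → Entry L (A l c)) (L²≤ : L ℕ.* L ≤ 2 ^ (2 ^ h)) (k≤ : k ≤ 2 ^ q) where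

      private
        cost = levelCost k q h

        LL : ∀ j t → t ≤ k → ¬ InSpan j (suc t) → Sys j (Others j (gc (suc t))) ⊢[ cost ] gc t
        LL j t t≤k ¬s = level-lemma t h q q L entries L²≤ (ℕ.≤-trans t≤k k≤) k≤ j ¬s

        open-i : ∀ Y → Sim Open (Others i Y i)
        open-i Y = go (i ≟ i)
          where
          go : (dec : Dec (i ≡ i)) → Sim Open (pick dec Y)
          go (yes _) = sim-id
          go (no ne) = ⊥-elim (ne refl)

        others : ∀ {Y} Z → Sim Y Z → ∀ l → l ≢ i → Sim Y (Others i Z l)
        others Z s l l≢i = go (l ≟ i)
          where
          go : (dec : Dec (l ≡ i)) → Sim _ (pick dec Z)
          go (yes e) = ⊥-elim (l≢i e)
          go (no _) = s

        base : Sys i (Others i Atom) ⊢[ k ℕ.* 1 ] Sys i (Others i (gc k'))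
        base = sweep i (λ _ → ⊤) (gc k') tt (λ X _ _ j i≢j →
            Sys-⊢₀ i (λ l → same X j l (l ≟ j)) ▸ Sys⊢plug i j X (X j) ▸ base-step i j X (b j) (b-one j) (b-zero j) i≢j ₀◂ plug⊢Sys i j X (gc k'))
          (Others i Atom) (λ _ _ → tt) (open-i Atom)
          where
          same : ∀ X j l (dec : Dec (l ≡ j)) → X l ⊢[ 0 ] choose dec (X j) (X l)
          same X j l (yes refl) = ⊢-refl
          same X j l (no _) = ⊢-refl

        -- The level lemma is applied at `i` and at every other `j`, so power `suc t` must lie
        -- outside the span for all forms; s(Φ) ≤ s + 1 grants this exactly from t = s + 1 on.
        level : ∀ t → suc s ≤ t → t ≤ k → Sys i (Others i (gc (suc t))) ⊢[ sweepCost k q h ] Sys i (Others i (gc t))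
        level t s<t t≤k = sweep i (Sim (gc (suc t))) (gc t) (gc-suc t)
          (λ X good closed j i≢j → descend t i j i≢j X good closed (LL i t t≤k (¬spanᵢ _ (ℕ.m≤n⇒m≤1+n s<t))) (LL j t t≤k (¬span j _ (s≤s s<t))))
          (Others i (gc (suc t))) (others (gc (suc t)) sim-id) (open-i (gc (suc t)))

        levels : ∀ m → m ℕ.+ suc s ≤ k → Sys i (Others i (gc (m ℕ.+ suc s))) ⊢[ m ℕ.* sweepCost k q h ] Sys i (Others i (gc (suc s)))
        levels zero _ = ⊢-refl
        levels (suc m) h = level (m ℕ.+ suc s) (ℕ.m≤n+m (suc s) m) (ℕ.<⇒≤ h) ▸ levels m (ℕ.<⇒≤ h)

        direct : Sys i (Others i Atom) ⊢[ 0 ] gc k'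
        direct = sim (record
          { θ = λ g → lin (b i) g , (λ l → z l (l ≟ i) (φ l (lin (b i) g))) , λ l → z-out l (l ≟ i) _
          ; out-θ = λ g → trans (φ-lin i (b i) g) (sum-≗ (λ r → φ i (b i r) * g r) g (λ r → trans (cong (_* g r) (b-one i r)) (*-identityˡ (g r))))
          ; dep = λ { (inj₂ (l , ι)) → z-dep l (l ≟ i) ι } })
          where
          open AtLevel k' using (val-off)
          z : ∀ l (dec : Dec (l ≡ i)) → F → P (pick dec Atom)
          z l (yes _) e = e
          z l (no _) e = e
          z-out : ∀ l dec e → e ≡ out (pick dec Atom) (z l dec e)
          z-out l (yes _) e = refl
          z-out l (no _) e = refl
          z-dep : ∀ l (dec : Dec (l ≡ i)) (ι : I (pick dec Atom)) → Σ (Fin k) λ r → ∀ g g' → g ≈[ r ] g' →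
            rel (pick dec Atom) ι (z l dec (φ l (lin (b i) g))) (z l dec (φ l (lin (b i) g')))
          z-dep l (no l≢i) ι = let r , h = b-zero i l l≢i in r , λ g g' e →
            trans (φ-lin l (b i) g) (trans (val-off (λ r → φ l (b i r)) r h g g' e) (sym (φ-lin l (b i) g')))

      main : Sys i (Others i Atom) ⊢[ totalCost k q h ] gc s
      main with s <? k'
      -- Order k - 1 is available without any join, and `gc-mono` raises it to `s`.
      ... | no s≮k' = relax z≤n (direct ▸ gc-mono (ℕ.≮⇒≥ s≮k'))
      -- The final drop from s + 1 to s is made at φ_i alone: for other forms the power s + 1 may
      -- lie in the span.
      ... | yes s<k' = base ▸ relax (ℕ.*-monoˡ-≤ (sweepCost k q h) m≤k) descent ▸ LL i s (ℕ.≤-trans (ℕ.<⇒≤ s<k') (ℕ.n≤1+n k')) (¬spanᵢ _ ℕ.≤-refl)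
        where
        m = k' ℕ.∸ suc s
        m≤k : m ≤ k
        m≤k = ℕ.≤-trans (ℕ.m∸n≤m k' (suc s)) (ℕ.n≤1+n k')
        m+s : m ℕ.+ suc s ≡ k'
        m+s = ℕ.m∸n+n≡m s<k'
        descent : Sys i (Others i (gc k')) ⊢[ m ℕ.* sweepCost k q h ] Sys i (Others i (gc (suc s)))
        descent = subst (λ n → Sys i (Others i (gc n)) ⊢[ m ℕ.* sweepCost k q h ] Sys i (Others i (gc (suc s)))) m+s
          (levels m (ℕ.≤-trans (ℕ.≤-reflexive m+s) (ℕ.n≤1+n k')))

-- The field with p elements

module PrimeField (p : ℕ) {{p≢0 : NonZero p}} where
  open Over p

  toℕ-mod : ∀ n → toℕ (n mod p) ≡ n % p
  toℕ-mod n = toℕ-fromℕ< (m%n<n n p)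

  mod-cong : ∀ {m n} → m % p ≡ n % p → m mod p ≡ n mod p
  mod-cong {m} {n} h = toℕ-injective (trans (toℕ-mod m) (trans h (sym (toℕ-mod n))))

  toℕ-% : ∀ (x : F) → toℕ x % p ≡ toℕ x
  toℕ-% x = m<n⇒m%n≡m (toℕ<n x)

  mod-toℕ : ∀ (x : F) → toℕ x mod p ≡ x
  mod-toℕ x = toℕ-injective (trans (toℕ-mod (toℕ x)) (toℕ-% x))

  mod-+ : ∀ m n → (m mod p) +F (n mod p) ≡ (m ℕ.+ n) mod p
  mod-+ m n = mod-cong (trans (cong₂ (λ a b → (a ℕ.+ b) % p) (toℕ-mod m) (toℕ-mod n)) (sym (%-distribˡ-+ m n p)))

  mod-* : ∀ m n → (m mod p) *F (n mod p) ≡ (m ℕ.* n) mod p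
  mod-* m n = mod-cong (trans (cong₂ (λ a b → (a ℕ.* b) % p) (toℕ-mod m) (toℕ-mod n)) (sym (%-distribˡ-* m n p)))

  private
    via₂ : (P : F → F → Set) → (∀ m n → P (m mod p) (n mod p)) → ∀ x y → P x y
    via₂ P h x y = subst₂ P (mod-toℕ x) (mod-toℕ y) (h (toℕ x) (toℕ y))

    via₃ : (P : F → F → F → Set) → (∀ l m n → P (l mod p) (m mod p) (n mod p)) → ∀ x y z → P x y z
    via₃ P h x y z = via₂ (P x) (λ m n → subst (λ a → P a (m mod p) (n mod p)) (mod-toℕ x) (h (toℕ x) m n)) y z

    +-comm* : ∀ x y → x +F y ≡ y +F x
    +-comm* x y = cong (_mod p) (ℕ.+-comm (toℕ x) (toℕ y))

    *-comm* : ∀ x y → x *F y ≡ y *F x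
    *-comm* x y = cong (_mod p) (ℕ.*-comm (toℕ x) (toℕ y))

    +-assoc* : ∀ x y z → (x +F y) +F z ≡ x +F (y +F z)
    +-assoc* = via₃ _ λ l m n → trans (cong (_+F (n mod p)) (mod-+ l m)) (trans (mod-+ _ n)
      (trans (cong (_mod p) (ℕ.+-assoc l m n)) (sym (trans (cong ((l mod p) +F_) (mod-+ m n)) (mod-+ l _)))))

    *-assoc* : ∀ x y z → (x *F y) *F z ≡ x *F (y *F z)
    *-assoc* = via₃ _ λ l m n → trans (cong (_*F (n mod p)) (mod-* l m)) (trans (mod-* _ n)
      (trans (cong (_mod p) (ℕ.*-assoc l m n)) (sym (trans (cong ((l mod p) *F_) (mod-* m n)) (mod-* l _)))))

    distribˡ* : ∀ x y z → x *F (y +F z) ≡ (x *F y) +F (x *F z)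
    distribˡ* = via₃ _ λ l m n → trans (cong ((l mod p) *F_) (mod-+ m n)) (trans (mod-* l _)
      (trans (cong (_mod p) (ℕ.*-distribˡ-+ l m n)) (sym (trans (cong₂ _+F_ (mod-* l m) (mod-* l n)) (mod-+ _ _)))))

    +-identityˡ* : ∀ x → 0F +F x ≡ x
    +-identityˡ* x = trans (cong (0F +F_) (sym (mod-toℕ x))) (trans (mod-+ 0 (toℕ x)) (mod-toℕ x))

    *-identityˡ* : ∀ x → 1F *F x ≡ x
    *-identityˡ* x = trans (cong (1F *F_) (sym (mod-toℕ x))) (trans (mod-* 1 (toℕ x)) (trans (cong (_mod p) (ℕ.+-identityʳ (toℕ x))) (mod-toℕ x)))

    -‿inverseʳ* : ∀ x → x +F (-F x) ≡ 0F
    -‿inverseʳ* x = trans (cong (_+F (-F x)) (sym (mod-toℕ x))) (trans (mod-+ (toℕ x) _)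
      (trans (cong (_mod p) (ℕ.m+[n∸m]≡n (ℕ.<⇒≤ (toℕ<n x)))) (mod-cong (trans (n%n≡0 p) (sym (m*n%n≡0 0 p))))))

  F-isCommutativeRing : IsCommutativeRing _≡_ _+F_ _*F_ -F_ 0F 1F
  F-isCommutativeRing = record
    { isRing = record
      { +-isAbelianGroup = record
        { isGroup = record
          { isMonoid = record
            { isSemigroup = record
              { isMagma = record { isEquivalence = isEquivalence ; ∙-cong = cong₂ _+F_ }
              ; assoc = +-assoc* }
            ; identity = +-identityˡ* , λ x → trans (+-comm* x 0F) (+-identityˡ* x) }
          ; inverse = (λ x → trans (+-comm* _ x) (-‿inverseʳ* x)) , -‿inverseʳ*
          ; ⁻¹-cong = cong -F_ }
        ; comm = +-comm* }
      ; *-cong = cong₂ _*F_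
      ; *-assoc = *-assoc*
      ; *-identity = *-identityˡ* , λ x → trans (*-comm* x 1F) (*-identityˡ* x)
      ; distrib = distribˡ* , λ x y z → trans (*-comm* _ x) (trans (distribˡ* x y z) (cong₂ _+F_ (*-comm* x y) (*-comm* x z))) }
    ; *-comm = *-comm* }

  private
    multiple-0 : ∀ q → (q ℕ.* p) mod p ≡ 0F
    multiple-0 q = mod-cong (trans (m*n%n≡0 q p) (sym (m*n%n≡0 0 p)))

    inverse* : Prime p → ∀ x → x ≢ 0F → Σ F λ y → y *F x ≡ 1F
    inverse* pr x x≢0 with coprime-Bézout (prime⇒coprime pr {{ℕ.≢-nonZero λ x≡0 → x≢0 (trans (sym (mod-toℕ x)) (cong (_mod p) x≡0))}} (toℕ<n x))
    ... | Bézout.-+ u v eq = v mod p , (begin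
      (v mod p) *F x                  ≡⟨ cong ((v mod p) *F_) (mod-toℕ x) ⟨
      (v mod p) *F (toℕ x mod p)      ≡⟨ mod-* v (toℕ x) ⟩
      (v ℕ.* toℕ x) mod p             ≡⟨ cong (_mod p) eq ⟨
      (1 ℕ.+ u ℕ.* p) mod p           ≡⟨ mod-+ 1 _ ⟨
      1F +F ((u ℕ.* p) mod p)         ≡⟨ cong (1F +F_) (multiple-0 u) ⟩
      1F +F 0F                        ≡⟨ trans (+-comm* 1F 0F) (+-identityˡ* 1F) ⟩
      1F                              ∎)
      where open ≡-Reasoning
    -- Here 1 + v x = u p, so the inverse is -v.
    ... | Bézout.+- u v eq = (-F (v mod p)) , (begin
      (-F w) *F x                              ≡⟨ +-identityˡ* _ ⟨
      0F +F ((-F w) *F x)                      ≡⟨ cong (_+F ((-F w) *F x)) (trans (sym (multiple-0 u)) (trans (cong (_mod p) (sym eq)) (trans (sym (mod-+ 1 _)) (cong (1F +F_) (trans (sym (mod-* v (toℕ x))) (cong (w *F_) (mod-toℕ x))))))) ⟩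
      (1F +F (w *F x)) +F ((-F w) *F x)        ≡⟨ +-assoc* _ _ _ ⟩
      1F +F ((w *F x) +F ((-F w) *F x))        ≡⟨ cong (1F +F_) (IsCommutativeRing.distribʳ F-isCommutativeRing x w (-F w)) ⟨
      1F +F ((w +F (-F w)) *F x)               ≡⟨ cong (λ z → 1F +F (z *F x)) (-‿inverseʳ* w) ⟩
      1F +F (0F *F x)                          ≡⟨ cong (1F +F_) (IsCommutativeRing.zeroˡ F-isCommutativeRing x) ⟩
      1F +F 0F                                 ≡⟨ trans (+-comm* 1F 0F) (+-identityˡ* 1F) ⟩
      1F                                       ∎)
      where
      open ≡-Reasoning
      w = v mod p

  Fp : Prime p → Field
  Fp pr = record { isCommutativeRing = F-isCommutativeRing ; _≟F_ = _≟_ ; inverse = inverse* pr }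

-- From ports to linear data

module Soundness (p : ℕ) {{p≢0 : NonZero p}} (pr : Prime p) where

  open Over p
  open PrimeField p
  module T = Theory (Fp pr)
  open T using (Port; Sim; Join; JoinI; left; right; atom; _⊢[_]_; sim; join; _▸_; relax; _≈[_]_)

  dot-cong : ∀ {n} (u : Vector F n) {v w : Vector F n} → v ≗ w → dot u v ≡ dot u w
  dot-cong u h = T.sum-cong-≗ (λ k → cong (u k *F_) (h k))

  dot-++ : ∀ {m n} (u v : Vector F m) (u' v' : Vector F n) → dot (u V.++ u') (v V.++ v') ≡ dot u v +F dot u' v'
  dot-++ {zero} u v u' v' = sym (T.+-identityˡ _)
  dot-++ {suc m} u v u' v' = trans
    (cong ((u zero *F v zero) +F_) (trans (T.sum-cong-≗ tl) (dot-++ (u ∘ suc) (v ∘ suc) u' v')))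
    (sym (T.+-assoc _ _ _))
    where
    tl : ∀ k → (u V.++ u') (suc k) *F (v V.++ v') (suc k) ≡ ((u ∘ suc) V.++ u') k *F ((v ∘ suc) V.++ v') k
    tl k with splitAt m k
    ... | inj₁ _ = refl
    ... | inj₂ _ = refl

  dot-0ˡ : ∀ {n} (v : Vector F n) → dot (λ _ → 0F) v ≡ 0F
  dot-0ˡ v = T.sum-ε _ (λ k → T.zeroˡ (v k))

  dot-negˡ : ∀ {n} (u v : Vector F n) → dot (λ k → -F (u k)) v ≡ -F (dot u v)
  dot-negˡ u v = T.+-inverseˡ-unique _ _ (trans (sym (T.∑-distrib-+ (λ k → (-F (u k)) *F v k) (λ k → u k *F v k)))
    (T.sum-ε _ λ k → trans (sym (T.distribʳ (v k) (-F (u k)) (u k))) (trans (cong (_*F v k) (T.-‿inverseˡ (u k))) (T.zeroˡ (v k)))))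

  dot-sub : ∀ {n} (u v w : Vector F n) → dot u (λ k → v k +F (-F (w k))) ≡ dot u v +F (-F (dot u w))
  dot-sub u v w = trans (T.sum-cong-≗ (λ k → T.distribˡ (u k) (v k) (-F (w k))))
    (trans (T.∑-distrib-+ (λ k → u k *F v k) (λ k → u k *F (-F (w k))))
    (cong (dot u v +F_) (T.+-inverseˡ-unique _ _ (trans (sym (T.∑-distrib-+ (λ k → u k *F (-F (w k))) (λ k → u k *F w k)))
      (T.sum-ε _ λ k → trans (sym (T.distribˡ (u k) (-F (w k)) (w k))) (trans (cong (u k *F_) (T.-‿inverseˡ (w k))) (T.zeroʳ (u k))))))))

  dot-· : ∀ {m n} (u : Vector F m) (M : Mat m n) (v : Vector F n) → dot u (M · v) ≡ ΣF (λ r → dot u (λ c → M c r) *F v r)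
  dot-· u M v = begin
    ΣF (λ c → u c *F ΣF (λ r → M c r *F v r))      ≡⟨ T.sum-cong-≗ (λ c → T.*-distribˡ-sum (u c) (λ r → M c r *F v r)) ⟩
    ΣF (λ c → ΣF (λ r → u c *F (M c r *F v r)))    ≡⟨ T.∑-comm (λ c r → u c *F (M c r *F v r)) ⟩
    ΣF (λ r → ΣF (λ c → u c *F (M c r *F v r)))    ≡⟨ T.sum-cong-≗ (λ r → T.sum-cong-≗ (λ c → sym (T.*-assoc (u c) (M c r) (v r)))) ⟩
    ΣF (λ r → ΣF (λ c → (u c *F M c r) *F v r))    ≡⟨ T.sum-cong-≗ (λ r → sym (T.*-distribʳ-sum (v r) (λ c → u c *F M c r))) ⟩
    ΣF (λ r → dot u (λ c → M c r) *F v r)          ∎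
    where open ≡-Reasoning

  δ-refl : ∀ a → δ a a ≡ 1F
  δ-refl a rewrite dec-true (a ℕ.≟ a) refl = refl

  δ-≢ : ∀ {a b} → a ≢ b → δ a b ≡ 0F
  δ-≢ {a} {b} a≢b rewrite dec-false (a ℕ.≟ b) a≢b = refl

  Id : ∀ {n} → Mat n n
  Id c k = δ (toℕ c) (toℕ k)

  Id-· : ∀ {n} (v : Vector F n) c → (Id · v) c ≡ v c
  Id-· v c = trans (T.sum-single c (λ k → δ (toℕ c) (toℕ k) *F v k)
      (λ k k≢c → trans (cong (_*F v k) (δ-≢ (λ e → k≢c (sym (toℕ-injective e))))) (T.zeroˡ (v k))))
    (trans (cong (_*F v c) (δ-refl (toℕ c))) (T.*-identityˡ (v c)))

  -- One-dimensional targets with φ constant in its row argument: only for these can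
  -- the equation of functions in Morphism.comm be proved without extensionality.
  record LinData : Set₁ where
    field
      Ix   : Set
      fin  : Finite Ix
      dim  : ℕ
      Con  : Set
      con  : Con → Vector F dim
      form : Ix → Vector F dim

    datum : Datum
    datum = record { I = Ix ; finI = fin ; n = dim ; R = Con ; cons = con ; dimW = λ _ → 1 ; φ = λ j _ → form j }

  open LinData public

  idMorphism : (D : LinData) → Morphism (datum D) (datum D)
  idMorphism D = record
    { α = just ; θ = Id
    ; θ-into = λ v h r → trans (dot-cong (con D r) (Id-· v)) (h r)
    ; σ = λ _ _ _ → 1F
    ; comm = λ j v _ → cong (λ x _ → x) (trans (T.+-identityʳ _) (trans (T.*-identityˡ _) (sym (dot-cong (form D j) (Id-· v))))) }

  δ₁ : ∀ (c c' : Fin 1) → 1F ≡ δ (toℕ c) (toℕ c')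
  δ₁ zero zero = refl

  module _ (D : LinData) (S : Ix D → Bool) where

    private
      keep : ∀ x b → S x ≡ b → List (Σ (Ix D) λ j → S j ≡ false) → List (Σ (Ix D) λ j → S j ≡ false)
      keep x true _ ks = ks
      keep x false e ks = (x , e) ∷ ks

      keep-here : ∀ x b e ks (q : S x ≡ false) → (x , q) ∈ keep x b e ks
      keep-here x true e ks q with () ← trans (sym e) q
      keep-here x false e ks q = here (cong (x ,_) (≡-irrelevant q e))

      keep-there : ∀ x b e {ks j} → j ∈ ks → j ∈ keep x b e ks
      keep-there x true e j∈ = j∈
      keep-there x false e j∈ = there j∈

      kept : List (Ix D) → List (Σ (Ix D) λ j → S j ≡ false)
      kept [] = []
      kept (x ∷ xs) = keep x (S x) refl (kept xs)

      ∈-kept : ∀ {xs j} → j ∈ xs → (q : S j ≡ false) → (j , q) ∈ kept xs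
      ∈-kept {x ∷ xs} (here refl) q = keep-here x (S x) refl (kept xs) q
      ∈-kept {x ∷ xs} (there j∈) q = keep-there x (S x) refl (∈-kept j∈ q)

    finite-join : Finite (SelfJoinI (datum D) S)
    finite-join = (map (false ,_) ks ++ map (true ,_) ks) , λ
      { (false , j , q) → ∈-++⁺ˡ (∈-map⁺ (false ,_) (∈-kept (proj₂ (fin D) j) q))
      ; (true , j , q) → ∈-++⁺ʳ (map (false ,_) ks) (∈-map⁺ (true ,_) (∈-kept (proj₂ (fin D) j) q)) }
      where ks = kept (proj₁ (fin D))

    joinData : LinData
    joinData = record
      { Ix = SelfJoinI (datum D) S
      ; fin = finite-join
      ; dim = dim D ℕ.+ dim D
      ; Con = (Con D ⊎ Con D) ⊎ (Σ (Ix D) λ j → (S j ≡ true) × Fin 1)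
      ; con = λ { (inj₁ (inj₁ r)) → con D r V.++ (λ _ → 0F)
                ; (inj₁ (inj₂ r)) → (λ _ → 0F) V.++ con D r
                ; (inj₂ (j , _ , _)) → form D j V.++ (λ k → -F (form D j k)) }
      ; form = λ { (false , j , _) → form D j V.++ (λ _ → 0F)
                 ; (true , j , _) → (λ _ → 0F) V.++ form D j } }

    -- Trades the self-joining, whose maps are defined by cases on the index, for a datum of the
    -- shape of `LinData` at no cost.
    joinMorphism : Morphism (datum joinData) (selfJoin (datum D) S finite-join)
    joinMorphism = record
      { α = just ; θ = Id
      ; θ-into = λ { v h (inj₁ (inj₁ r)) → trans (dot-cong (con joinData (inj₁ (inj₁ r))) (Id-· v)) (h (inj₁ (inj₁ r)))
                   ; v h (inj₁ (inj₂ r)) → trans (dot-cong (con joinData (inj₁ (inj₂ r))) (Id-· v)) (h (inj₁ (inj₂ r)))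
                   ; v h (inj₂ r) → trans (dot-cong (con joinData (inj₂ r)) (Id-· v)) (h (inj₂ r)) }
      ; σ = λ _ _ _ → 1F
      ; comm = λ { (false , j) v _ → cong (λ x _ → x) (trans (T.+-identityʳ _) (trans (T.*-identityˡ _) (sym (dot-cong (form joinData (false , j)) (Id-· v)))))
                 ; (true , j) v _ → cong (λ x _ → x) (trans (T.+-identityʳ _) (trans (T.*-identityˡ _) (sym (dot-cong (form joinData (true , j)) (Id-· v))))) } }

  -- `θ` is a mere map of sets. `nothing` stands for the output index; `only-i` later becomes the
  -- condition that no second index is sent to `△`, which respecting `i` requires.
  record Realises (Y : Port) (D : LinData) (i : Ix D) : Set where
    field
      θ     : T.P Y → Vector F (dim D)
      inV   : ∀ x r → dot (con D r) (θ x) ≡ 0F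
      out-θ : ∀ x → dot (form D i) (θ x) ≡ T.out Y x
      α     : Ix D → Maybe (T.I Y)
      α-i   : α i ≡ nothing
      only-i : ∀ j → α j ≡ nothing → j ≡ i
      dep   : ∀ j κ → α j ≡ just κ → ∀ x y → T.rel Y κ x y → dot (form D j) (θ x) ≡ dot (form D j) (θ y)

  realises-sim : ∀ {Y Y' D i} → Sim Y' Y → Realises Y D i → Realises Y' D i
  realises-sim {Y} {Y'} {D} {i} s R = record
    { θ = λ x → R.θ (S.θ x)
    ; inV = λ x → R.inV (S.θ x)
    ; out-θ = λ x → trans (R.out-θ (S.θ x)) (S.out-θ x)
    ; α = λ j → f (R.α j)
    ; α-i = cong f R.α-i
    ; only-i = λ j e → R.only-i j (f-nothing (R.α j) e)
    ; dep = λ j κ e x y r → go j κ (R.α j) refl e x y r }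
    where
    module R = Realises R
    module S = Sim s
    f : Maybe (T.I Y) → Maybe (T.I Y')
    f nothing = nothing
    f (just ι) = just (proj₁ (S.dep ι))
    f-nothing : ∀ m → f m ≡ nothing → m ≡ nothing
    f-nothing nothing _ = refl
    go : ∀ j κ m → R.α j ≡ m → f m ≡ just κ → ∀ x y → T.rel Y' κ x y → dot (form D j) (R.θ (S.θ x)) ≡ dot (form D j) (R.θ (S.θ y))
    go j κ (just ι) e refl x y r = R.dep j ι e _ _ (proj₂ (S.dep ι) x y r)

  module _ {Y : Port} {D : LinData} {i : Ix D} (S : T.I Y → Bool) (R : Realises Y D i) where
    private
      module R = Realises R
      S̃ : Ix D → Bool
      S̃ j = maybe S false (R.α j)
      i∉ : S̃ i ≡ false
      i∉ = cong (maybe S false) R.α-i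

      αL αR : ∀ m → maybe S false m ≡ false → Maybe (JoinI Y S)
      αL nothing _ = nothing
      αL (just ι) q = just (left ι q)
      αR nothing _ = just atom
      αR (just ι) q = just (right ι q)

      αL-nothing : ∀ m q → αL m q ≡ nothing → m ≡ nothing
      αL-nothing nothing _ _ = refl

      αR-just : ∀ m q → αR m q ≢ nothing
      αR-just nothing _ ()
      αR-just (just _) _ ()

      αL-α-i : ∀ m q → m ≡ nothing → αL m q ≡ nothing
      αL-α-i nothing _ _ = refl

      index-≡ : ∀ {j} (q : S̃ j ≡ false) → j ≡ i → _≡_ {A = SelfJoinI (datum D) S̃} (false , j , q) (false , i , i∉)
      index-≡ q refl = cong (λ q' → false , i , q') (≡-irrelevant q i∉)

      θ' : T.P (Join Y S) → Vector F (dim D ℕ.+ dim D)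
      θ' ((x , x') , _) = R.θ x V.++ R.θ x'

      fst snd : T.P (Join Y S) → Vector F (dim D)
      fst ((x , _) , _) = R.θ x
      snd ((_ , x') , _) = R.θ x'

      dotL : ∀ (u : Vector F (dim D)) x → dot (u V.++ (λ (_ : Fin (dim D)) → 0F)) (θ' x) ≡ dot u (fst x)
      dotL u x = trans (dot-++ u (fst x) (λ _ → 0F) (snd x)) (trans (cong (dot u (fst x) +F_) (dot-0ˡ (snd x))) (T.+-identityʳ _))

      dotR : ∀ (u : Vector F (dim D)) x → dot ((λ (_ : Fin (dim D)) → 0F) V.++ u) (θ' x) ≡ dot u (snd x)
      dotR u x = trans (dot-++ (λ _ → 0F) (fst x) u (snd x)) (trans (cong (_+F dot u (snd x)) (dot-0ˡ (fst x))) (T.+-identityˡ _))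

      agrees : ∀ (x : T.P (Join Y S)) j m → R.α j ≡ m → maybe S false m ≡ true →
               dot (form D j) (fst x) ≡ dot (form D j) (snd x)
      agrees x j (just κ) e q = R.dep j κ e _ _ (proj₂ x κ q)

      depL : ∀ j m (q : maybe S false m ≡ false) → R.α j ≡ m → ∀ κ → αL m q ≡ just κ → ∀ x y → T.rel (Join Y S) κ x y →
             dot (form D j) (fst x) ≡ dot (form D j) (fst y)
      depL j (just ι) q e _ refl x y r = R.dep j ι e _ _ r

      depR : ∀ j m (q : maybe S false m ≡ false) → R.α j ≡ m → ∀ κ → αR m q ≡ just κ → ∀ x y → T.rel (Join Y S) κ x y →
             dot (form D j) (snd x) ≡ dot (form D j) (snd y)
      depR j (just ι) q e _ refl x y r = R.dep j ι e _ _ r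
      depR j nothing q e _ refl x y r rewrite R.only-i j e = trans (R.out-θ _) (trans r (sym (R.out-θ _)))

    -- The glued set is pulled back along `α`. It misses `i`, so the left copy of `i` stays the
    -- output and the right copy is sent to `atom`.
    realises-join : Realises (Join Y S) (joinData D S̃) (false , i , i∉)
    realises-join = record
      { θ = θ'
      ; inV = λ { x (inj₁ (inj₁ r)) → trans (dotL (con D r) x) (R.inV _ r)
                ; x (inj₁ (inj₂ r)) → trans (dotR (con D r) x) (R.inV _ r)
                ; x (inj₂ (j , q , _)) → trans (dot-++ (form D j) (fst x) (λ k → -F (form D j k)) (snd x)) (trans (cong₂ _+F_ (agrees x j _ refl q) (dot-negˡ (form D j) (snd x))) (T.-‿inverseʳ (dot (form D j) (snd x)))) }
      ; out-θ = λ x → trans (dotL (form D i) x) (R.out-θ _)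
      ; α = α'
      ; α-i = αL-α-i (R.α i) i∉ R.α-i
      ; only-i = λ { (false , j , q) e → index-≡ q (R.only-i j (αL-nothing (R.α j) q e))
                   ; (true , j , q) e → ⊥-elim (αR-just (R.α j) q e) }
      ; dep = λ { (false , j , q) κ e x y r → trans (dotL (form D j) x) (trans (depL j (R.α j) q refl κ e x y r) (sym (dotL (form D j) y)))
                ; (true , j , q) κ e x y r → trans (dotR (form D j) x) (trans (depR j (R.α j) q refl κ e x y r) (sym (dotR (form D j) y))) } }
      where
      α' : SelfJoinI (datum D) S̃ → Maybe (JoinI Y S)
      α' (false , j , q) = αL (R.α j) q
      α' (true , j , q) = αR (R.α j) q

  Derived : (D : LinData) → Ix D → ℕ → Port → Set₂
  Derived D i n Y' = Σ LinData λ D' → Σ (Ix D') λ i' → Σ (PMap (datum D') (datum D)) λ γ →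
    γ i' (i , false) × Derives (datum D) (datum D') n γ × Realises Y' D' i'

  id-respects : ∀ D i → fromMorphism (idMorphism D) i (i , false)
  id-respects D i = refl , refl , (i , refl , (λ _ → just-injective) , refl , δ₁)

  -- The output is always followed through the left copy, so its bit stays `false` throughout.
  sound : ∀ {Y Y' n D i} → Y ⊢[ n ] Y' → Realises Y D i → Derived D i n Y'
  sound {D = D} {i} (sim s) R = D , i , _ , id-respects D i , morph (idMorphism D) , realises-sim s R
  sound {D = D} {i} (join S) R = joinData D _ , _ , _ ,
    (_ , false , false , (refl , refl , (_ , refl , (λ _ → just-injective) , refl , δ₁)) , (refl , refl) , refl) ,
    compose (join (datum D) _ _) (morph (joinMorphism D _)) , realises-join S R
  sound (d ▸ e) R =
    let D₁ , i₁ , γ₁ , h₁ , d₁ , R₁ = sound d R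
        D₂ , i₂ , γ₂ , h₂ , d₂ , R₂ = sound e R₁
    in D₂ , i₂ , _ , (i₁ , false , false , h₂ , h₁ , refl) , compose d₁ d₂ , R₂
  sound (relax m≤n d) R =
    let D₁ , i₁ , γ₁ , h₁ , d₁ , R₁ = sound d R
    in D₁ , i₁ , _ , h₁ , weaken d₁ m≤n (λ _ _ r → r) , R₁

  module _ {s : ℕ} {D : LinData} {i : Ix D} (R : Realises (T.gc s) D i) where
    private
      module R = Realises R
      e : Fin (suc s) → Vector F (suc s)
      e r c = δ (toℕ c) (toℕ r)
      o : Vector F (suc s)
      o _ = 0F

      -- Linearity is recovered from the values of `θ` at 0 and the basis vectors: the constraints
      -- vanish at all of them, form `i` grows by 1 along each basis vector, and a form depending on
      -- `w` off `r` does not change along the vector `r`.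
      Θ : Mat (dim D) (suc s)
      Θ c r = R.θ (e r) c +F (-F (R.θ o c))

      coef : Vector F (dim D) → Vector F (suc s)
      coef u r = dot u (λ c → Θ c r)

      coef-sub : ∀ u r → coef u r ≡ dot u (R.θ (e r)) +F (-F (dot u (R.θ o)))
      coef-sub u r = dot-sub u (R.θ (e r)) (R.θ o)

      cancel : ∀ {a b} → a ≡ b → a +F (-F b) ≡ 0F
      cancel refl = T.-‿inverseʳ _

      sum-e : ∀ r → ΣF (e r) ≡ 1F
      sum-e r = trans (T.sum-single r (e r) (λ k k≢r → δ-≢ (λ q → k≢r (toℕ-injective q)))) (δ-refl (toℕ r))

      coef-i : ∀ r → coef (form D i) r ≡ 1F
      coef-i r = trans (coef-sub (form D i) r)
        (trans (cong₂ (λ a b → a +F (-F b)) (trans (R.out-θ (e r)) (sum-e r)) (trans (R.out-θ o) (T.sum-ε o λ _ → refl)))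
        (trans (cong (1F +F_) T.-0#≈0#) (T.+-identityʳ 1F)))

      coef-dep : ∀ j r → R.α j ≡ just r → coef (form D j) r ≡ 0F
      coef-dep j r q = trans (coef-sub (form D j) r) (cancel (R.dep j r q (e r) o (λ c c≢r → δ-≢ (λ w → c≢r (toℕ-injective w)))))

      conv : Maybe (Fin (suc s)) → Maybe (Maybe (Fin (suc s)))
      conv = just

      σ' : ∀ j m → Mat 1 (dimW* (gc s) (conv m))
      σ' j nothing _ _ = 1F
      σ' j (just r) _ c = coef (form D j) (punchIn r c)

      omit : ∀ r v (c : Fin s) → (φ (gc s) (just r) · v) c ≡ v (punchIn r c)
      omit r v c = trans (T.sum-single (punchIn r c) _
          (λ k q → trans (cong (_*F v k) (δ-≢ (λ w → q (toℕ-injective w)))) (T.zeroˡ (v k))))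
        (trans (cong (_*F v (punchIn r c)) (δ-refl (toℕ (punchIn r c)))) (T.*-identityˡ _))

      comm' : ∀ j m → R.α j ≡ m → ∀ v → σ' j m · (φ* (gc s) (conv m) · v) ≡ (λ _ → dot (form D j) (Θ · v))
      comm' j nothing q v rewrite R.only-i j q = cong (λ x _ → x) (trans (T.+-identityʳ _) (trans (T.*-identityˡ _)
        (trans (T.sum-cong-≗ (λ r → cong (_*F v r) (sym (coef-i r)))) (sym (dot-· (form D i) Θ v)))))
      comm' j (just r) q v = cong (λ x _ → x) (trans (T.sum-cong-≗ (λ c → cong (coef (form D j) (punchIn r c) *F_) (omit r v c)))
        (trans (sym (T.+-identityˡ (ΣF (λ c → coef (form D j) (punchIn r c) *F v (punchIn r c))))) (trans (cong (_+F ΣF (λ c → coef (form D j) (punchIn r c) *F v (punchIn r c))) (sym (trans (cong (_*F v r) (coef-dep j r q)) (T.zeroˡ (v r)))))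
        (trans (sym (T.sum-remove {i = r} (λ k → coef (form D j) k *F v k))) (sym (dot-· (form D j) Θ v))))))

    gcMorphism : Morphism (gc s) (datum D)
    gcMorphism = record
      { α = λ j → conv (R.α j) ; θ = Θ
      ; θ-into = λ v _ r → trans (dot-· (con D r) Θ v) (T.sum-ε _ λ c → trans (cong (_*F v c)
          (trans (coef-sub (con D r) c) (cancel (trans (R.inV (e c) r) (sym (R.inV o r)))))) (T.zeroˡ (v c)))
      ; σ = λ j → σ' j (R.α j)
      ; comm = λ j v _ → comm' j (R.α j) refl v }

    gc-respects : fromMorphism gcMorphism △ (i , false)
    gc-respects = refl , cong just R.α-i , (nothing , cong just R.α-i , (λ j' q → R.only-i j' (just-injective q)) ,
      cong (λ m → dimW* (gc s) (just m)) (sym R.α-i) , σδ (R.α i) R.α-i)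
      where
      σδ : ∀ m → m ≡ nothing → ∀ c c' → σ' i m c c' ≡ δ (toℕ c) (toℕ c')
      σδ nothing _ c c' = δ₁ c c'

  derives-gc : ∀ {Y n s D i} → Realises Y D i → Y ⊢[ n ] T.gc s →
               Σ (PMap (gc s) (datum D)) λ γ → γ △ (i , false) × Derives (datum D) (gc s) n γ
  derives-gc {n = n} R d =
    let D' , i' , γ , h , d' , R' = sound d R
    in _ , (i' , false , false , gc-respects R' , h , refl) ,
       weaken (compose d' (morph (gcMorphism R'))) (ℕ.≤-reflexive (ℕ.+-identityʳ n)) (λ _ _ r → r)

open import Data.Nat using (_+_; _*_)

-- The bound

n<2^1+log : ∀ n → n < 2 ^ suc ⌊log₂ n ⌋
n<2^1+log = <-rec _ step
  where
  step : ∀ n → (∀ {m} → m < n → m < 2 ^ suc ⌊log₂ m ⌋) → n < 2 ^ suc ⌊log₂ n ⌋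
  step 0 _ = s≤s z≤n
  step 1 _ = s≤s (s≤s z≤n)
  step n@(suc (suc n')) rec = begin-strict
    n                                ≡⟨ ℕ.⌊n/2⌋+⌈n/2⌉≡n n ⟨
    ⌊ n /2⌋ + ⌈ n /2⌉                ≤⟨ ℕ.+-monoʳ-≤ ⌊ n /2⌋ (ceil n) ⟩
    ⌊ n /2⌋ + suc ⌊ n /2⌋            <⟨ ℕ.+-mono-<-≤ half half ⟩
    2 ^ l + 2 ^ l                    ≡⟨ cong ((2 ^ l) +_) (ℕ.+-identityʳ (2 ^ l)) ⟨
    2 ^ suc l                        ∎
    where
    open ℕ.≤-Reasoning
    l = ⌊log₂ n ⌋
    ceil : ∀ n → ⌈ n /2⌉ ≤ suc ⌊ n /2⌋
    ceil 0 = z≤n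
    ceil 1 = ℕ.≤-refl
    ceil (suc (suc n)) = s≤s (ceil n)
    l≥1 : 1 ≤ l
    l≥1 = ⌊log₂⌋-mono-≤ {2} {n} (s≤s (s≤s z≤n))
    half : ⌊ n /2⌋ < 2 ^ l
    half = ℕ.<-≤-trans (rec (ℕ.⌊n/2⌋<n (suc n'))) (ℕ.≤-reflexive (cong (2 ^_) (trans (cong suc (⌊log₂⌊n/2⌋⌋≡⌊log₂n⌋∸1 n)) (ℕ.m+[n∸m]≡n l≥1))))

-- L ≤ 2 ^ (l + 1) and l + 1 ≤ 2 ^ (m + 1); squaring L doubles the exponent, which makes m + 2.
L²≤2^2^ : ∀ L → L * L ≤ 2 ^ (2 ^ (2 + ⌊log₂ ⌊log₂ (10 * L) ⌋ ⌋))
L²≤2^2^ L = begin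
  L * L                            ≤⟨ ℕ.*-mono-≤ L≤ L≤ ⟩
  2 ^ suc l * 2 ^ suc l            ≡⟨ ℕ.^-distribˡ-+-* 2 (suc l) (suc l) ⟨
  2 ^ (suc l + suc l)              ≤⟨ ℕ.^-monoʳ-≤ 2 (ℕ.+-mono-≤ (n<2^1+log l) (n<2^1+log l)) ⟩
  2 ^ (2 ^ suc m + 2 ^ suc m)      ≡⟨ cong (λ x → 2 ^ (2 ^ suc m + x)) (ℕ.+-identityʳ (2 ^ suc m)) ⟨
  2 ^ (2 ^ (2 + m))                ∎
  where
  open ℕ.≤-Reasoning
  l = ⌊log₂ (10 * L) ⌋
  m = ⌊log₂ l ⌋
  L≤ : L ≤ 2 ^ suc l
  L≤ = ℕ.≤-trans (ℕ.m≤m+n L (9 * L)) (ℕ.<⇒≤ (n<2^1+log (10 * L)))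

-- In units of k Λ the gadgets of a level cost 4 * 7, as there are u + v + 7 ≤ 7 Λ rounds, and
-- closing the cycle at most 2, together 30. The sweeps contribute 2 + 30 + 30 = 62, taken k * k
-- times, the initial joins and the last level 1 + 30 = 31, and 62 + 31 = 93.
totalCost≤ : ∀ k u v → 1 ≤ k → totalCost k (suc u) (2 + v) ≤ 93 * (k ^ 3) * (u + v + 1)
totalCost≤ k u v 1≤k = begin
  k * 1 + (k * (k * (2 + (cost + cost))) + cost)                              ≤⟨ ℕ.+-mono-≤ k≤ (ℕ.+-mono-≤ (ℕ.*-monoʳ-≤ k (ℕ.*-monoʳ-≤ k (ℕ.+-mono-≤ 2≤ (ℕ.+-mono-≤ cost≤ cost≤)))) cost≤) ⟩
  k * Λ + (k * (k * (2 * (k * Λ) + (30 * (k * Λ) + 30 * (k * Λ)))) + 30 * (k * Λ))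
    ≡⟨ solve 2 (λ k l → k :* l :+ (k :* (k :* (con 2 :* (k :* l) :+ (con 30 :* (k :* l) :+ con 30 :* (k :* l)))) :+ con 30 :* (k :* l))
                     := con 31 :* (k :* l) :+ con 62 :* (k :* (k :* (k :* con 1)) :* l)) refl k Λ ⟩
  31 * (k * Λ) + 62 * (k ^ 3 * Λ)                                             ≤⟨ ℕ.+-monoˡ-≤ (62 * (k ^ 3 * Λ)) (ℕ.*-monoʳ-≤ 31 (ℕ.*-monoˡ-≤ Λ k≤k³)) ⟩
  31 * (k ^ 3 * Λ) + 62 * (k ^ 3 * Λ)                                         ≡⟨ ℕ.*-distribʳ-+ (k ^ 3 * Λ) 31 62 ⟨
  93 * (k ^ 3 * Λ)                                                            ≡⟨ ℕ.*-assoc 93 (k ^ 3) Λ ⟨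
  93 * (k ^ 3) * Λ                                                            ∎
  where
  open ℕ.≤-Reasoning
  open +-*-Solver
  Λ = u + v + 1
  q = suc u
  cost = levelCost k q (2 + v)
  1≤Λ : 1 ≤ Λ
  1≤Λ = ℕ.m≤n+m 1 (u + v)
  1≤kΛ : 1 ≤ k * Λ
  1≤kΛ = ℕ.*-mono-≤ 1≤k 1≤Λ
  k≤ : k * 1 ≤ k * Λ
  k≤ = ℕ.*-monoʳ-≤ k 1≤Λ
  2≤ : 2 ≤ 2 * (k * Λ)
  2≤ = ℕ.*-monoʳ-≤ 2 1≤kΛ
  k≤k³ : k ≤ k ^ 3
  k≤k³ = ℕ.≤-trans (ℕ.≤-reflexive (sym (ℕ.*-identityʳ k))) (ℕ.*-monoʳ-≤ k (ℕ.*-mono-≤ 1≤k (ℕ.*-mono-≤ 1≤k (ℕ.≤-refl {1}))))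
  H≤ : suc (q + (3 + (2 + v))) ≤ 7 * Λ
  H≤ = ℕ.≤-trans (ℕ.m≤m+n _ (6 * u + 6 * v)) (ℕ.≤-reflexive (solve 2 (λ u v → con 1 :+ (con 1 :+ u :+ (con 3 :+ (con 2 :+ v))) :+ (con 6 :* u :+ con 6 :* v) := con 7 :* (u :+ v :+ con 1)) refl u v))
  q≤ : suc q ≤ 2 * (k * Λ)
  q≤ = ℕ.≤-trans (ℕ.≤-trans (ℕ.m≤m+n _ (u + 2 * v)) (ℕ.≤-reflexive (solve 2 (λ u v → con 2 :+ u :+ (u :+ con 2 :* v) := con 2 :* (u :+ v :+ con 1)) refl u v)))
    (ℕ.*-monoʳ-≤ 2 (ℕ.≤-trans (ℕ.≤-reflexive (sym (ℕ.*-identityˡ Λ))) (ℕ.*-monoˡ-≤ Λ 1≤k)))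
  cost≤ : cost ≤ 30 * (k * Λ)
  cost≤ = ℕ.≤-trans (ℕ.+-mono-≤ (ℕ.*-monoʳ-≤ k (ℕ.*-monoˡ-≤ 4 H≤)) q≤)
    (ℕ.≤-reflexive (solve 2 (λ k l → k :* (con 7 :* l :* con 4) :+ con 2 :* (k :* l) := con 30 :* (k :* l)) refl k Λ))

module Assembly (p : ℕ) {{_ : NonZero p}} (pr : Prime p) (k' d : ℕ) (A : Over.Mat p (suc k') d) (i : Fin (suc k')) (s : ℕ)
  (isS : Over.IsS p A i s) (allS : ∀ j → Σ ℕ λ t → Over.IsS p A j t × t ≤ suc s)
  (L : ℕ) (a : Fin (suc k') → Fin d → ℤ) (bound : ∀ j ℓ → ∣ a j ℓ ∣ ≤ L) (lift : Over.IntLift p A a) where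
  open Over p using (PMap; Derives; △; systemDatum; ℤ→F; 1F; -F_; _+F_)
  open PrimeField p using (Fp; mod-+)
  module T = Theory (Fp pr)
  module E = T.Forms A
  module S = Soundness p pr

  fromℕ-mod : ∀ n → T.fromℕ n ≡ n mod p
  fromℕ-mod zero = refl
  fromℕ-mod (suc n) = trans (cong (1F +F_) (fromℕ-mod n)) (mod-+ 1 n)

  entry : ∀ z → ∣ z ∣ ≤ L → E.Entry L (ℤ→F z)
  entry (fromNat n) h = n , h , inj₁ (sym (fromℕ-mod n))
  entry -[1+ n ] h = suc n , h , inj₂ (cong -F_ (sym (fromℕ-mod (suc n))))

  entries : ∀ l c → E.Entry L (A l c)
  entries l c = subst (E.Entry L) (sym (lift l c)) (entry (a l c) (bound l c))

  ¬spanᵢ : ∀ n → s < n → ¬ E.InSpan i n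
  ¬spanᵢ n s<n h = ℕ.<⇒≱ s<n (proj₂ isS n h)

  ¬span : ∀ j n → suc s < n → ¬ E.InSpan j n
  ¬span j n s<n h with t , (_ , max) , t≤ ← allS j = ℕ.<⇒≱ s<n (ℕ.≤-trans (max n h) t≤)

  module M = T.Main A i s ¬spanᵢ ¬span
  k h q : ℕ
  k = suc k'
  h = 2 + ⌊log₂ ⌊log₂ (10 * L) ⌋ ⌋
  q = suc ⌊log₂ k ⌋

  derivation : M.Sys i (M.Others i T.Atom) T.⊢[ totalCost k q h ] T.gc s
  derivation = M.main h q L entries (L²≤2^2^ L) (ℕ.<⇒≤ (n<2^1+log k))

  D : S.LinData
  D = record { Ix = Fin k ; fin = finite-Fin k ; dim = d ; Con = Over.Datum.R (systemDatum k d A)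
             ; con = Over.Datum.cons (systemDatum k d A) ; form = A }

  realises : S.Realises (M.Sys i (M.Others i T.Atom)) D i
  realises = record
    { θ = proj₁
    ; inV = λ _ ()
    ; out-θ = λ _ → refl
    ; α = λ j → lift' j (atomI (j ≟ i))
    ; α-i = cong (lift' i) (atomI-i (i ≟ i))
    ; only-i = λ j e → only-i (j ≟ i) (lift'-nothing j (atomI (j ≟ i)) e)
    ; dep = λ j κ e x y r → depends j (atomI (j ≟ i)) κ e x y r
    }
    where
    open T using (pick)
    open E using (φ)
    Y = M.Sys i (M.Others i T.Atom)
    atomI : ∀ {j} (dec : Dec (j ≡ i)) → Maybe (T.I (pick dec T.Atom))
    atomI (yes _) = nothing
    atomI (no _) = just tt
    atomI-i : (dec : Dec (i ≡ i)) → atomI dec ≡ nothing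
    atomI-i (yes _) = refl
    atomI-i (no ne) = ⊥-elim (ne refl)
    only-i : ∀ {j} (dec : Dec (j ≡ i)) → atomI dec ≡ nothing → j ≡ i
    only-i (yes e) _ = e
    lift' : ∀ j → Maybe (T.I (M.Others i T.Atom j)) → Maybe (T.I Y)
    lift' j (just ι) = just (inj₂ (j , ι))
    lift' j nothing = nothing
    lift'-nothing : ∀ j m → lift' j m ≡ nothing → m ≡ nothing
    lift'-nothing j nothing _ = refl
    same-out : ∀ {j} (dec : Dec (j ≡ i)) ι z z' → T.rel (pick dec T.Atom) ι z z' → T.out (pick dec T.Atom) z ≡ T.out (pick dec T.Atom) z'
    same-out (no _) ι z z' r = r
    depends : ∀ j m κ → lift' j m ≡ just κ → ∀ (x y : T.P Y) → T.rel Y κ x y → φ j (proj₁ x) ≡ φ j (proj₁ y)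
    depends j (just ι) _ refl (v , z , ok) (v' , z' , ok') r = trans (ok j) (trans (same-out (j ≟ i) ι (z j) (z' j) r) (sym (ok' j)))

  proof : Σ ℕ λ M → (M ≤ 93 * (k ^ 3) * (⌊log₂ k ⌋ + ⌊log₂ ⌊log₂ (10 * L) ⌋ ⌋ + 1))
    × Σ (PMap (Over.gc p s) (systemDatum k d A)) λ γ → Σ Bool λ b → γ (△) (i , b) × Derives (systemDatum k d A) (Over.gc p s) M γ
  proof = let γ , △↦i , der = S.derives-gc {n = totalCost k q h} realises derivation in
    totalCost k q h , totalCost≤ k ⌊log₂ k ⌋ ⌊log₂ ⌊log₂ (10 * L) ⌋ ⌋ (s≤s z≤n) , γ , false , △↦i , der

theorem3p7 : Σ ℕ λ C →
    ∀ (p : ℕ) {{_ : NonZero p}} → Prime p →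
    (k d : ℕ) (A : Over.Mat p k d) (i : Fin k) (s : ℕ) →
    Over.IsS p A i s →
    (∀ j → Σ ℕ λ t → Over.IsS p A j t × t ≤ suc s) →
    (L : ℕ) (a : Fin k → Fin d → ℤ) →
    (∀ j ℓ → ∣ a j ℓ ∣ ≤ L) →
    Over.IntLift p A a →
    Σ ℕ λ M → (M ≤ C * (k ^ 3) * (⌊log₂ k ⌋ + ⌊log₂ ⌊log₂ (10 * L) ⌋ ⌋ + 1))
    × Σ (Over.PMap p (Over.gc p s) (Over.systemDatum p k d A)) λ γ →
    Σ Bool λ b → γ (Over.△ p) (i , b)
    × Over.Derives p (Over.systemDatum p k d A) (Over.gc p s) M γ
theorem3p7 = 93 , λ { p pr k@(suc k') d A i s isS allS L a bound lift → Assembly.proof p pr k' d A i s isS allS L a bound lift }
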